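{- Let $K$ be a field of characteristic $0$ with henselian valuation ring $A$, maximal ideal $\mathfrak{m}_A$, valuation $v$ and residue field of characteristic $p>0$, containing a primitive $p$-th root of unity $\zeta$; put $\mathfrak{z}=\zeta-1$. Let $L|K$ be a Kummer extension of degree $p$ with defect $p$, $B$ the integral closure of $A$ in $L$. Let $\mathfrak{A}'=\{h\in\mathfrak{A}: h\in A^\times,\ h-1\in\mathfrak{m}_A\}$ and $\mathscr{S}=\{\alpha\in L:\alpha^p\in\mathfrak{A}'\}$. For each $\alpha\in\mathscr{S}$ there is $\alpha'\in B^\times\cap(\alpha-1)K^\times$, namely $\alpha'=\gamma_\alpha(\alpha-1)/\mathfrak{z}$ with $\gamma_\alpha\in A$ chosen so that $\alpha'\in B^\times$, such that $B=\bigcup_{\alpha\in\mathscr{S}}A[\alpha']$ is a filtered union, i.e.: (i) for any $\alpha_1,\alpha_2\in\mathscr{S}$, either $A[\alpha_1']\subset A[\alpha_2']$ or $A[\alpha_2']\subset A[\alpha_1']$; (ii) for every $\beta\in B$ there exists $\alpha\in\mathscr{S}$ with $\beta\in A[\alpha']$.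
   Context: $\mathfrak{A}$ is the set of $h\in K$ such that the solutions of $X^p=h$ generate $L$ over $K$. With $w$ the extension of $v$ to $L$, $k,l$ the residue fields, $e=(w(L^\times):v(K^\times))$, $f=[l:k]$, the defect $d$ is given by $p=def$; here $d=p$ (so $e=f=1$). The ring $A[\alpha']$ does not depend on the choice of $\gamma_\alpha$. -}

module Defs where

open import Level using (Level; suc)
open import Algebra.Bundles using (CommutativeRing; CommutativeSemiring; AbelianGroup)
open import Algebra.Morphism.Structures using (module RingMorphisms)
import Algebra.Definitions.RawSemiring as RawSemiringDefs
import Algebra.Properties.CommutativeSemigroup as CommutativeSemigroupProperties
import Algebra.Properties.Ring as RingProperties
open import Data.Nat.Base using (ℕ; _<_) renaming (suc to 1+_; _*_ to _ℕ*_)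
open import Data.Nat.Divisibility using (_∣_)
open import Data.Fin.Base using (Fin)
open import Data.List.Base using (List; []; _∷_; _++_; map)
open import Data.List.Relation.Unary.All using (All)
open import Data.Product using (∃; ∃!; _×_; _,_; proj₁; proj₂)
open import Data.Sum.Base using (_⊎_; [_,_]′)
open import Function.Bundles using (_⇔_; module Equivalence)
open import Relation.Binary.PropositionalEquality.Core using (_≡_)
import Relation.Binary.Reasoning.Setoid as SetoidReasoning
open import Relation.Nullary.Negation using (¬_)
open import Relation.Unary using (Pred; _∈_; _∉_)

------------------------------------------------------------------------
-- Commutative rings

module RingDefs {ℓ : Level} (R : CommutativeRing ℓ ℓ) where
  open CommutativeRing R
  open RawSemiringDefs (CommutativeSemiring.rawSemiring commutativeSemiring) public
    using (_^_; sum) renaming (_×_ to _·_)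

  HasCharacteristic : ℕ → Set ℓ
  HasCharacteristic n = ∀ m → m · 1# ≈ 0# ⇔ n ∣ m

  IsPrimitiveRootOfUnity : ℕ → Carrier → Set ℓ
  IsPrimitiveRootOfUnity n ζ =
    ζ ^ n ≈ 1# × (∀ m → 0 < m → m < n → ¬ (ζ ^ m ≈ 1#))

  -- The list a₀ ∷ a₁ ∷ … ∷ aₙ ∷ [] stands for a₀ + a₁X + … + aₙXⁿ.
  eval : List Carrier → Carrier → Carrier
  eval []       x = 0#
  eval (a ∷ as) x = a + x * eval as x

  -- a₀ ∷ … ∷ aₙ₋₁ ∷ [] gives a₀ + … + aₙ₋₁Xⁿ⁻¹ + Xⁿ.
  monic : List Carrier → List Carrier
  monic as = as ++ 1# ∷ []

  derivative : List Carrier → List Carrier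
  derivative []       = []
  derivative (_ ∷ as) = scale 1 as
    where
    scale : ℕ → List Carrier → List Carrier
    scale i []       = []
    scale i (b ∷ bs) = i · b ∷ scale (1+ i) bs

  record IsSubring (S : Pred Carrier ℓ) : Set ℓ where
    field
      resp : ∀ {x y} → x ≈ y → x ∈ S → y ∈ S
      0∈   : 0# ∈ S
      1∈   : 1# ∈ S
      +∈   : ∀ {x y} → x ∈ S → y ∈ S → x + y ∈ S
      *∈   : ∀ {x y} → x ∈ S → y ∈ S → x * y ∈ S
      -∈   : ∀ {x} → x ∈ S → - x ∈ S

  UnitOf : Pred Carrier ℓ → Pred Carrier ℓ
  UnitOf S x = x ∈ S × ∃ λ y → y ∈ S × x * y ≈ 1#

-- S is free of rank n as a module over R via φ: every element of S is a
-- unique R-linear combination of n fixed ones.  For fields, [S : R] = n.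
HasDegree : ∀ {ℓ} (R S : CommutativeRing ℓ ℓ) →
            (CommutativeRing.Carrier R → CommutativeRing.Carrier S) → ℕ → Set ℓ
HasDegree R S φ n =
  ∃ λ (b : Fin n → S.Carrier) → ∀ y →
  ∃ λ (c : Fin n → R.Carrier) →
    y S.≈ combination b c ×
    (∀ c′ → y S.≈ combination b c′ → ∀ i → c i R.≈ c′ i)
  where
  module R = CommutativeRing R
  module S = CommutativeRing S
  combination : (Fin n → S.Carrier) → (Fin n → R.Carrier) → S.Carrier
  combination b c = RingDefs.sum S (λ i → φ (c i) S.* b i)

-- (H : φ(G)) = n, given by n coset representatives.
HasIndex : ∀ {ℓ} (G H : AbelianGroup ℓ ℓ) →
           (AbelianGroup.Carrier G → AbelianGroup.Carrier H) → ℕ → Set ℓ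
HasIndex G H φ n =
  ∃ λ (r : Fin n → H.Carrier) → ∀ h →
  ∃! _≡_ λ i → ∃ λ g → h H.≈ φ g H.∙ r i
  where module H = AbelianGroup H

------------------------------------------------------------------------
-- Fields

-- Classical fields.  (The library's HeytingField carries an apartness
-- relation and admits the zero ring.)
record Field (ℓ : Level) : Set (suc ℓ) where
  field
    commutativeRing : CommutativeRing ℓ ℓ
  open CommutativeRing commutativeRing public hiding (zero)
  field
    1≉0     : ¬ (1# ≈ 0#)
    inverse : ∀ {x} → ¬ (x ≈ 0#) → ∃ λ y → x * y ≈ 1#
  open RingDefs commutativeRing public

record Extension {ℓ : Level} (K L : Field ℓ) : Set ℓ where
  private
    module K = Field K
    module L = Field L
  field
    ι : K.Carrier → L.Carrier
    isRingHomomorphism : RingMorphisms.IsRingHomomorphism K.rawRing L.rawRing ι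

------------------------------------------------------------------------
-- Valuation rings

-- A valuation ring of K, as a subset of K.  It carries the valuation up to
-- equivalence: v is the projection onto the value group K^×/A^× below, and
-- v(x) ≤ v(y) means y ∈ xA.
record ValuationRing {ℓ : Level} (K : Field ℓ) : Set (suc ℓ) where
  open Field K
  field
    𝒪         : Pred Carrier ℓ
    isSubring : IsSubring 𝒪
    total     : ∀ {x y} → x * y ≈ 1# → x ∈ 𝒪 ⊎ y ∈ 𝒪
  open IsSubring isSubring public

  units : Pred Carrier ℓ
  units = UnitOf 𝒪

  𝔪 : Pred Carrier ℓ
  𝔪 x = x ∈ 𝒪 × x ∉ units

  -- Hensel's lemma: simple roots modulo 𝔪 of monic polynomials over A lift.
  IsHenselian : Set ℓ
  IsHenselian =
    ∀ f → All 𝒪 f → ∀ a → a ∈ 𝒪 →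
    eval (monic f) a ∈ 𝔪 → eval (derivative (monic f)) a ∉ 𝔪 →
    ∃ λ b → b ∈ 𝒪 × eval (monic f) b ≈ 0# × b - a ∈ 𝔪

  private
    open RingProperties (CommutativeRing.ring commutativeRing)
      using (-‿distribˡ-*; -‿distribʳ-*; -‿+-comm)
    open CommutativeSemigroupProperties +-commutativeSemigroup
      using () renaming (interchange to +-interchange)
    open CommutativeSemigroupProperties *-commutativeSemigroup
      using () renaming (interchange to *-interchange)
    open SetoidReasoning setoid

  𝔪-resp : ∀ {x y} → x ≈ y → x ∈ 𝔪 → y ∈ 𝔪
  𝔪-resp x≈y (x∈ , x∉) = resp x≈y x∈ , λ where
    (_ , z , z∈ , yz≈1) → x∉ (x∈ , z , z∈ , trans (*-congʳ x≈y) yz≈1)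

  𝔪-0 : 0# ∈ 𝔪
  𝔪-0 = 0∈ , λ where
    (_ , z , _ , 0z≈1) → 1≉0 (trans (sym 0z≈1) (zeroˡ z))

  𝔪-* : ∀ {x y} → x ∈ 𝒪 → y ∈ 𝔪 → x * y ∈ 𝔪
  𝔪-* {x} {y} x∈ (y∈ , y∉) = *∈ x∈ y∈ , λ where
    (_ , z , z∈ , xyz≈1) → y∉ (y∈ , x * z , *∈ x∈ z∈ , (begin
      y * (x * z)  ≈⟨ *-assoc y x z ⟨
      (y * x) * z  ≈⟨ *-congʳ (*-comm y x) ⟩
      (x * y) * z  ≈⟨ xyz≈1 ⟩
      1#           ∎))

  𝔪-neg : ∀ {x} → x ∈ 𝔪 → - x ∈ 𝔪
  𝔪-neg {x} x∈𝔪 = 𝔪-resp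
    (trans (sym (-‿distribˡ-* 1# x)) (-‿cong (*-identityˡ x)))
    (𝔪-* (-∈ 1∈) x∈𝔪)

  -- If q = x/y ∈ A then x + y = (1 + q)y.
  𝔪-+-aux : ∀ {x y y⁻¹} → y * y⁻¹ ≈ 1# → x * y⁻¹ ∈ 𝒪 →
            y ∈ 𝔪 → x + y ∈ 𝔪
  𝔪-+-aux {x} {y} {y⁻¹} yy⁻¹≈1 q∈ y∈𝔪 =
    𝔪-resp eq (𝔪-* (+∈ q∈ 1∈) y∈𝔪)
    where
    eq : (x * y⁻¹ + 1#) * y ≈ x + y
    eq = begin
      (x * y⁻¹ + 1#) * y     ≈⟨ distribʳ y (x * y⁻¹) 1# ⟩
      x * y⁻¹ * y + 1# * y   ≈⟨ +-cong (*-assoc x y⁻¹ y) (*-identityˡ y) ⟩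
      x * (y⁻¹ * y) + y      ≈⟨ +-congʳ (*-congˡ (trans (*-comm y⁻¹ y) yy⁻¹≈1)) ⟩
      x * 1# + y             ≈⟨ +-congʳ (*-identityʳ x) ⟩
      x + y                  ∎

  𝔪-+ : ∀ {x y} → x ∈ 𝔪 → y ∈ 𝔪 → x + y ∈ 𝔪
  𝔪-+ {x} {y} x∈𝔪 y∈𝔪 = +∈ (proj₁ x∈𝔪) (proj₁ y∈𝔪) , λ u →
    let x≉0 : ¬ (x ≈ 0#)
        x≉0 x≈0 = proj₂ (𝔪-resp (sym (trans (+-congʳ x≈0) (+-identityˡ y))) y∈𝔪) u
        y≉0 : ¬ (y ≈ 0#)
        y≉0 y≈0 = proj₂ (𝔪-resp (sym (trans (+-congˡ y≈0) (+-identityʳ x))) x∈𝔪) u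
        (x⁻¹ , xx⁻¹≈1) = inverse x≉0
        (y⁻¹ , yy⁻¹≈1) = inverse y≉0
        prod : (x * y⁻¹) * (y * x⁻¹) ≈ 1#
        prod = begin
          (x * y⁻¹) * (y * x⁻¹)  ≈⟨ *-congˡ (*-comm y x⁻¹) ⟩
          (x * y⁻¹) * (x⁻¹ * y)  ≈⟨ *-interchange x y⁻¹ x⁻¹ y ⟩
          (x * x⁻¹) * (y⁻¹ * y)  ≈⟨ *-cong xx⁻¹≈1 (trans (*-comm y⁻¹ y) yy⁻¹≈1) ⟩
          1# * 1#                ≈⟨ *-identityˡ 1# ⟩
          1#                     ∎
    in [ (λ q∈ → proj₂ (𝔪-+-aux yy⁻¹≈1 q∈ y∈𝔪) u)
       , (λ q∈ → proj₂ (𝔪-resp (+-comm y x) (𝔪-+-aux xx⁻¹≈1 q∈ x∈𝔪)) u)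
       ]′ (total prod)

  𝔪-≈ : ∀ {x y} → x ≈ y → x - y ∈ 𝔪
  𝔪-≈ {x} {y} x≈y =
    𝔪-resp (sym (trans (+-congʳ x≈y) (-‿inverseʳ y))) 𝔪-0

  telescope : ∀ x y z → (x - y) + (y - z) ≈ x - z
  telescope x y z = begin
    (x - y) + (y - z)    ≈⟨ +-assoc x (- y) (y - z) ⟩
    x + (- y + (y - z))  ≈⟨ +-congˡ (+-assoc (- y) y (- z)) ⟨
    x + ((- y + y) - z)  ≈⟨ +-congˡ (+-congʳ (-‿inverseˡ y)) ⟩
    x + (0# - z)         ≈⟨ +-congˡ (+-identityˡ (- z)) ⟩
    x - z                ∎

  swap- : ∀ x y → - (x - y) ≈ y - x
  swap- x y = begin
    - (x - y)            ≈⟨ +-identityʳ (- (x - y)) ⟨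
    - (x - y) + 0#       ≈⟨ +-congˡ (trans (telescope x y x) (-‿inverseʳ x)) ⟨
    - (x - y) + ((x - y) + (y - x))  ≈⟨ +-assoc _ _ _ ⟨
    (- (x - y) + (x - y)) + (y - x)  ≈⟨ +-congʳ (-‿inverseˡ (x - y)) ⟩
    0# + (y - x)         ≈⟨ +-identityˡ (y - x) ⟩
    y - x                ∎

  𝔪-+-cong : ∀ {x x′ y y′} → x - x′ ∈ 𝔪 → y - y′ ∈ 𝔪 →
             (x + y) - (x′ + y′) ∈ 𝔪
  𝔪-+-cong {x} {x′} {y} {y′} p q = 𝔪-resp
    (trans (+-interchange x (- x′) y (- y′)) (+-congˡ (-‿+-comm x′ y′)))
    (𝔪-+ p q)

  𝔪-*-cong : ∀ {x x′ y y′} → x′ ∈ 𝒪 → y ∈ 𝒪 →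
             x - x′ ∈ 𝔪 → y - y′ ∈ 𝔪 → x * y - x′ * y′ ∈ 𝔪
  𝔪-*-cong {x} {x′} {y} {y′} x′∈ y∈ p q =
    𝔪-resp (telescope (x * y) (x′ * y) (x′ * y′))
      (𝔪-+ (𝔪-resp eq₁ (𝔪-* y∈ p)) (𝔪-resp eq₂ (𝔪-* x′∈ q)))
    where
    eq₁ : y * (x - x′) ≈ x * y - x′ * y
    eq₁ = begin
      y * (x - x′)         ≈⟨ *-comm y (x - x′) ⟩
      (x - x′) * y         ≈⟨ distribʳ y x (- x′) ⟩
      x * y + - x′ * y     ≈⟨ +-congˡ (-‿distribˡ-* x′ y) ⟨
      x * y - x′ * y       ∎
    eq₂ : x′ * (y - y′) ≈ x′ * y - x′ * y′
    eq₂ = begin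
      x′ * (y - y′)        ≈⟨ distribˡ x′ y (- y′) ⟩
      x′ * y + x′ * - y′   ≈⟨ +-congˡ (-‿distribʳ-* x′ y′) ⟨
      x′ * y - x′ * y′     ∎

  𝔪-neg-cong : ∀ {x y} → x - y ∈ 𝔪 → - x - - y ∈ 𝔪
  𝔪-neg-cong {x} {y} p = 𝔪-resp (sym (-‿+-comm x (- y))) (𝔪-neg p)

  residueField : CommutativeRing ℓ ℓ
  residueField = record
    { Carrier = ∃ 𝒪
    ; _≈_     = λ (x , _) (y , _) → x - y ∈ 𝔪
    ; _+_     = λ (x , x∈) (y , y∈) → x + y , +∈ x∈ y∈
    ; _*_     = λ (x , x∈) (y , y∈) → x * y , *∈ x∈ y∈
    ; -_      = λ (x , x∈) → - x , -∈ x∈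
    ; 0#      = 0# , 0∈
    ; 1#      = 1# , 1∈
    ; isCommutativeRing = record
      { isRing = record
        { +-isAbelianGroup = record
          { isGroup = record
            { isMonoid = record
              { isSemigroup = record
                { isMagma = record
                  { isEquivalence = record
                    { refl  = 𝔪-≈ refl
                    ; sym   = λ p → 𝔪-resp (swap- _ _) (𝔪-neg p)
                    ; trans = λ p q → 𝔪-resp (telescope _ _ _) (𝔪-+ p q)
                    }
                  ; ∙-cong = 𝔪-+-cong
                  }
                ; assoc = λ _ _ _ → 𝔪-≈ (+-assoc _ _ _)
                }
              ; identity = (λ _ → 𝔪-≈ (+-identityˡ _)) , (λ _ → 𝔪-≈ (+-identityʳ _))
              }
            ; inverse = (λ _ → 𝔪-≈ (-‿inverseˡ _)) , (λ _ → 𝔪-≈ (-‿inverseʳ _))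
            ; ⁻¹-cong = 𝔪-neg-cong
            }
          ; comm = λ _ _ → 𝔪-≈ (+-comm _ _)
          }
        ; *-cong     = λ {_} {x′} {y} {_} → 𝔪-*-cong (proj₂ x′) (proj₂ y)
        ; *-assoc    = λ _ _ _ → 𝔪-≈ (*-assoc _ _ _)
        ; *-identity = (λ _ → 𝔪-≈ (*-identityˡ _)) , (λ _ → 𝔪-≈ (*-identityʳ _))
        ; distrib    = (λ _ _ _ → 𝔪-≈ (distribˡ _ _ _)) , (λ _ _ _ → 𝔪-≈ (distribʳ _ _ _))
        }
      ; *-comm = λ _ _ → 𝔪-≈ (*-comm _ _)
      }
    }

  infix 4 _∼_
  _∼_ : Carrier → Carrier → Set ℓ
  x ∼ y = ∃ λ u → u ∈ units × x ≈ u * y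

  ∼-reflexive : ∀ {x y} → x ≈ y → x ∼ y
  ∼-reflexive {x} {y} x≈y =
    1# , (1∈ , 1# , 1∈ , *-identityˡ 1#) , trans x≈y (sym (*-identityˡ y))

  ∼-sym : ∀ {x y} → x ∼ y → y ∼ x
  ∼-sym {x} {y} (u , (u∈ , u⁻¹ , u⁻¹∈ , uu⁻¹≈1) , x≈uy) =
    u⁻¹ , (u⁻¹∈ , u , u∈ , trans (*-comm u⁻¹ u) uu⁻¹≈1) , (begin
      y              ≈⟨ *-identityˡ y ⟨
      1# * y         ≈⟨ *-congʳ (trans (*-comm u⁻¹ u) uu⁻¹≈1) ⟨
      u⁻¹ * u * y    ≈⟨ *-assoc u⁻¹ u y ⟩
      u⁻¹ * (u * y)  ≈⟨ *-congˡ x≈uy ⟨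
      u⁻¹ * x        ∎)

  units-* : ∀ {u u′} → u ∈ units → u′ ∈ units → u * u′ ∈ units
  units-* {u} {u′} (u∈ , w , w∈ , uw≈1) (u′∈ , w′ , w′∈ , u′w′≈1) =
    *∈ u∈ u′∈ , w * w′ , *∈ w∈ w′∈ ,
    trans (*-interchange u u′ w w′)
          (trans (*-cong uw≈1 u′w′≈1) (*-identityˡ 1#))

  ∼-trans : ∀ {x y z} → x ∼ y → y ∼ z → x ∼ z
  ∼-trans (u , u∈ , x≈uy) (u′ , u′∈ , y≈u′z) =
    u * u′ , units-* u∈ u′∈ ,
    trans x≈uy (trans (*-congˡ y≈u′z) (sym (*-assoc u u′ _)))

  ∼-*-cong : ∀ {x x′ y y′} → x ∼ x′ → y ∼ y′ → x * y ∼ x′ * y′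
  ∼-*-cong {x′ = x′} {y′ = y′} (u , u∈ , x≈ux′) (t , t∈ , y≈ty′) =
    u * t , units-* u∈ t∈ ,
    trans (*-cong x≈ux′ y≈ty′) (*-interchange u x′ t y′)

  ≉0-* : ∀ {x y} → ¬ (x ≈ 0#) → ¬ (y ≈ 0#) → ¬ (x * y ≈ 0#)
  ≉0-* {x} {y} x≉0 y≉0 xy≈0 = let (x⁻¹ , xx⁻¹≈1) = inverse x≉0 in y≉0 (begin
    y              ≈⟨ *-identityˡ y ⟨
    1# * y         ≈⟨ *-congʳ (trans (*-comm x⁻¹ x) xx⁻¹≈1) ⟨
    x⁻¹ * x * y    ≈⟨ *-assoc x⁻¹ x y ⟩
    x⁻¹ * (x * y)  ≈⟨ *-congˡ xy≈0 ⟩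
    x⁻¹ * 0#       ≈⟨ zeroʳ x⁻¹ ⟩
    0#             ∎)

  inv : (∃ λ x → ¬ (x ≈ 0#)) → ∃ λ x → ¬ (x ≈ 0#)
  inv (x , x≉0) = let (x⁻¹ , xx⁻¹≈1) = inverse x≉0 in
    x⁻¹ , λ x⁻¹≈0 → 1≉0 (trans (sym xx⁻¹≈1) (trans (*-congˡ x⁻¹≈0) (zeroʳ x)))

  inv-inverseʳ : ∀ x → proj₁ x * proj₁ (inv x) ≈ 1#
  inv-inverseʳ (_ , x≉0) = proj₂ (inverse x≉0)

  inv-inverseˡ : ∀ x → proj₁ (inv x) * proj₁ x ≈ 1#
  inv-inverseˡ x = trans (*-comm _ _) (inv-inverseʳ x)

  inv-cong : ∀ x y → proj₁ x ∼ proj₁ y → proj₁ (inv x) ∼ proj₁ (inv y)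
  inv-cong x y x∼y =
    ∼-trans (∼-reflexive (sym (trans (*-congˡ (inv-inverseʳ y)) (*-identityʳ _))))
    (∼-trans (∼-*-cong (∼-reflexive refl) (∼-*-cong (∼-sym x∼y) (∼-reflexive refl)))
    (∼-reflexive (trans (sym (*-assoc _ _ _))
      (trans (*-congʳ (inv-inverseˡ x)) (*-identityˡ _)))))

  -- K^×/A^×, written multiplicatively.
  valueGroup : AbelianGroup ℓ ℓ
  valueGroup = record
    { Carrier = ∃ λ x → ¬ (x ≈ 0#)
    ; _≈_     = λ (x , _) (y , _) → x ∼ y
    ; _∙_     = λ (x , x≉0) (y , y≉0) → x * y , ≉0-* x≉0 y≉0
    ; ε       = 1# , 1≉0
    ; _⁻¹     = inv
    ; isAbelianGroup = record
      { isGroup = record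
        { isMonoid = record
          { isSemigroup = record
            { isMagma = record
              { isEquivalence = record
                { refl = ∼-reflexive refl ; sym = ∼-sym ; trans = ∼-trans }
              ; ∙-cong = ∼-*-cong
              }
            ; assoc = λ _ _ _ → ∼-reflexive (*-assoc _ _ _)
            }
          ; identity = (λ _ → ∼-reflexive (*-identityˡ _)) , (λ _ → ∼-reflexive (*-identityʳ _))
          }
        ; inverse = (λ x → ∼-reflexive (inv-inverseˡ x)) , (λ x → ∼-reflexive (inv-inverseʳ x))
        ; ⁻¹-cong = λ {x} {y} → inv-cong x y
        }
      ; comm = λ _ _ → ∼-reflexive (*-comm _ _)
      }
    }

------------------------------------------------------------------------
-- Field extensions L|K and valuation rings

module ExtensionDefs {ℓ : Level} {K L : Field ℓ} (E : Extension K L) where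
  private
    module K = Field K
    module L = Field L
  open Extension E
  open RingMorphisms.IsRingHomomorphism isRingHomomorphism using (⟦⟧-cong; 1#-homo; *-homo)

  -- K(S), the subfield of L generated over K by S.
  data K⟨_⟩ (S : Pred L.Carrier ℓ) : Pred L.Carrier ℓ where
    base : ∀ x → K⟨ S ⟩ (ι x)
    gen  : ∀ {x} → x ∈ S → K⟨ S ⟩ x
    add  : ∀ {x y} → K⟨ S ⟩ x → K⟨ S ⟩ y → K⟨ S ⟩ (x L.+ y)
    mul  : ∀ {x y} → K⟨ S ⟩ x → K⟨ S ⟩ y → K⟨ S ⟩ (x L.* y)
    inv  : ∀ {x y} → K⟨ S ⟩ x → x L.* y L.≈ L.1# → K⟨ S ⟩ y
    resp : ∀ {x y} → x L.≈ y → K⟨ S ⟩ x → K⟨ S ⟩ y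

  -- The h ∈ K such that the solutions of Xⁿ = h generate L over K.  When K
  -- contains a primitive n-th root of unity, a single solution in L puts
  -- all of them in L.
  𝔄 : ℕ → Pred K.Carrier ℓ
  𝔄 n h = (∃ λ x → x L.^ n L.≈ ι h) ×
          (∀ y → y ∈ K⟨ (λ x → x L.^ n L.≈ ι h) ⟩)

  -- L|K is Kummer of exponent n; to be used only when K contains a
  -- primitive n-th root of unity.
  IsKummer : ℕ → Set ℓ
  IsKummer n = ∃ λ h → h ∈ 𝔄 n

  module OverValuationRing (A : ValuationRing K) where
    private module A = ValuationRing A

    -- The integral closure of A in L.
    B : Pred L.Carrier ℓ
    B x = ∃ λ f → All A.𝒪 f × L.eval (L.monic (map ι f)) x L.≈ L.0#

    A[_] : L.Carrier → Pred L.Carrier ℓ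
    A[ x ] y = ∃ λ f → All A.𝒪 f × y L.≈ L.eval (map ι f) x

    𝔄′ : ℕ → Pred K.Carrier ℓ
    𝔄′ n h = h ∈ 𝔄 n × h ∈ A.units × h K.- K.1# ∈ A.𝔪

    𝒮 : ℕ → Pred L.Carrier ℓ
    𝒮 n α = ∃ λ h → h ∈ 𝔄′ n × α L.^ n L.≈ ι h

    -- α′ = γ (α - 1) / (ζ - 1) for some γ ∈ A making α′ a unit of B; the
    -- division is cleared, as ζ ≠ 1 in the intended use.
    IsNormalization : K.Carrier → L.Carrier → L.Carrier → Set ℓ
    IsNormalization ζ α α′ =
      (∃ λ γ → γ ∈ A.𝒪 ×
               α′ L.* ι (ζ K.- K.1#) L.≈ ι γ L.* (α L.- L.1#)) ×
      α′ ∈ L.UnitOf B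

  -- The valuation of O extends that of A.
  _LiesOver_ : ValuationRing L → ValuationRing K → Set ℓ
  O LiesOver A = ∀ x → x ∈ ValuationRing.𝒪 A ⇔ ι x ∈ ValuationRing.𝒪 O

  module _ {O : ValuationRing L} {A : ValuationRing K} (O/A : O LiesOver A) where
    private
      module O = ValuationRing O
      module A = ValuationRing A
      module l = CommutativeRing O.residueField
      module k = CommutativeRing A.residueField
      module wL = AbelianGroup O.valueGroup
      module vK = AbelianGroup A.valueGroup

    residueMap : k.Carrier → l.Carrier
    residueMap (x , x∈) = ι x , Equivalence.to (O/A x) x∈

    valueMap : vK.Carrier → wL.Carrier
    valueMap (x , x≉0) = ι x , λ ιx≈0 →
      let (y , xy≈1) = K.inverse x≉0 in
      L.1≉0 (L.trans (L.sym 1#-homo) (L.trans (⟦⟧-cong (K.sym xy≈1))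
        (L.trans (*-homo x y) (L.trans (L.*-congʳ ιx≈0) (L.zeroˡ (ι y))))))

    -- The defect d of an extension of degree n is given by n = d e f, where
    -- e = (w(L^×) : v(K^×)) and f = [l : k].
    HasDefect : (n d : ℕ) → Set ℓ
    HasDefect n d = ∃ λ e → ∃ λ f →
      HasIndex A.valueGroup O.valueGroup valueMap e ×
      HasDegree A.residueField O.residueField residueMap f ×
      n ≡ d ℕ* e ℕ* f

{-# OPTIONS --safe #-}

-- As L|K is immediate, α ∈ 𝒮 can be written as α = 1 + c u with c ∈ K and u a
-- unit, and α′ is u up to a unit of A.  If ζ - 1 divided α - 1, Hensel's lemma
-- would give a p-th root of αᵖ in K; hence c divides ζ - 1 properly, and
-- Xᵖ - 1 = ∏ (X - ζⁱ) at X = 1 + c u, divided by cᵖ, shows that u and u⁻¹ are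
-- integral over A.
--
-- By Kummer theory α₁ ∈ K α₂ʲ for some j, so that A[α₁′] ⊆ A[α₂′] when c₁
-- divides c₂.
--
-- For the union, α may be divided by 1 + c a, a ∈ A, replacing u by (u - a) / d,
-- and this improves the approximation without end.  Following Kaplansky, after
-- finitely many steps the constant term of a given polynomial g of degree < p
-- over K, rewritten in u, dominates all others.  Indeed, by induction this holds
-- for the derivative of g, so that the linear term of g dominates the higher
-- ones; then either the constant term dominates already, or g has a root in K
-- by Hensel's lemma, and it suffices to come closer to α than that root.  If
-- g(α) is integral, its coefficients in terms of u are then in A.

module Submission where

open import Algebra.Bundles using (CommutativeRing)
import Algebra.Construct.Pointwise as Pointwise
open import Algebra.Morphism.Structures using (module RingMorphisms)
import Algebra.Properties.CommutativeSemiring.Exp as ExpProperties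
import Algebra.Properties.Ring as RingProperties
import Algebra.Properties.Semiring.Mult as MultProperties
import Algebra.Properties.Semiring.Mult.TCOptimised as TCOptimisedMult
import Algebra.Properties.Semiring.Sum as SumProperties
import Algebra.Solver.Ring
open import Algebra.Solver.Ring.AlmostCommutativeRing using (fromCommutativeRing; _-Raw-AlmostCommutative⟶_)
open import Axiom.ExcludedMiddle using (ExcludedMiddle)
open import Data.Fin.Base as Fin using (Fin)
open import Data.Integer.Base as ℤ using (ℤ; +_; -[1+_]; _⊖_; _◃_)
import Data.Integer.Properties as ℤ
open import Data.List.Base using ([]; _∷_; map; length)
open import Data.List.Relation.Unary.All using (All; []; _∷_)
open import Data.Maybe.Base as Maybe using (Maybe)
open import Data.Nat.Base as ℕ using (ℕ; zero; suc; z≤n; s≤s; _<_)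
import Data.Nat.Properties as ℕ
open import Data.Nat.Coprimality using (Coprime; coprime-Bézout)
open import Data.Nat.Divisibility using (_∣_; divides; ∣⇒≤; ∣-refl)
open import Data.Nat.GCD using (module Bézout)
open import Data.Product using (∃; ∃₂; _×_; _,_; proj₁; proj₂)
import Data.Sign.Base as Sign
open import Data.Sum.Base as Sum using (_⊎_; inj₁; inj₂)
open import Function.Base using (_∘_; id; case_of_)
open import Function.Bundles using (_⇔_; module Equivalence)
open import Level using (Level)
open import Relation.Binary.Definitions using (tri<; tri≈; tri>)
open import Relation.Binary.PropositionalEquality.Core as ≡ using (_≡_)
import Relation.Binary.Reasoning.Setoid as SetoidReasoning
open import Relation.Nullary.Decidable.Core using (yes; no; decidable-stable; dec⇒maybe)
open import Relation.Nullary.Negation using (¬_; contradiction)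
open import Relation.Unary using (Pred; _∈_; _∉_; _⊆_)
open import Defs

-- All arguments take place inside `L`, with `K` and `A` replaced by predicates on its elements, so
-- that no embedding has to be carried along. Of `B` it is only used that it lies in `O`, a
-- valuation ring being integrally closed; the union is proved for all of `O`, each element of which
-- lands in some A[u], and A[u] is integral over `A`. The obstacle in the union is that every
-- improvement replaces the generator, while β is a polynomial in one fixed generator. A
-- `Substitution` records how such polynomials are rewritten in the current `u`; its compatibility
-- with derivatives drives the induction. Degrees stay below p because only there the factors
-- produced by differentiation are units. Instead of an infinite pseudo-convergent sequence, each
-- polynomial receives its own finite number of improvements. Domination also yields the linear
-- independence of the powers of α below p. Kummer theory rests on it: a polynomial identity that
-- holds at α is transported to the conjugate ζ α.

-- Ring identities with integer coefficients

module IntegerSolver {ℓ} (C : CommutativeRing ℓ ℓ) where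
  open CommutativeRing C
  open RingProperties ring using (-0#≈0#; -‿+-comm; -‿distribˡ-*; -‿distribʳ-*; -‿involutive)
  open TCOptimisedMult semiring using (1+×; ×-homo-+; ×1-homo-*) renaming (_×_ to _·_)
  open SetoidReasoning setoid

  private
    -- With these multiples 0 and 1 denote `0#` and `1#` by definition, so that `con (+ 0)` and
    -- `con (+ 1)` match the constants in the goals.
    ⟦_⟧ᶻ : ℤ → Carrier
    ⟦ + n ⟧ᶻ      = n · 1#
    ⟦ -[1+ n ] ⟧ᶻ = - (suc n · 1#)

    cancelˡ : ∀ x y z → (x + y) - (x + z) ≈ y - z
    cancelˡ x y z = begin
      (x + y) - (x + z)      ≈⟨ +-cong (+-comm x y) (sym (-‿+-comm x z)) ⟩
      (y + x) + (- x + - z)  ≈⟨ +-assoc y x _ ⟩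
      y + (x + (- x + - z))  ≈⟨ +-congˡ (+-assoc x (- x) (- z)) ⟨
      y + ((x + - x) + - z)  ≈⟨ +-congˡ (+-congʳ (-‿inverseʳ x)) ⟩
      y + (0# + - z)         ≈⟨ +-congˡ (+-identityˡ (- z)) ⟩
      y - z                  ∎

    ⊖-homo : ∀ m n → ⟦ m ⊖ n ⟧ᶻ ≈ m · 1# - n · 1#
    ⊖-homo m       zero    = sym (trans (+-congˡ -0#≈0#) (+-identityʳ _))
    ⊖-homo zero    (suc n) = sym (+-identityˡ _)
    ⊖-homo (suc m) (suc n) rewrite ℤ.[1+m]⊖[1+n]≡m⊖n m n =
      trans (⊖-homo m n) (sym (trans
        (+-cong (1+× m 1#) (-‿cong (1+× n 1#))) (cancelˡ 1# (m · 1#) (n · 1#))))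

    +-homoᶻ : ∀ i j → ⟦ i ℤ.+ j ⟧ᶻ ≈ ⟦ i ⟧ᶻ + ⟦ j ⟧ᶻ
    +-homoᶻ (+ m)      (+ n)      = ×-homo-+ 1# m n
    +-homoᶻ (+ m)      -[1+ n ]   = ⊖-homo m (suc n)
    +-homoᶻ -[1+ m ]   (+ n)      = trans (⊖-homo n (suc m)) (+-comm _ _)
    +-homoᶻ -[1+ m ]   -[1+ n ] = trans
      (-‿cong (trans (reflexive (≡.cong (λ k → suc k · 1#) (≡.sym (ℕ.+-suc m n))))
                     (×-homo-+ 1# (suc m) (suc n))))
      (sym (-‿+-comm _ _))

    -‿homoᶻ : ∀ i → ⟦ ℤ.- i ⟧ᶻ ≈ - ⟦ i ⟧ᶻ
    -‿homoᶻ (+ zero)  = sym -0#≈0#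
    -‿homoᶻ (+ suc n) = refl
    -‿homoᶻ -[1+ n ]  = sym (-‿involutive _)

    ◃-homo : ∀ n → ⟦ Sign.- ◃ n ⟧ᶻ ≈ - (n · 1#)
    ◃-homo zero    = sym -0#≈0#
    ◃-homo (suc n) = refl

    *-homoᶻ : ∀ i j → ⟦ i ℤ.* j ⟧ᶻ ≈ ⟦ i ⟧ᶻ * ⟦ j ⟧ᶻ
    *-homoᶻ (+ m) (+ n) rewrite ℤ.+◃n≡+n (m ℕ.* n) = ×1-homo-* m n
    *-homoᶻ (+ m) -[1+ n ] = begin
      ⟦ Sign.- ◃ (m ℕ.* suc n) ⟧ᶻ  ≈⟨ ◃-homo (m ℕ.* suc n) ⟩
      - ((m ℕ.* suc n) · 1#)       ≈⟨ -‿cong (×1-homo-* m (suc n)) ⟩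
      - ((m · 1#) * (suc n · 1#))  ≈⟨ -‿distribʳ-* _ _ ⟩
      (m · 1#) * - (suc n · 1#)    ∎
    *-homoᶻ -[1+ m ] (+ n) = begin
      ⟦ Sign.- ◃ (suc m ℕ.* n) ⟧ᶻ  ≈⟨ ◃-homo (suc m ℕ.* n) ⟩
      - ((suc m ℕ.* n) · 1#)       ≈⟨ -‿cong (×1-homo-* (suc m) n) ⟩
      - ((suc m · 1#) * (n · 1#))  ≈⟨ -‿distribˡ-* _ _ ⟩
      - (suc m · 1#) * (n · 1#)    ∎
    *-homoᶻ -[1+ m ] -[1+ n ] = begin
      (suc m ℕ.* suc n) · 1#           ≈⟨ ×1-homo-* (suc m) (suc n) ⟩
      (suc m · 1#) * (suc n · 1#)      ≈⟨ -‿involutive _ ⟨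
      - - ((suc m · 1#) * (suc n · 1#))  ≈⟨ -‿cong (-‿distribʳ-* _ _) ⟩
      - ((suc m · 1#) * - (suc n · 1#))  ≈⟨ -‿distribˡ-* _ _ ⟩
      - (suc m · 1#) * - (suc n · 1#)  ∎

    ℤ⟶C : ℤ.+-*-rawRing -Raw-AlmostCommutative⟶ fromCommutativeRing C
    ℤ⟶C = record
      { ⟦_⟧    = ⟦_⟧ᶻ
      ; +-homo = +-homoᶻ
      ; *-homo = *-homoᶻ
      ; -‿homo = -‿homoᶻ
      ; 0-homo = refl
      ; 1-homo = refl
      }

    ≟ᶻ⇒≈ : ∀ i j → Maybe (⟦ i ⟧ᶻ ≈ ⟦ j ⟧ᶻ)
    ≟ᶻ⇒≈ i j = Maybe.map (λ { ≡.refl → refl }) (dec⇒maybe (i ℤ.≟ j))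

  open Algebra.Solver.Ring ℤ.+-*-rawRing (fromCommutativeRing C) ℤ⟶C ≟ᶻ⇒≈
    public using (solve; _:=_; _:+_; _:*_; _:-_; :-_; con)

-- Values of polynomials, adjunction, integrality

module Polynomials {ℓ} (C : CommutativeRing ℓ ℓ) where
  open CommutativeRing C hiding (zero)
  open RingDefs C
  open IntegerSolver C
  open SetoidReasoning setoid

  -- The values at y of the polynomials of degree < n (Pol) and of the monic
  -- polynomials of degree n (Mon) with coefficients in S.
  data Pol (S : Pred Carrier ℓ) (y : Carrier) : ℕ → Pred Carrier ℓ where
    nil  : ∀ {z} → z ≈ 0# → Pol S y 0 z
    cons : ∀ {n s w z} → s ∈ S → w ∈ Pol S y n → z ≈ s + y * w → Pol S y (suc n) z

  data Mon (S : Pred Carrier ℓ) (y : Carrier) : ℕ → Pred Carrier ℓ where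
    nil  : ∀ {z} → z ≈ 1# → Mon S y 0 z
    cons : ∀ {n s w z} → s ∈ S → w ∈ Mon S y n → z ≈ s + y * w → Mon S y (suc n) z

  Adj : Pred Carrier ℓ → Carrier → Pred Carrier ℓ
  Adj S y z = ∃ λ n → z ∈ Pol S y n

  Integral : Pred Carrier ℓ → Pred Carrier ℓ
  Integral S y = ∃ λ n → 0# ∈ Mon S y n

  pol-resp : ∀ {S y n z z′} → z ≈ z′ → z ∈ Pol S y n → z′ ∈ Pol S y n
  pol-resp z≈z′ (nil e)         = nil (trans (sym z≈z′) e)
  pol-resp z≈z′ (cons s∈ w∈ e) = cons s∈ w∈ (trans (sym z≈z′) e)

  mon-resp : ∀ {S y n z z′} → z ≈ z′ → z ∈ Mon S y n → z′ ∈ Mon S y n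
  mon-resp z≈z′ (nil e)         = nil (trans (sym z≈z′) e)
  mon-resp z≈z′ (cons s∈ w∈ e) = cons s∈ w∈ (trans (sym z≈z′) e)

  pol-map : ∀ {S S′ y n} → S ⊆ S′ → Pol S y n ⊆ Pol S′ y n
  pol-map S⊆S′ (nil e)         = nil e
  pol-map S⊆S′ (cons s∈ w∈ e) = cons (S⊆S′ s∈) (pol-map S⊆S′ w∈) e

  module _ {S : Pred Carrier ℓ} {y : Carrier} where

    pol-0 : 0# ∈ S → ∀ n → 0# ∈ Pol S y n
    pol-0 0∈ zero    = nil refl
    pol-0 0∈ (suc n) = cons 0∈ (pol-0 0∈ n)
      (solve 1 (λ y → con (+ 0) := con (+ 0) :+ y :* con (+ 0)) refl y)

    pol-raise : 0# ∈ S → ∀ {m n} → m ℕ.≤ n → Pol S y m ⊆ Pol S y n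
    pol-raise 0∈ {n = n} z≤n   (nil e)          = pol-resp (sym e) (pol-0 0∈ n)
    pol-raise 0∈ (s≤s m≤n) (cons s∈ w∈ e) = cons s∈ (pol-raise 0∈ m≤n w∈) e

    pol-+ : (∀ {s t} → s ∈ S → t ∈ S → s + t ∈ S) →
            ∀ {n z z′} → z ∈ Pol S y n → z′ ∈ Pol S y n → z + z′ ∈ Pol S y n
    pol-+ +∈ (nil e) (nil e′) = nil (trans (+-cong e e′) (+-identityˡ 0#))
    pol-+ +∈ (cons {s = s} {w} s∈ w∈ e) (cons {s = s′} {w′} s′∈ w′∈ e′) =
      cons (+∈ s∈ s′∈) (pol-+ +∈ w∈ w′∈) (trans (+-cong e e′)
        (solve 5 (λ s s′ w w′ y → (s :+ y :* w) :+ (s′ :+ y :* w′)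
                                := (s :+ s′) :+ y :* (w :+ w′)) refl s s′ w w′ y))

    pol-scale : ∀ {S′ k} → (∀ {s} → s ∈ S → k * s ∈ S′) →
                ∀ {n z} → z ∈ Pol S y n → k * z ∈ Pol S′ y n
    pol-scale *∈ (nil e) = nil (trans (*-congˡ e) (zeroʳ _))
    pol-scale {k = k} *∈ (cons {s = s} {w} s∈ w∈ e) =
      cons (*∈ s∈) (pol-scale *∈ w∈) (trans (*-congˡ e)
        (solve 4 (λ k s w y → k :* (s :+ y :* w) := k :* s :+ y :* (k :* w)) refl k s w y))

    mon⇒pol : 1# ∈ S → ∀ {n} → Mon S y n ⊆ Pol S y (suc n)
    mon⇒pol 1∈ (nil e) = cons 1∈ (nil refl)
      (trans e (solve 1 (λ y → con (+ 1) := con (+ 1) :+ y :* con (+ 0)) refl y))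
    mon⇒pol 1∈ (cons s∈ w∈ e) = cons s∈ (mon⇒pol 1∈ w∈) e

  module _ {S : Pred Carrier ℓ} (S-subring : IsSubring S) where
    private module S = IsSubring S-subring

    module _ {y : Carrier} where

      pol-neg : ∀ {n z} → z ∈ Pol S y n → - z ∈ Pol S y n
      pol-neg {z = z} z∈ = pol-resp
        (solve 1 (λ z → :- con (+ 1) :* z := :- z) refl z)
        (pol-scale (S.*∈ (S.-∈ S.1∈)) z∈)

      pol-shift : ∀ {n z} → z ∈ Pol S y n → y * z ∈ Pol S y (suc n)
      pol-shift z∈ = cons S.0∈ z∈ (sym (+-identityˡ _))

      pol-* : ∀ {m n z z′} → z ∈ Pol S y m → z′ ∈ Pol S y n → z * z′ ∈ Pol S y (m ℕ.+ n)
      pol-* {n = n} (nil e) z′∈ = pol-resp (sym (trans (*-congʳ e) (zeroˡ _))) (pol-0 S.0∈ n)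
      pol-* {suc m} {n} {z′ = z′} (cons {s = s} {w} s∈ w∈ e) z′∈ = pol-resp
        (sym (trans (*-congʳ e) (solve 4 (λ s w y z′ →
          (s :+ y :* w) :* z′ := s :* z′ :+ y :* (w :* z′)) refl s w y z′)))
        (pol-+ S.+∈ (pol-raise S.0∈ (ℕ.m≤n+m n (suc m)) (pol-scale (S.*∈ s∈) z′∈))
               (pol-shift (pol-* w∈ z′∈)))

      mon-+-pol : ∀ {n z z′} → z ∈ Mon S y n → z′ ∈ Pol S y n → z + z′ ∈ Mon S y n
      mon-+-pol (nil e) (nil e′) = nil (trans (+-cong e e′) (+-identityʳ 1#))
      mon-+-pol (cons {s = s} {w} s∈ w∈ e) (cons {s = s′} {w′} s′∈ w′∈ e′) =
        cons (S.+∈ s∈ s′∈) (mon-+-pol w∈ w′∈) (trans (+-cong e e′)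
          (solve 5 (λ s s′ w w′ y → (s :+ y :* w) :+ (s′ :+ y :* w′)
                                  := (s :+ s′) :+ y :* (w :+ w′)) refl s s′ w w′ y))

      mon-*-pol : ∀ {m n z z′} → z ∈ Mon S y m → z′ ∈ Pol S y n → z * z′ ∈ Pol S y (m ℕ.+ n)
      mon-*-pol (nil e) z′∈ = pol-resp (sym (trans (*-congʳ e) (*-identityˡ _))) z′∈
      mon-*-pol {suc m} {n} {z′ = z′} (cons {s = s} {w} s∈ w∈ e) z′∈ = pol-resp
        (sym (trans (*-congʳ e) (solve 4 (λ s w y z′ →
          (s :+ y :* w) :* z′ := s :* z′ :+ y :* (w :* z′)) refl s w y z′)))
        (pol-+ S.+∈ (pol-raise S.0∈ (ℕ.m≤n+m n (suc m)) (pol-scale (S.*∈ s∈) z′∈))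
               (pol-shift (mon-*-pol w∈ z′∈)))

      mon-* : ∀ {m n z z′} → z ∈ Mon S y m → z′ ∈ Mon S y n → z * z′ ∈ Mon S y (m ℕ.+ n)
      mon-* (nil e) z′∈ = mon-resp (sym (trans (*-congʳ e) (*-identityˡ _))) z′∈
      mon-* {suc m} {n} {z′ = z′} (cons {s = s} {w} s∈ w∈ e) z′∈ = mon-resp
        (sym (trans (*-congʳ e) (solve 4 (λ s w y z′ →
          (s :+ y :* w) :* z′ := (con (+ 0) :+ y :* (w :* z′)) :+ s :* z′) refl s w y z′)))
        (mon-+-pol (cons S.0∈ (mon-* w∈ z′∈) refl)
                   (pol-raise S.0∈ (s≤s (ℕ.m≤n+m n m)) (pol-scale (S.*∈ s∈) (mon⇒pol S.1∈ z′∈))))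

      linear : ∀ {s} → s ∈ S → y - s ∈ Mon S y 1
      linear {s} s∈ = cons (S.-∈ s∈) (nil refl)
        (solve 2 (λ y s → y :- s := :- s :+ y :* con (+ 1)) refl y s)

      private
        -- One step of division by a monic polynomial: `s` is the top coefficient of the dividend.
        divide : ∀ {n z m} → z ∈ Pol S y (suc n) → m ∈ Mon S y n →
                 ∃ λ s → s ∈ S × z - s * m ∈ Pol S y n
        divide {m = m} (cons {s = s} {w} {z} s∈ (nil w≈0) e) (nil m≈1) = s , s∈ , nil (begin
          z - s * m               ≈⟨ +-cong e (-‿cong (*-congˡ m≈1)) ⟩
          s + y * w - s * 1#      ≈⟨ +-congʳ (+-congˡ (*-congˡ w≈0)) ⟩
          s + y * 0# - s * 1#     ≈⟨ solve 2 (λ s y →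
                                       s :+ y :* con (+ 0) :- s :* con (+ 1) := con (+ 0)) refl s y ⟩
          0#                      ∎)
        divide {m = m} (cons {s = t} {w} {z} t∈ w∈ e) (cons {s = t′} {w′} t′∈ w′∈ e′) =
          let (s , s∈ , r∈) = divide w∈ w′∈ in
          s , s∈ , cons (S.+∈ t∈ (S.-∈ (S.*∈ s∈ t′∈))) r∈ (begin
            z - s * m                                ≈⟨ +-cong e (-‿cong (*-congˡ e′)) ⟩
            t + y * w - s * (t′ + y * w′)            ≈⟨ solve 6 (λ s t t′ w w′ y →
              t :+ y :* w :- s :* (t′ :+ y :* w′)
              := (t :- s :* t′) :+ y :* (w :- s :* w′)) refl s t t′ w w′ y ⟩
            (t - s * t′) + y * (w - s * w′)          ∎)

      -- The monic polynomial takes the value 0 at `y`, so subtracting a multiple of it lowers the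
      -- degree and keeps the value.
      pol-reduce : ∀ {n} → 0# ∈ Mon S y n → ∀ {m} → Pol S y m ⊆ Pol S y n
      pol-reduce {n} 0∈ (nil e) = pol-resp (sym e) (pol-0 S.0∈ n)
      pol-reduce 0∈ (cons s∈ w∈ e) =
        let (s , _ , r∈) = divide (cons s∈ (pol-reduce 0∈ w∈) e) 0∈ in
        pol-resp (solve 2 (λ z s → z :- s :* con (+ 0) := z) refl _ s) r∈

      pol-coefficients : ∀ {n z} → z ∈ Pol S y n →
        ∃ λ (a : Fin n → Carrier) → (∀ i → a i ∈ S) × z ≈ sum (λ i → a i * y ^ Fin.toℕ i)
      pol-coefficients (nil e) = (λ ()) , (λ ()) , e
      pol-coefficients (cons {n} {s} {w} {z} s∈ w∈ e) =
        let (a , a∈ , w≈) = pol-coefficients w∈ in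
        (λ { Fin.zero → s ; (Fin.suc i) → a i }) ,
        (λ { Fin.zero → s∈ ; (Fin.suc i) → a∈ i }) , (begin
          z                                              ≈⟨ e ⟩
          s + y * w                                      ≈⟨ +-cong (sym (*-identityʳ s)) (*-congˡ w≈) ⟩
          s * 1# + y * sum (λ i → a i * y ^ Fin.toℕ i)   ≈⟨ +-congˡ (*-distribˡ-sum y (λ i → a i * y ^ Fin.toℕ i)) ⟩
          s * 1# + sum (λ i → y * (a i * y ^ Fin.toℕ i)) ≈⟨ +-congˡ (sum-cong-≋ λ i →
            solve 3 (λ y a b → y :* (a :* b) := a :* (y :* b)) refl y (a i) (y ^ Fin.toℕ i)) ⟩
          s * 1# + sum (λ i → a i * (y * y ^ Fin.toℕ i)) ∎)
        where open SumProperties semiring using (*-distribˡ-sum; sum-cong-≋)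

      adj-S : S ⊆ Adj S y
      adj-S {s} s∈ = 1 , cons s∈ (nil refl)
        (solve 2 (λ s y → s := s :+ y :* con (+ 0)) refl s y)

      adj-gen : y ∈ Adj S y
      adj-gen = 2 , cons S.0∈ (proj₂ (adj-S S.1∈))
        (solve 1 (λ y → y := con (+ 0) :+ y :* con (+ 1)) refl y)

      adj-subring : IsSubring (Adj S y)
      adj-subring = record
        { resp = λ x≈y (n , x∈) → n , pol-resp x≈y x∈
        ; 0∈   = adj-S S.0∈
        ; 1∈   = adj-S S.1∈
        ; +∈   = λ (m , x∈) (n , y∈) → m ℕ.+ n ,
                   pol-+ S.+∈ (pol-raise S.0∈ (ℕ.m≤m+n m n) x∈) (pol-raise S.0∈ (ℕ.m≤n+m n m) y∈)
        ; *∈   = λ (m , x∈) (n , y∈) → m ℕ.+ n , pol-* x∈ y∈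
        ; -∈   = λ (n , x∈) → n , pol-neg x∈
        }

      adj-minimal : ∀ {T} → IsSubring T → S ⊆ T → y ∈ T → Adj S y ⊆ T
      adj-minimal {T} T-subring S⊆T y∈ (_ , z∈) = pol⊆ z∈
        where
        module T = IsSubring T-subring
        pol⊆ : ∀ {n} → Pol S y n ⊆ T
        pol⊆ (nil e)         = T.resp (sym e) T.0∈
        pol⊆ (cons s∈ w∈ e) = T.resp (sym e) (T.+∈ (S⊆T s∈) (T.*∈ y∈ (pol⊆ w∈)))

      private
        open SumProperties semiring using (*-distribˡ-sum; sum-cong-≋; ∑-distrib-+)

        -- The classical determinant argument, with fraction-free elimination
        -- of one generator at a time in place of the determinant.
        eliminate : ∀ n d (e : Fin (suc n) → Carrier)
          (D : Fin (suc n) → Carrier) (U : Fin (suc n) → Fin (suc n) → Carrier) →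
          (∀ i z → z * e i ≈ 0# → z ≈ 0#) →
          (∀ i → D i ∈ Mon S y d) → (∀ i j → U i j ∈ Pol S y d) →
          (∀ i → D i * e i ≈ sum (λ j → U i j * e j)) → Integral S y
        eliminate zero d e D U cancel D∈ U∈ eq = d , mon-resp
          (cancel Fin.zero _ (begin
            (D 0F - U 0F 0F) * e 0F          ≈⟨ solve 3 (λ d u e → (d :- u) :* e := d :* e :- (u :* e :+ con (+ 0)))
                                                  refl (D 0F) (U 0F 0F) (e 0F) ⟩
            D 0F * e 0F - (U 0F 0F * e 0F + 0#)  ≈⟨ +-congʳ (eq 0F) ⟩
            (U 0F 0F * e 0F + 0#) - (U 0F 0F * e 0F + 0#)  ≈⟨ -‿inverseʳ _ ⟩
            0#  ∎))
          (mon-+-pol (D∈ 0F) (pol-neg (U∈ 0F 0F)))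
          where
          0F : Fin 1
          0F = Fin.zero
        eliminate (suc n) d e D U cancel D∈ U∈ eq =
          -- Row `i` is multiplied by the pivot `P`, and `P * e 0F` is replaced by means of row 0.
          -- The diagonal is `D` minus `U`, with `D` monic of degree `d` and all `U` of degree below
          -- `d`. Doubling `d` restores this, so the last entry left is a monic polynomial
          -- annihilating a cancellable element.
          eliminate n (d ℕ.+ d) (λ i → e (Fin.suc i))
            (λ i → P * D (Fin.suc i))
            (λ i j → U (Fin.suc i) 0F * U 0F (Fin.suc j) + P * U (Fin.suc i) (Fin.suc j))
            (λ i → cancel (Fin.suc i))
            (λ i → mon-* P∈ (D∈ (Fin.suc i)))
            (λ i j → pol-+ S.+∈ (pol-* (U∈ (Fin.suc i) 0F) (U∈ 0F (Fin.suc j)))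
                           (mon-*-pol P∈ (U∈ (Fin.suc i) (Fin.suc j))))
            row
          where
          0F : Fin (suc (suc n))
          0F = Fin.zero
          P = D 0F - U 0F 0F
          P∈ = mon-+-pol (D∈ 0F) (pol-neg (U∈ 0F 0F))
          Σ₊ : Fin (suc (suc n)) → Carrier
          Σ₊ i = sum (λ j → U i (Fin.suc j) * e (Fin.suc j))
          pivot : P * e 0F ≈ Σ₊ 0F
          pivot = begin
            P * e 0F                                      ≈⟨ solve 3 (λ d u e → (d :- u) :* e := d :* e :- u :* e)
                                                              refl (D 0F) (U 0F 0F) (e 0F) ⟩
            D 0F * e 0F - U 0F 0F * e 0F                  ≈⟨ +-congʳ (eq 0F) ⟩
            (U 0F 0F * e 0F + Σ₊ 0F) - U 0F 0F * e 0F     ≈⟨ solve 2 (λ a b → (a :+ b) :- a := b) refl _ _ ⟩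
            Σ₊ 0F                                         ∎
          row : ∀ i → (P * D (Fin.suc i)) * e (Fin.suc i) ≈
            sum (λ j → (U (Fin.suc i) 0F * U 0F (Fin.suc j) + P * U (Fin.suc i) (Fin.suc j)) * e (Fin.suc j))
          row i = begin
            (P * D i′) * e i′                       ≈⟨ *-assoc P (D i′) (e i′) ⟩
            P * (D i′ * e i′)                       ≈⟨ *-congˡ (eq i′) ⟩
            P * (U i′ 0F * e 0F + Σ₊ i′)            ≈⟨ solve 4 (λ p u e s → p :* (u :* e :+ s) := u :* (p :* e) :+ p :* s)
                                                         refl P (U i′ 0F) (e 0F) (Σ₊ i′) ⟩
            U i′ 0F * (P * e 0F) + P * Σ₊ i′        ≈⟨ +-congʳ (*-congˡ pivot) ⟩
            U i′ 0F * Σ₊ 0F + P * Σ₊ i′             ≈⟨ +-cong (*-distribˡ-sum (U i′ 0F) (λ j → U 0F (Fin.suc j) * e (Fin.suc j)))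
                                                              (*-distribˡ-sum P (λ j → U i′ (Fin.suc j) * e (Fin.suc j))) ⟩
            sum (λ j → U i′ 0F * (U 0F (Fin.suc j) * e (Fin.suc j))) + sum (λ j → P * (U i′ (Fin.suc j) * e (Fin.suc j)))
              ≈⟨ ∑-distrib-+ (λ j → U i′ 0F * (U 0F (Fin.suc j) * e (Fin.suc j)))
                             (λ j → P * (U i′ (Fin.suc j) * e (Fin.suc j))) ⟨
            sum (λ j → U i′ 0F * (U 0F (Fin.suc j) * e (Fin.suc j)) + P * (U i′ (Fin.suc j) * e (Fin.suc j)))
              ≈⟨ sum-cong-≋ (λ j → solve 5 (λ u v e p w → u :* (v :* e) :+ p :* (w :* e) := (u :* v :+ p :* w) :* e)
                   refl (U i′ 0F) (U 0F (Fin.suc j)) (e (Fin.suc j)) P (U i′ (Fin.suc j))) ⟩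
            sum (λ j → (U i′ 0F * U 0F (Fin.suc j) + P * U i′ (Fin.suc j)) * e (Fin.suc j)) ∎
            where i′ = Fin.suc i

      -- Cancellability of the `e i` makes the module that they span faithful. The elimination
      -- starts with `D` equal to `y`, monic of degree 1, and with constant `U`.
      stable⇒integral : ∀ n (e : Fin (suc n) → Carrier) →
        (∀ i z → z * e i ≈ 0# → z ≈ 0#) →
        (a : Fin (suc n) → Fin (suc n) → Carrier) → (∀ i j → a i j ∈ S) →
        (∀ i → y * e i ≈ sum (λ j → a i j * e j)) → Integral S y
      stable⇒integral n e cancel a a∈ eq = eliminate n 1 e (λ _ → y) a cancel
        (λ _ → mon-resp (solve 1 (λ y → y :- con (+ 0) := y) refl y) (linear S.0∈))
        (λ i j → cons (a∈ i j) (nil refl) (solve 2 (λ s y → s := s :+ y :* con (+ 0)) refl _ y))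
        eq

    -- The powers of `x` below the degree of its equation span a module stable under S[x]; they can
    -- be cancelled because `x` is nonzero in a domain.
    adj⇒integral : (∀ {x y} → x * y ≈ 0# → ¬ (x ≈ 0#) → y ≈ 0#) → ¬ (1# ≈ 0#) →
      ∀ {x} → ¬ (x ≈ 0#) → Integral S x → Adj S x ⊆ Integral S
    adj⇒integral domain 1≉0 {x} x≉0 (zero  , nil 0≈1)    _  = contradiction (sym 0≈1) 1≉0
    adj⇒integral domain 1≉0 {x} x≉0 (suc n , 0∈)      {y} y∈ = stable⇒integral n
      (λ i → x ^ Fin.toℕ i)
      (λ i z zx≈0 → domain (trans (*-comm _ z) zx≈0) (power≉0 (Fin.toℕ i)))
      (λ i → proj₁ (coefficients i)) (λ i → proj₁ (proj₂ (coefficients i)))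
      (λ i → proj₂ (proj₂ (coefficients i)))
      where
      power≉0 : ∀ k → ¬ (x ^ k ≈ 0#)
      power≉0 zero    = 1≉0
      power≉0 (suc k) e = power≉0 k (domain e x≉0)
      module A = IsSubring (adj-subring {x})
      power∈ : ∀ k → x ^ k ∈ Adj S x
      power∈ zero    = A.1∈
      power∈ (suc k) = A.*∈ adj-gen (power∈ k)
      coefficients = λ (i : Fin (suc n)) →
        pol-coefficients (pol-reduce 0∈ (proj₂ (A.*∈ y∈ (power∈ (Fin.toℕ i)))))

-- Coefficient sequences, affine substitution, derivatives

module Coefficients {ℓ} (C : CommutativeRing ℓ ℓ) where
  open CommutativeRing C hiding (zero)
  open RingDefs C
  open Polynomials C
  open IntegerSolver C
  open SetoidReasoning setoid

  -- A sequence g with a bound n stands for g 0 + g 1 X + … + g (n - 1) Xⁿ⁻¹.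
  ev : ℕ → (ℕ → Carrier) → Carrier → Carrier
  ev zero    g x = 0#
  ev (suc n) g x = g 0 + x * ev n (g ∘ suc) x

  -- The coefficients of g (a + d X).
  sub : Carrier → Carrier → ℕ → (ℕ → Carrier) → ℕ → Carrier
  sub a d zero    g i       = 0#
  sub a d (suc n) g zero    = g 0 + a * sub a d n (g ∘ suc) 0
  sub a d (suc n) g (suc i) = a * sub a d n (g ∘ suc) (suc i) + d * sub a d n (g ∘ suc) i

  D : (ℕ → Carrier) → ℕ → Carrier
  D g i = (suc i · 1#) * g (suc i)

  ev-cong : ∀ n {g h} x → (∀ i → i ℕ.< n → g i ≈ h i) → ev n g x ≈ ev n h x
  ev-cong zero    x g≈h = refl
  ev-cong (suc n) x g≈h =
    +-cong (g≈h 0 (s≤s z≤n)) (*-congˡ (ev-cong n x (λ i i<n → g≈h (suc i) (s≤s i<n))))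

  ev-congʳ : ∀ n g {x y} → x ≈ y → ev n g x ≈ ev n g y
  ev-congʳ zero    g x≈y = refl
  ev-congʳ (suc n) g x≈y = +-congˡ (*-cong x≈y (ev-congʳ n (g ∘ suc) x≈y))

  ev-0 : ∀ n x → ev n (λ _ → 0#) x ≈ 0#
  ev-0 zero    x = refl
  ev-0 (suc n) x = trans (+-congˡ (*-congˡ (ev-0 n x)))
    (solve 1 (λ x → con (+ 0) :+ x :* con (+ 0) := con (+ 0)) refl x)

  ev-+ : ∀ n g h x → ev n (λ i → g i + h i) x ≈ ev n g x + ev n h x
  ev-+ zero    g h x = sym (+-identityˡ 0#)
  ev-+ (suc n) g h x = trans (+-congˡ (*-congˡ (ev-+ n (g ∘ suc) (h ∘ suc) x)))
    (solve 5 (λ g h x e f → (g :+ h) :+ x :* (e :+ f) := (g :+ x :* e) :+ (h :+ x :* f)) refl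
      (g 0) (h 0) x (ev n (g ∘ suc) x) (ev n (h ∘ suc) x))

  ev-scale : ∀ n k g x → ev n (λ i → k * g i) x ≈ k * ev n g x
  ev-scale zero    k g x = sym (zeroʳ k)
  ev-scale (suc n) k g x = trans (+-congˡ (*-congˡ (ev-scale n k (g ∘ suc) x)))
    (solve 4 (λ k g x e → k :* g :+ x :* (k :* e) := k :* (g :+ x :* e)) refl
      k (g 0) x (ev n (g ∘ suc) x))

  ev-snoc : ∀ n g x → ev (suc n) g x ≈ ev n g x + x ^ n * g n
  ev-snoc zero    g x =
    solve 2 (λ g x → g :+ x :* con (+ 0) := con (+ 0) :+ con (+ 1) :* g) refl (g 0) x
  ev-snoc (suc n) g x = trans (+-congˡ (*-congˡ (ev-snoc n (g ∘ suc) x)))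
    (solve 5 (λ g x e y h → g :+ x :* (e :+ y :* h) := (g :+ x :* e) :+ (x :* y) :* h) refl
      (g 0) x (ev n (g ∘ suc) x) (x ^ n) (g (suc n)))

  module _ (a d : Carrier) where

    sub-≥ : ∀ n g i → n ℕ.≤ i → sub a d n g i ≈ 0#
    sub-≥ zero    g i       n≤i       = refl
    sub-≥ (suc n) g (suc i) (s≤s n≤i) = trans
      (+-cong (*-congˡ (sub-≥ n (g ∘ suc) (suc i) (ℕ.m≤n⇒m≤1+n n≤i))) (*-congˡ (sub-≥ n (g ∘ suc) i n≤i)))
      (solve 2 (λ a d → a :* con (+ 0) :+ d :* con (+ 0) := con (+ 0)) refl a d)

    sub-cong : ∀ n {g h} → (∀ i → i ℕ.< n → g i ≈ h i) → ∀ i → sub a d n g i ≈ sub a d n h i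
    sub-cong zero    g≈h i = refl
    sub-cong (suc n) g≈h = λ where
        zero    → +-cong (g≈h 0 (s≤s z≤n)) (*-congˡ (tail 0))
        (suc i) → +-cong (*-congˡ (tail (suc i))) (*-congˡ (tail i))
      where tail = sub-cong n (λ i i<n → g≈h (suc i) (s≤s i<n))

    sub-+ : ∀ n g h i → sub a d n (λ i → g i + h i) i ≈ sub a d n g i + sub a d n h i
    sub-+ zero    g h i = sym (+-identityˡ 0#)
    sub-+ (suc n) g h zero = trans (+-congˡ (*-congˡ (sub-+ n (g ∘ suc) (h ∘ suc) 0)))
      (solve 5 (λ g h a x y → (g :+ h) :+ a :* (x :+ y) := (g :+ a :* x) :+ (h :+ a :* y)) refl
        (g 0) (h 0) a _ _)
    sub-+ (suc n) g h (suc i) = trans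
      (+-cong (*-congˡ (sub-+ n (g ∘ suc) (h ∘ suc) (suc i))) (*-congˡ (sub-+ n (g ∘ suc) (h ∘ suc) i)))
      (solve 6 (λ a x y d z w → a :* (x :+ y) :+ d :* (z :+ w) := (a :* x :+ d :* z) :+ (a :* y :+ d :* w)) refl
        a _ _ d _ _)

    sub-scale : ∀ n k g i → sub a d n (λ i → k * g i) i ≈ k * sub a d n g i
    sub-scale zero    k g i = sym (zeroʳ k)
    sub-scale (suc n) k g zero = trans (+-congˡ (*-congˡ (sub-scale n k (g ∘ suc) 0)))
      (solve 4 (λ k g a x → k :* g :+ a :* (k :* x) := k :* (g :+ a :* x)) refl k (g 0) a _)
    sub-scale (suc n) k g (suc i) = trans
      (+-cong (*-congˡ (sub-scale n k (g ∘ suc) (suc i))) (*-congˡ (sub-scale n k (g ∘ suc) i)))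
      (solve 5 (λ k a x d y → a :* (k :* x) :+ d :* (k :* y) := k :* (a :* x :+ d :* y)) refl k a _ d _)

    sub-0 : ∀ n {g} → (∀ i → i ℕ.< n → g i ≈ 0#) → ∀ i → sub a d n g i ≈ 0#
    sub-0 n {g} g≈0 i = trans
      (sub-cong n {h = λ i → 0# * g i} (λ i i<n → trans (g≈0 i i<n) (sym (zeroˡ _))) i)
      (trans (sub-scale n 0# g i) (zeroˡ _))

    ev-sub : ∀ n g y → ev n (sub a d n g) y ≈ ev n g (a + d * y)
    ev-sub zero    g y = refl
    ev-sub (suc n) g y = begin
      (g 0 + a * F 0) + y * ev n (λ i → a * F (suc i) + d * F i) y
        ≈⟨ +-congˡ (*-congˡ (trans (ev-+ n (λ i → a * F (suc i)) (λ i → d * F i) y)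
             (+-cong (ev-scale n a (F ∘ suc) y) (ev-scale n d F y)))) ⟩
      (g 0 + a * F 0) + y * (a * ev n (F ∘ suc) y + d * ev n F y)
        ≈⟨ solve 7 (λ g a f y e d h → (g :+ a :* f) :+ y :* (a :* e :+ d :* h)
             := g :+ (a :* (f :+ y :* e) :+ d :* y :* h)) refl
             (g 0) a (F 0) y (ev n (F ∘ suc) y) d (ev n F y) ⟩
      g 0 + (a * ev (suc n) F y + d * y * ev n F y)
        -- `F` comes from only `n` coefficients, so the top term of `ev (suc n) F y` vanishes.
        ≈⟨ +-congˡ (+-congʳ (*-congˡ (trans (ev-snoc n F y) (trans
             (+-congˡ (trans (*-congˡ (sub-≥ n (g ∘ suc) n ℕ.≤-refl)) (zeroʳ _))) (+-identityʳ _))))) ⟩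
      g 0 + (a * ev n F y + d * y * ev n F y)
        ≈⟨ +-congˡ (distribʳ _ a (d * y)) ⟨
      g 0 + (a + d * y) * ev n F y
        ≈⟨ +-congˡ (*-congˡ (ev-sub n (g ∘ suc) y)) ⟩
      g 0 + (a + d * y) * ev n (g ∘ suc) (a + d * y) ∎
      where F = sub a d n (g ∘ suc)

    sub-constant : ∀ n g → sub a d n g 0 ≈ ev n g a
    sub-constant zero    g = refl
    sub-constant (suc n) g = +-congˡ (*-congˡ (sub-constant n (g ∘ suc)))

    -- Writing g = g 0 + X f gives g′ = f + X f′; the tail of this identity, after substitution, is
    -- `split`, and the induction hypothesis treats f′. Coefficients and not just values are
    -- compared, since domination is a condition on coefficients.
    chain-rule : ∀ n g i → D (sub a d (suc n) g) i ≈ d * sub a d n (D g) i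
    chain-rule zero g i = solve 3 (λ c a d →
      c :* (a :* con (+ 0) :+ d :* con (+ 0)) := d :* con (+ 0)) refl (suc i · 1#) a d
    chain-rule (suc m) g = λ where
        zero → begin
          (1# + 0#) * (a * F 1 + d * F 0)
            ≈⟨ solve 4 (λ a d x y → (con (+ 1) :+ con (+ 0)) :* (a :* x :+ d :* y)
                 := a :* ((con (+ 1) :+ con (+ 0)) :* x) :+ d :* y) refl a d (F 1) (F 0) ⟩
          a * ((1# + 0#) * F 1) + d * F 0
            ≈⟨ +-congʳ (*-congˡ (IH 0)) ⟩
          a * (d * H 0) + d * (g 1 + a * F′ 0)
            ≈⟨ solve 5 (λ a d g h f → a :* (d :* h) :+ d :* (g :+ a :* f)
                 := d :* ((con (+ 1) :+ con (+ 0)) :* g :+ a :* (f :+ h))) refl a d (g 1) (H 0) (F′ 0) ⟩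
          d * ((1# + 0#) * g 1 + a * (F′ 0 + H 0))
            ≈⟨ *-congˡ (+-congˡ (*-congˡ (split 0))) ⟨
          d * ((1# + 0#) * g 1 + a * sub a d m (D g ∘ suc) 0) ∎
        (suc j) → begin
          (1# + (1# + j · 1#)) * (a * F (suc (suc j)) + d * F (suc j))
            ≈⟨ solve 5 (λ c a x d y → (con (+ 1) :+ (con (+ 1) :+ c)) :* (a :* x :+ d :* y)
                 := a :* ((con (+ 1) :+ (con (+ 1) :+ c)) :* x) :+ (d :* y :+ d :* ((con (+ 1) :+ c) :* y)))
                 refl (j · 1#) a (F (suc (suc j))) d (F (suc j)) ⟩
          a * ((1# + (1# + j · 1#)) * F (suc (suc j))) + (d * F (suc j) + d * ((1# + j · 1#) * F (suc j)))
            ≈⟨ +-cong (*-congˡ (IH (suc j))) (+-congˡ (*-congˡ (IH j))) ⟩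
          a * (d * H (suc j)) + (d * (a * F′ (suc j) + d * F′ j) + d * (d * H j))
            ≈⟨ solve 6 (λ a d h f f′ h′ → a :* (d :* h) :+ (d :* (a :* f :+ d :* f′) :+ d :* (d :* h′))
                 := d :* (a :* (f :+ h) :+ d :* (f′ :+ h′))) refl a d (H (suc j)) (F′ (suc j)) (F′ j) (H j) ⟩
          d * (a * (F′ (suc j) + H (suc j)) + d * (F′ j + H j))
            ≈⟨ *-congˡ (+-cong (*-congˡ (split (suc j))) (*-congˡ (split j))) ⟨
          d * (a * sub a d m (D g ∘ suc) (suc j) + d * sub a d m (D g ∘ suc) j) ∎
      where
      F  = sub a d (suc m) (g ∘ suc)
      F′ = sub a d m (g ∘ suc ∘ suc)
      H  = sub a d m (D (g ∘ suc))
      IH : ∀ i → D F i ≈ d * H i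
      IH = chain-rule m (g ∘ suc)
      split : ∀ i → sub a d m (D g ∘ suc) i ≈ F′ i + H i
      split i = trans
        (sub-cong m (λ j _ → solve 2 (λ c x → (con (+ 1) :+ c) :* x := x :+ c :* x) refl _ _) i)
        (sub-+ m (g ∘ suc ∘ suc) (D (g ∘ suc)) i)

  module _ {S : Pred Carrier ℓ} (S-subring : IsSubring S) where
    private module S = IsSubring S-subring

    sub∈ : ∀ {a d} → a ∈ S → d ∈ S → ∀ n {g} → (∀ i → i ℕ.< n → g i ∈ S) → ∀ i → sub a d n g i ∈ S
    sub∈ a∈ d∈ zero    g∈ i = S.0∈
    sub∈ a∈ d∈ (suc n) g∈ = λ where
        zero    → S.+∈ (g∈ 0 (s≤s z≤n)) (S.*∈ a∈ (tail∈ 0))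
        (suc i) → S.+∈ (S.*∈ a∈ (tail∈ (suc i))) (S.*∈ d∈ (tail∈ i))
      where tail∈ = sub∈ a∈ d∈ n (λ i i<n → g∈ (suc i) (s≤s i<n))

    -- In a + d X every X carries a factor `d`. Thus the nonconstant coefficients become small
    -- together with `d`.
    sub-suc∈ : ∀ {a d} → a ∈ S → d ∈ S → ∀ n {g} → (∀ i → i ℕ.< n → g i ∈ S) → ∀ i →
               ∃ λ s → s ∈ S × sub a d n g (suc i) ≈ d * s
    sub-suc∈ {d = d} a∈ d∈ zero    g∈ i = 0# , S.0∈ , sym (zeroʳ d)
    sub-suc∈ {a} {d} a∈ d∈ (suc n) {g} g∈ i =
      let (s , s∈ , e) = sub-suc∈ a∈ d∈ n g∈′ i in
      a * s + _ , S.+∈ (S.*∈ a∈ s∈) (sub∈ a∈ d∈ n g∈′ i) ,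
      trans (+-congʳ (*-congˡ e))
        (solve 4 (λ a d s x → a :* (d :* s) :+ d :* x := d :* (a :* s :+ x)) refl a d s _)
      where
      g∈′ : ∀ i → i ℕ.< n → g (suc i) ∈ S
      g∈′ i i<n = g∈ (suc i) (s≤s i<n)

    stream⇒pol : ∀ n {g} x → (∀ i → i ℕ.< n → g i ∈ S) → ev n g x ∈ Pol S x n
    stream⇒pol zero    x g∈ = nil refl
    stream⇒pol (suc n) x g∈ =
      cons (g∈ 0 (s≤s z≤n)) (stream⇒pol n x (λ i i<n → g∈ (suc i) (s≤s i<n))) refl

    pol⇒stream : ∀ {n x z} → z ∈ Pol S x n → ∃ λ g → (∀ i → g i ∈ S) × z ≈ ev n g x
    pol⇒stream (nil e) = (λ _ → 0#) , (λ _ → S.0∈) , e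
    pol⇒stream (cons {s = s} s∈ w∈ e) =
      let (g , g∈ , e′) = pol⇒stream w∈ in
      (λ { zero → s ; (suc i) → g i }) , (λ { zero → s∈ ; (suc i) → g∈ i }) ,
      trans e (+-congˡ (*-congˡ e′))

  module _ {I : Pred Carrier ℓ} (I-resp : ∀ {x y} → x ≈ y → x ∈ I → y ∈ I) (0∈ : 0# ∈ I)
           (+∈ : ∀ {x y} → x ∈ I → y ∈ I → x + y ∈ I) where

    -- `I` is kept abstract because it is used for 𝔪 and for the multiples of a fixed coefficient by
    -- 𝔪.
    ev∈ : ∀ n {g x} → (∀ {z} → z ∈ I → x * z ∈ I) → (∀ i → i ℕ.< n → g i ∈ I) → ev n g x ∈ I
    ev∈ zero    x* g∈ = 0∈
    ev∈ (suc n) x* g∈ = +∈ (g∈ 0 (s≤s z≤n)) (x* (ev∈ n x* (λ i i<n → g∈ (suc i) (s≤s i<n))))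

    -- The divided difference of g at `a` and `b` is a sum of coefficients of g times monomials in
    -- `a` and `b`, so it stays in `I`. For `I` equal to 𝔪 this says that g contracts distances.
    ev-difference : ∀ n {g a b} → (∀ {z} → z ∈ I → a * z ∈ I) → (∀ {z} → z ∈ I → b * z ∈ I) →
      (∀ i → i ℕ.< n → g i ∈ I) → ∃ λ μ → μ ∈ I × ev n g a - ev n g b ≈ (a - b) * μ
    ev-difference zero    {a = a} {b} a* b* g∈ = 0# , 0∈ ,
      solve 2 (λ a b → con (+ 0) :- con (+ 0) := (a :- b) :* con (+ 0)) refl a b
    ev-difference (suc n) {g} {a} {b} a* b* g∈ =
      let (μ , μ∈ , e) = ev-difference n a* b* g∈′ in
      ev n (g ∘ suc) a + b * μ , +∈ (ev∈ n a* g∈′) (b* μ∈) , (begin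
        (g 0 + a * ev n (g ∘ suc) a) - (g 0 + b * ev n (g ∘ suc) b)
          ≈⟨ solve 5 (λ g a b x y → (g :+ a :* x) :- (g :+ b :* y)
               := (a :- b) :* x :+ b :* (x :- y)) refl (g 0) a b _ _ ⟩
        (a - b) * ev n (g ∘ suc) a + b * (ev n (g ∘ suc) a - ev n (g ∘ suc) b)
          ≈⟨ +-congˡ (*-congˡ e) ⟩
        (a - b) * ev n (g ∘ suc) a + b * ((a - b) * μ)
          ≈⟨ solve 4 (λ d x b μ → d :* x :+ b :* (d :* μ) := d :* (x :+ b :* μ)) refl (a - b) _ b μ ⟩
        (a - b) * (ev n (g ∘ suc) a + b * μ) ∎)
      where
      g∈′ : ∀ i → i ℕ.< n → g (suc i) ∈ I
      g∈′ i i<n = g∈ (suc i) (s≤s i<n)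

-- Monic polynomials and linear factors

module MonicPolynomials {ℓ} (C : CommutativeRing ℓ ℓ) where
  open CommutativeRing C hiding (zero)
  open RingDefs C
  open Polynomials C
  open IntegerSolver C
  open SetoidReasoning setoid

  -- As ev, with the additional leading term xⁿ.
  evᵐ : ℕ → (ℕ → Carrier) → Carrier → Carrier
  evᵐ zero    g x = 1#
  evᵐ (suc n) g x = g 0 + x * evᵐ n (g ∘ suc) x

  evᵐ-congʳ : ∀ n g {x y} → x ≈ y → evᵐ n g x ≈ evᵐ n g y
  evᵐ-congʳ zero    g x≈y = refl
  evᵐ-congʳ (suc n) g x≈y = +-congˡ (*-cong x≈y (evᵐ-congʳ n (g ∘ suc) x≈y))

  prod : ℕ → (ℕ → Carrier) → Carrier
  prod zero    φ = 1#
  prod (suc n) φ = φ 0 * prod n (φ ∘ suc)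

  prod-cong : ∀ n {φ ψ : ℕ → Carrier} → (∀ i → i ℕ.< n → φ i ≈ ψ i) → prod n φ ≈ prod n ψ
  prod-cong zero    φ≈ψ = refl
  prod-cong (suc n) φ≈ψ =
    *-cong (φ≈ψ 0 (s≤s z≤n)) (prod-cong n (λ i i<n → φ≈ψ (suc i) (s≤s i<n)))

  prod-scale : ∀ n c φ → prod n (λ i → c * φ i) ≈ c ^ n * prod n φ
  prod-scale zero    c φ = sym (*-identityˡ 1#)
  prod-scale (suc n) c φ = trans (*-congˡ (prod-scale n c (φ ∘ suc)))
    (solve 4 (λ c f d g → (c :* f) :* (d :* g) := (c :* d) :* (f :* g)) refl
      c (φ 0) (c ^ n) (prod n (φ ∘ suc)))

  evᵐ-divide : ∀ n g r → ∃ λ h → ∀ x →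
    evᵐ (suc n) g x - evᵐ (suc n) g r ≈ (x - r) * evᵐ n h x
  evᵐ-divide zero    g r = g , λ x → solve 3 (λ g x r →
    (g :+ x :* con (+ 1)) :- (g :+ r :* con (+ 1)) := (x :- r) :* con (+ 1)) refl (g 0) x r
  evᵐ-divide (suc n) g r =
    let (h , e) = evᵐ-divide n (g ∘ suc) r in
    (λ { zero → evᵐ (suc n) (g ∘ suc) r ; (suc i) → h i }) , λ x → begin
      (g 0 + x * evᵐ (suc n) (g ∘ suc) x) - (g 0 + r * evᵐ (suc n) (g ∘ suc) r)
        ≈⟨ solve 5 (λ g x r a b → (g :+ x :* a) :- (g :+ r :* b) := (x :- r) :* b :+ x :* (a :- b))
             refl (g 0) x r _ _ ⟩
      (x - r) * evᵐ (suc n) (g ∘ suc) r + x * (evᵐ (suc n) (g ∘ suc) x - evᵐ (suc n) (g ∘ suc) r)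
        ≈⟨ +-congˡ (*-congˡ (e x)) ⟩
      (x - r) * evᵐ (suc n) (g ∘ suc) r + x * ((x - r) * evᵐ n h x)
        ≈⟨ solve 4 (λ d a x b → d :* a :+ x :* (d :* b) := d :* (a :+ x :* b))
             refl (x - r) _ x _ ⟩
      (x - r) * (evᵐ (suc n) (g ∘ suc) r + x * evᵐ n h x) ∎

  x≈y⇒x-y≈0 : ∀ {x y} → x ≈ y → x - y ≈ 0#
  x≈y⇒x-y≈0 {x} {y} e = trans (+-congʳ e) (-‿inverseʳ y)

  x-y≈0⇒x≈y : ∀ {x y} → x - y ≈ 0# → x ≈ y
  x-y≈0⇒x≈y {x} {y} e = trans (solve 2 (λ x y → x := (x :- y) :+ y) refl x y)
    (trans (+-congʳ e) (+-identityˡ y))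

  -- Each root is split off by `evᵐ-divide`; in a domain the remaining roots, being different from
  -- it, are roots of the quotient.
  roots⇒product : (∀ {x y} → x * y ≈ 0# → ¬ (x ≈ 0#) → y ≈ 0#) →
    ∀ n g (ρ : ℕ → Carrier) → (∀ i → i ℕ.< n → evᵐ n g (ρ i) ≈ 0#) →
    (∀ i j → i ℕ.< j → j ℕ.< n → ¬ (ρ i ≈ ρ j)) →
    ∀ x → evᵐ n g x ≈ prod n (λ i → x - ρ i)
  roots⇒product domain zero    g ρ root distinct x = refl
  roots⇒product domain (suc n) g ρ root distinct x =
    let (h , e) = evᵐ-divide n g (ρ 0)
        e′ : ∀ x → evᵐ (suc n) g x ≈ (x - ρ 0) * evᵐ n h x
        e′ x = trans (solve 1 (λ a → a := a :- con (+ 0)) refl _)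
               (trans (+-congˡ (-‿cong (sym (root 0 (s≤s z≤n))))) (e x))
    in trans (e′ x) (*-congˡ (roots⇒product domain n h (ρ ∘ suc)
         (λ i i<n → domain (trans (sym (e′ (ρ (suc i)))) (root (suc i) (s≤s i<n)))
           λ z → distinct 0 (suc i) (s≤s z≤n) (s≤s i<n) (sym (x-y≈0⇒x≈y z)))
         (λ i j i<j j<n → distinct (suc i) (suc j) (s≤s i<j) (s≤s j<n)) x))

  geometric : ∀ n x → (x - 1#) * evᵐ n (λ _ → 1#) x ≈ x ^ suc n - 1#
  geometric zero    x = solve 1 (λ x → (x :- con (+ 1)) :* con (+ 1) := x :* con (+ 1) :- con (+ 1)) refl x
  geometric (suc n) x = begin
    (x - 1#) * (1# + x * E)               ≈⟨ solve 2 (λ x e → (x :- con (+ 1)) :* (con (+ 1) :+ x :* e)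
                                               := (x :- con (+ 1)) :+ x :* ((x :- con (+ 1)) :* e)) refl x E ⟩
    (x - 1#) + x * ((x - 1#) * E)         ≈⟨ +-congˡ (*-congˡ (geometric n x)) ⟩
    (x - 1#) + x * (x ^ suc n - 1#)       ≈⟨ solve 2 (λ x y → (x :- con (+ 1)) :+ x :* (y :- con (+ 1))
                                               := x :* y :- con (+ 1)) refl x (x ^ suc n) ⟩
    x * x ^ suc n - 1#                    ∎
    where E = evᵐ n (λ _ → 1#) x

  geometric-1 : ∀ n → evᵐ n (λ _ → 1#) 1# ≈ suc n · 1#
  geometric-1 zero    = sym (+-identityʳ 1#)
  geometric-1 (suc n) = +-congˡ (trans (*-identityˡ _) (geometric-1 n))

  mon-linear-prod : ∀ {S} → IsSubring S → ∀ {y} n {ρ : ℕ → Carrier} → (∀ i → i ℕ.< n → ρ i ∈ S) →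
                    prod n (λ i → y - ρ i) ∈ Mon S y n
  mon-linear-prod S-subring zero    ρ∈ = nil refl
  mon-linear-prod S-subring (suc n) ρ∈ = mon-* S-subring (linear S-subring (ρ∈ 0 (s≤s z≤n)))
    (mon-linear-prod S-subring n (λ i i<n → ρ∈ (suc i) (s≤s i<n)))

-- Polynomial functions are the polynomials in the identity function with
-- constant functions as coefficients.
module PolynomialFunctions {ℓ} (C : CommutativeRing ℓ ℓ) where
  open CommutativeRing C hiding (zero)
  open RingDefs C
  open MonicPolynomials C

  functionRing : CommutativeRing ℓ ℓ
  functionRing = Pointwise.commutativeRing Carrier C
  module Fun = Polynomials functionRing

  Const : Pred Carrier ℓ → Pred (Carrier → Carrier) ℓ
  Const S φ = ∃ λ s → s ∈ S × ∀ x → φ x ≈ s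

  const-subring : ∀ {S} → IsSubring S → RingDefs.IsSubring functionRing (Const S)
  const-subring S-subring = record
    { resp = λ { φ≈ψ (s , s∈ , e) → s , s∈ , λ x → trans (sym (φ≈ψ x)) (e x) }
    ; 0∈   = 0# , S.0∈ , λ _ → refl
    ; 1∈   = 1# , S.1∈ , λ _ → refl
    ; +∈   = λ { (s , s∈ , e) (t , t∈ , f) → s + t , S.+∈ s∈ t∈ , λ x → +-cong (e x) (f x) }
    ; *∈   = λ { (s , s∈ , e) (t , t∈ , f) → s * t , S.*∈ s∈ t∈ , λ x → *-cong (e x) (f x) }
    ; -∈   = λ { (s , s∈ , e) → - s , S.-∈ s∈ , λ x → -‿cong (e x) }
    }
    where module S = IsSubring S-subring

  -- Membership in `Mon` over the function ring provides coefficients independent of the argument,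
  -- as Hensel's lemma requires; membership at a single point would forget the polynomial.
  mon⇒evᵐ : ∀ {S n φ} → IsSubring S → φ ∈ Fun.Mon (Const S) id n →
            ∃ λ g → (∀ i → g i ∈ S) × ∀ x → φ x ≈ evᵐ n g x
  mon⇒evᵐ S-subring (Fun.nil e) = (λ _ → 0#) , (λ _ → IsSubring.0∈ S-subring) , e
  mon⇒evᵐ S-subring (Fun.cons (s , s∈ , e) w∈ e′) =
    let (g , g∈ , f) = mon⇒evᵐ S-subring w∈ in
    (λ { zero → s ; (suc i) → g i }) , (λ { zero → s∈ ; (suc i) → g∈ i }) ,
    λ x → trans (e′ x) (+-cong (e x) (*-congˡ (f x)))

-- Valuation rings of a field

module Valuations {ℓ} (em : ExcludedMiddle ℓ) (L : Field ℓ) (O : ValuationRing L) where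
  open Field L
  open ValuationRing O
  open IntegerSolver commutativeRing
  open Polynomials commutativeRing using (Mon; nil; cons)
  open MonicPolynomials commutativeRing using (prod)
  open ExpProperties commutativeSemiring using (^-distrib-*; ^-congˡ)
  open SetoidReasoning setoid

  domain : ∀ {x y} → x * y ≈ 0# → ¬ (x ≈ 0#) → y ≈ 0#
  domain xy≈0 x≉0 = decidable-stable em (λ y≉0 → ≉0-* x≉0 y≉0 xy≈0)

  -- 0⁻¹ is 0.
  infix 8 _⁻¹
  _⁻¹ : Carrier → Carrier
  x ⁻¹ with em {P = x ≈ 0#}
  ... | yes _   = 0#
  ... | no x≉0 = proj₁ (inverse x≉0)

  inverseʳ : ∀ {x} → ¬ (x ≈ 0#) → x * x ⁻¹ ≈ 1#
  inverseʳ {x} x≉0 with em {P = x ≈ 0#}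
  ... | yes x≈0 = contradiction x≈0 x≉0
  ... | no x≉0′ = proj₂ (inverse x≉0′)

  factor≉0ˡ : ∀ {x y} → x * y ≈ 1# → ¬ (x ≈ 0#)
  factor≉0ˡ xy≈1 x≈0 = 1≉0 (trans (sym xy≈1) (trans (*-congʳ x≈0) (zeroˡ _)))

  power≉0 : ∀ {x} n → ¬ (x ≈ 0#) → ¬ (x ^ n ≈ 0#)
  power≉0 zero    x≉0 = 1≉0
  power≉0 (suc n) x≉0 = ≉0-* x≉0 (power≉0 n x≉0)

  cancelˡ : ∀ {c x y} → ¬ (c ≈ 0#) → c * x ≈ c * y → x ≈ y
  cancelˡ {c} {x} {y} c≉0 e = begin
    x                ≈⟨ *-identityˡ x ⟨
    1# * x           ≈⟨ *-congʳ (inverseʳ c≉0) ⟨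
    c * c ⁻¹ * x     ≈⟨ solve 3 (λ c d x → c :* d :* x := d :* (c :* x)) refl c (c ⁻¹) x ⟩
    c ⁻¹ * (c * x)   ≈⟨ *-congˡ e ⟩
    c ⁻¹ * (c * y)   ≈⟨ solve 3 (λ c d x → d :* (c :* x) := c :* d :* x) refl c (c ⁻¹) y ⟩
    c * c ⁻¹ * y     ≈⟨ *-congʳ (inverseʳ c≉0) ⟩
    1# * y           ≈⟨ *-identityˡ y ⟩
    y                ∎

  1∈units : 1# ∈ units
  1∈units = 1∈ , 1# , 1∈ , *-identityˡ 1#

  1∉𝔪 : 1# ∉ 𝔪
  1∉𝔪 (_ , 1∉) = 1∉ 1∈units

  units-resp : ∀ {x y} → x ≈ y → x ∈ units → y ∈ units
  units-resp x≈y (x∈ , w , w∈ , e) = resp x≈y x∈ , w , w∈ , trans (*-congʳ (sym x≈y)) e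

  units≉0 : ∀ {u} → u ∈ units → ¬ (u ≈ 0#)
  units≉0 (_ , _ , _ , e) = factor≉0ˡ e

  units∌𝔪 : ∀ {u} → u ∈ units → u ∉ 𝔪
  units∌𝔪 u∈ (_ , u∉) = u∉ u∈

  ∉𝔪⇒units : ∀ {x} → x ∈ 𝒪 → x ∉ 𝔪 → x ∈ units
  ∉𝔪⇒units x∈ x∉𝔪 = decidable-stable em (λ x∉ → x∉𝔪 (x∈ , x∉))

  units⁻¹ : ∀ {u} → u ∈ units → u ⁻¹ ∈ units
  units⁻¹ {u} u∈@(u∈𝒪 , w , w∈ , uw≈1) =
    units-resp (cancelˡ (units≉0 u∈) (trans uw≈1 (sym (inverseʳ (units≉0 u∈)))))
      (w∈ , u , u∈𝒪 , trans (*-comm w u) uw≈1)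

  units-+-𝔪 : ∀ {u m} → u ∈ units → m ∈ 𝔪 → u + m ∈ units
  units-+-𝔪 {u} {m} u∈ m∈ = ∉𝔪⇒units (+∈ (proj₁ u∈) (proj₁ m∈)) λ u+m∈ →
    units∌𝔪 u∈ (𝔪-resp (solve 2 (λ u m → (u :+ m) :+ :- m := u) refl u m) (𝔪-+ u+m∈ (𝔪-neg m∈)))

  ≡𝔪⇒units : ∀ {x u} → u ∈ units → x - u ∈ 𝔪 → x ∈ units
  ≡𝔪⇒units {x} {u} u∈ x-u∈ = units-resp
    (solve 2 (λ u x → u :+ (x :- u) := x) refl u x) (units-+-𝔪 u∈ x-u∈)

  units-neg : ∀ {u} → u ∈ units → - u ∈ units
  units-neg {u} (u∈ , w , w∈ , e) = -∈ u∈ , - w , -∈ w∈ ,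
    trans (solve 2 (λ u w → :- u :* :- w := u :* w) refl u w) e

  units-cancelˡ : ∀ {u x} → u ∈ units → u * x ∈ 𝒪 → x ∈ 𝒪
  units-cancelˡ {u} {x} (_ , w , w∈ , uw≈1) ux∈ = resp
    (trans (solve 3 (λ w u x → w :* (u :* x) := (u :* w) :* x) refl w u x)
      (trans (*-congʳ uw≈1) (*-identityˡ x))) (*∈ w∈ ux∈)

  𝔪-prime : ∀ {x y} → x ∈ 𝒪 → y ∈ 𝒪 → x * y ∈ 𝔪 → x ∈ 𝔪 ⊎ y ∈ 𝔪
  𝔪-prime {x} {y} x∈ y∈ xy∈ with em {P = x ∈ 𝔪}
  ... | yes x∈𝔪 = inj₁ x∈𝔪
  ... | no  x∉𝔪 with em {P = y ∈ 𝔪}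
  ...   | yes y∈𝔪 = inj₂ y∈𝔪
  ...   | no  y∉𝔪 = contradiction xy∈ (units∌𝔪 (units-* (∉𝔪⇒units x∈ x∉𝔪) (∉𝔪⇒units y∈ y∉𝔪)))

  prod∈ : ∀ n {φ : ℕ → Carrier} → (∀ i → φ i ∈ 𝒪) → prod n φ ∈ 𝒪
  prod∈ zero    φ∈ = 1∈
  prod∈ (suc n) φ∈ = *∈ (φ∈ 0) (prod∈ n (φ∈ ∘ suc))

  𝔪-prime-prod : ∀ n {φ : ℕ → Carrier} → (∀ i → φ i ∈ 𝒪) → prod n φ ∈ 𝔪 → ∃ λ i → i ℕ.< n × φ i ∈ 𝔪
  𝔪-prime-prod zero    φ∈ 1∈𝔪 = contradiction 1∈𝔪 1∉𝔪
  𝔪-prime-prod (suc n) {φ} φ∈ e with 𝔪-prime (φ∈ 0) (prod∈ n (φ∈ ∘ suc)) e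
  ... | inj₁ φ0∈ = 0 , s≤s z≤n , φ0∈
  ... | inj₂ e′ = let (i , i<n , φi∈) = 𝔪-prime-prod n (φ∈ ∘ suc) e′ in suc i , s≤s i<n , φi∈

  units-prod : ∀ n {φ : ℕ → Carrier} → (∀ i → i ℕ.< n → φ i ∈ units) → prod n φ ∈ units
  units-prod zero    φ∈ = 1∈units
  units-prod (suc n) φ∈ = units-* (φ∈ 0 (s≤s z≤n)) (units-prod n (λ i i<n → φ∈ (suc i) (s≤s i<n)))

  zero-prod : ∀ n {φ : ℕ → Carrier} → prod n φ ≈ 0# → ∃ λ i → i ℕ.< n × φ i ≈ 0#
  zero-prod zero    1≈0 = contradiction 1≈0 1≉0
  zero-prod (suc n) {φ} e with em {P = φ 0 ≈ 0#}
  ... | yes φ0≈0 = 0 , s≤s z≤n , φ0≈0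
  ... | no  φ0≉0 = let (i , i<n , φi≈0) = zero-prod n (domain e φ0≉0) in suc i , s≤s i<n , φi≈0

  ∉𝒪⇒inverse∈𝔪 : ∀ {x y} → x * y ≈ 1# → x ∉ 𝒪 → y ∈ 𝔪
  ∉𝒪⇒inverse∈𝔪 {x} {y} xy≈1 x∉ with total xy≈1
  ... | inj₁ x∈ = contradiction x∈ x∉
  ... | inj₂ y∈ = y∈ , λ { (_ , z , z∈ , yz≈1) → x∉ (resp (begin
      z             ≈⟨ *-identityˡ z ⟨
      1# * z        ≈⟨ *-congʳ xy≈1 ⟨
      x * y * z     ≈⟨ *-assoc x y z ⟩
      x * (y * z)   ≈⟨ *-congˡ yz≈1 ⟩
      x * 1#        ≈⟨ *-identityʳ x ⟩
      x             ∎) z∈) }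

  power∈ : ∀ {x} n → x ∈ 𝒪 → x ^ n ∈ 𝒪
  power∈ zero    x∈ = 1∈
  power∈ (suc n) x∈ = *∈ x∈ (power∈ n x∈)

  units-^ : ∀ {x} n → x ∈ units → x ^ n ∈ units
  units-^ zero    x∈ = 1∈units
  units-^ (suc n) x∈ = units-* x∈ (units-^ n x∈)

  𝔪-^ : ∀ {x} n → x ∈ 𝔪 → x ^ suc n ∈ 𝔪
  𝔪-^ {x} n x∈ = 𝔪-resp (*-comm (x ^ n) x) (𝔪-* (power∈ n (proj₁ x∈)) x∈)

  1^n≈1 : ∀ n → 1# ^ n ≈ 1#
  1^n≈1 zero    = refl
  1^n≈1 (suc n) = trans (*-identityˡ _) (1^n≈1 n)

  -- If `x` were outside 𝒪, its inverse would lie in 𝔪, and so would 1, as the power of `x` times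
  -- that of its inverse. If `x` were in 𝔪, so would be its power.
  root∈units : ∀ {x} n → x ^ suc n ∈ units → x ∈ units
  root∈units {x} n xⁿ∈ = ∉𝔪⇒units x∈ (λ x∈𝔪 → units∌𝔪 xⁿ∈ (𝔪-^ n x∈𝔪))
    where
    x∈ : x ∈ 𝒪
    x∈ = decidable-stable em λ x∉ →
      let x≉0 : ¬ (x ≈ 0#)
          x≉0 x≈0 = x∉ (resp (sym x≈0) 0∈)
          (y , xy≈1) = inverse x≉0
      in 1∉𝔪 (𝔪-resp (trans (sym (^-distrib-* x y (suc n))) (trans (^-congˡ (suc n) xy≈1) (1^n≈1 (suc n))))
           (𝔪-* (proj₁ xⁿ∈) (𝔪-^ n (∉𝒪⇒inverse∈𝔪 xy≈1 x∉))))

  power≡1 : ∀ {x} n → x - 1# ∈ 𝔪 → x ∈ 𝒪 → x ^ n - 1# ∈ 𝔪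
  power≡1 zero    x≡1 x∈ = 𝔪-≈ refl
  power≡1 (suc n) x≡1 x∈ = 𝔪-resp (+-congˡ (-‿cong (*-identityˡ 1#)))
    (𝔪-*-cong 1∈ (power∈ n x∈) x≡1 (power≡1 n x≡1 x∈))

  -- For `x` outside 𝒪 the inverse w lies in 𝔪. Multiplying a monic polynomial in `x` of degree n by
  -- wⁿ turns the leading term into 1 and puts all others into 𝔪; at the value 0 this places 1 in 𝔪.
  integrallyClosed : ∀ {S} → S ⊆ 𝒪 → ∀ {x n} → 0# ∈ Mon S x n → x ∈ 𝒪
  integrallyClosed {S} S⊆𝒪 {x} 0∈Mon = decidable-stable em λ x∉ →
    let x≉0 : ¬ (x ≈ 0#)
        x≉0 x≈0 = x∉ (resp (sym x≈0) 0∈)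
        (w , xw≈1) = inverse x≉0
    in 1∉𝔪 (𝔪-resp (solve 1 (λ v → :- (con (+ 0) :* v :- con (+ 1)) := con (+ 1)) refl _)
         (𝔪-neg (leading xw≈1 (∉𝒪⇒inverse∈𝔪 xw≈1 x∉) 0∈Mon)))
    where
    leading : ∀ {w} → x * w ≈ 1# → w ∈ 𝔪 → ∀ {n z} → z ∈ Mon S x n → z * w ^ n - 1# ∈ 𝔪
    leading xw≈1 w∈ (nil z≈1) = 𝔪-≈ (trans (*-congʳ z≈1) (*-identityˡ 1#))
    leading {w} xw≈1 w∈ {suc n} {z} (cons {s = s} {z′} s∈ z′∈ e) = 𝔪-resp (begin
        s * w ^ n * w + (z′ * w ^ n - 1#)
          ≈⟨ +-congˡ (+-congʳ (trans (sym (*-identityˡ _)) (*-congʳ (sym xw≈1)))) ⟩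
        s * w ^ n * w + (x * w * (z′ * w ^ n) - 1#)
          ≈⟨ solve 5 (λ s w x z v → s :* v :* w :+ (x :* w :* (z :* v) :- con (+ 1))
               := (s :+ x :* z) :* (w :* v) :- con (+ 1)) refl s w x z′ (w ^ n) ⟩
        (s + x * z′) * (w * w ^ n) - 1#
          ≈⟨ +-congʳ (*-congʳ e) ⟨
        z * w ^ suc n - 1# ∎)
      (𝔪-+ (𝔪-* (*∈ (S⊆𝒪 s∈) (power∈ n (proj₁ w∈))) w∈) (leading xw≈1 w∈ z′∈))

-- The data of the theorem seen from inside L: 𝕂 is the image of K, R that of
-- A, and p = suc q.
record Setting (ℓ : Level) : Set (Level.suc ℓ) where
  field
    em : ExcludedMiddle ℓ
    L  : Field ℓ
    O  : ValuationRing L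
  open Field L
  open ValuationRing O
  open MonicPolynomials commutativeRing using (evᵐ)
  field
    𝕂         : Pred Carrier ℓ
    𝕂-subring : IsSubring 𝕂
    𝕂-inverse : ∀ {x y} → x ∈ 𝕂 → x * y ≈ 1# → y ∈ 𝕂
    q         : ℕ

  R : Pred Carrier ℓ
  R x = x ∈ 𝕂 × x ∈ 𝒪

  p : ℕ
  p = suc q

  field
    p∈𝔪          : p · 1# ∈ 𝔪
    𝔪⇒p∣         : ∀ m → m · 1# ∈ 𝔪 → p ∣ m
    ζ            : Carrier
    ζ∈𝕂          : ζ ∈ 𝕂
    ζ-primitive  : IsPrimitiveRootOfUnity p ζ
    -- This and the next field are e = 1 and f = 1, stated on elements.
    sameValues   : ∀ {x} → ¬ (x ≈ 0#) → ∃₂ λ k u → k ∈ 𝕂 × u ∈ units × x ≈ k * u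
    sameResidues : ∀ {x} → x ∈ 𝒪 → ∃ λ a → a ∈ R × x - a ∈ 𝔪
    proper       : ∃ λ x → x ∉ 𝕂
    -- Hensel's lemma at 0 for the polynomial c + X g, g monic.
    hensel       : ∀ n {c g} → c ∈ R → c ∈ 𝔪 → (∀ i → g i ∈ R) → evᵐ n g 0# ∈ units →
                   ∃ λ b → b ∈ R × b ∈ 𝔪 × c + b * evᵐ n g b ≈ 0#

  module 𝕂 = IsSubring 𝕂-subring

  R-subring : IsSubring R
  R-subring = record
    { resp = λ { e (x∈ , x∈′) → 𝕂.resp e x∈ , resp e x∈′ }
    ; 0∈   = 𝕂.0∈ , 0∈
    ; 1∈   = 𝕂.1∈ , 1∈
    ; +∈   = λ { (x∈ , x∈′) (y∈ , y∈′) → 𝕂.+∈ x∈ y∈ , +∈ x∈′ y∈′ }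
    ; *∈   = λ { (x∈ , x∈′) (y∈ , y∈′) → 𝕂.*∈ x∈ y∈ , *∈ x∈′ y∈′ }
    ; -∈   = λ { (x∈ , x∈′) → 𝕂.-∈ x∈ , -∈ x∈′ }
    }
  module R = IsSubring R-subring

-- Roots of unity modulo the maximal ideal

module RootsOfUnity {ℓ} (setting : Setting ℓ) where
  open Setting setting
  open Field L
  open ValuationRing O
  open Valuations em L O public
  open IntegerSolver commutativeRing
  open MonicPolynomials commutativeRing
  open ExpProperties commutativeSemiring using (^-congˡ; ^-congʳ; ^-homo-*; ^-assocʳ; ^-distrib-*)
  open MultProperties semiring using (×1-homo-*)
  open SetoidReasoning setoid

  ⁻¹∈𝕂 : ∀ {x} → x ∈ 𝕂 → ¬ (x ≈ 0#) → x ⁻¹ ∈ 𝕂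
  ⁻¹∈𝕂 x∈ x≉0 = 𝕂-inverse x∈ (inverseʳ x≉0)

  q≢0 : ¬ (q ≡ 0)
  q≢0 q≡0 = 1∉𝔪 (𝔪-resp (trans (reflexive (≡.cong (λ q → suc q · 1#) q≡0)) (+-identityʳ 1#)) p∈𝔪)

  ·1∈𝒪 : ∀ n → n · 1# ∈ 𝒪
  ·1∈𝒪 zero    = 0∈
  ·1∈𝒪 (suc n) = +∈ 1∈ (·1∈𝒪 n)

  ·1∈𝕂 : ∀ n → n · 1# ∈ 𝕂
  ·1∈𝕂 zero    = 𝕂.0∈
  ·1∈𝕂 (suc n) = 𝕂.+∈ 𝕂.1∈ (·1∈𝕂 n)

  ·1∈units : ∀ n → suc n ℕ.< p → suc n · 1# ∈ units
  ·1∈units n n<p = ∉𝔪⇒units (·1∈𝒪 (suc n)) λ n∈𝔪 →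
    ℕ.<⇒≱ n<p (∣⇒≤ (𝔪⇒p∣ (suc n) n∈𝔪))

  ζ^p≈1 : ζ ^ p ≈ 1#
  ζ^p≈1 = proj₁ ζ-primitive

  ζ∈units : ζ ∈ units
  ζ∈units = root∈units q (units-resp (sym ζ^p≈1) 1∈units)

  ζ∈R : ζ ∈ R
  ζ∈R = ζ∈𝕂 , proj₁ ζ∈units

  ζ≉0 : ¬ (ζ ≈ 0#)
  ζ≉0 = units≉0 ζ∈units

  ζ-injective : ∀ i j → i ℕ.< j → j ℕ.< p ℕ.+ i → ¬ (ζ ^ i ≈ ζ ^ j)
  ζ-injective i j i<j j<p+i e = proj₂ ζ-primitive (j ℕ.∸ i) (ℕ.m<n⇒0<n∸m i<j) j∸i<p
    (sym (cancelˡ (power≉0 i ζ≉0) (begin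
      ζ ^ i * 1#               ≈⟨ *-identityʳ _ ⟩
      ζ ^ i                    ≈⟨ e ⟩
      ζ ^ j                    ≈⟨ ^-congʳ ζ (ℕ.m+[n∸m]≡n (ℕ.<⇒≤ i<j)) ⟨
      ζ ^ (i ℕ.+ (j ℕ.∸ i))    ≈⟨ ^-homo-* ζ i (j ℕ.∸ i) ⟩
      ζ ^ i * ζ ^ (j ℕ.∸ i)    ∎)))
    where
    j∸i<p : j ℕ.∸ i ℕ.< p
    j∸i<p = ≡.subst (j ℕ.∸ i ℕ.<_) (ℕ.m+n∸n≡m p i) (ℕ.∸-monoˡ-< j<p+i (ℕ.<⇒≤ i<j))

  -- On the left stands 1 + X + ... + X^q = (X^p - 1) / (X - 1), whose q roots are the nontrivial
  -- powers of ζ.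
  cyclotomic : ∀ x → evᵐ q (λ _ → 1#) x ≈ prod q (λ i → x - ζ ^ suc i)
  cyclotomic = roots⇒product domain q (λ _ → 1#) (λ i → ζ ^ suc i)
    (λ i i<q → domain (trans (geometric q (ζ ^ suc i)) (x≈y⇒x-y≈0 (begin
        (ζ ^ suc i) ^ p      ≈⟨ ^-assocʳ ζ (suc i) p ⟩
        ζ ^ (suc i ℕ.* p)    ≈⟨ ^-congʳ ζ (ℕ.*-comm (suc i) p) ⟩
        ζ ^ (p ℕ.* suc i)    ≈⟨ ^-assocʳ ζ p (suc i) ⟨
        (ζ ^ p) ^ suc i      ≈⟨ ^-congˡ (suc i) ζ^p≈1 ⟩
        1# ^ suc i           ≈⟨ 1^n≈1 (suc i) ⟩
        1#                   ∎)))
      λ e → proj₂ ζ-primitive (suc i) (s≤s z≤n) (s≤s i<q) (x-y≈0⇒x≈y e))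
    (λ i j i<j j<q → ζ-injective (suc i) (suc j) (s≤s i<j)
      (ℕ.≤-trans (s≤s (s≤s (ℕ.<⇒≤ j<q))) (ℕ.≤-trans (ℕ.≤-reflexive (ℕ.+-comm 1 p)) (ℕ.+-monoʳ-≤ p (s≤s z≤n)))))

  x^p-1 : ∀ x → (x - 1#) * prod q (λ i → x - ζ ^ suc i) ≈ x ^ p - 1#
  x^p-1 x = trans (*-congˡ (sym (cyclotomic x))) (geometric q x)

  -- Primality of p is read off from the residue field: if p = m g, then m or g lies in 𝔪, as 𝔪 is
  -- prime, and is therefore divisible by p.
  power-coprime : ∀ k → 0 ℕ.< k → k ℕ.< p → Coprime k p
  power-coprime (suc k) _ k<p {g} (g∣k , divides m p≡m*g)
    with 𝔪-prime (·1∈𝒪 m) (·1∈𝒪 g) (𝔪-resp (trans (reflexive (≡.cong (_· 1#) p≡m*g)) (×1-homo-* m g)) p∈𝔪)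
  ... | inj₂ g∈𝔪 with g | 𝔪⇒p∣ g g∈𝔪
  ...   | zero   | _   = contradiction (≡.trans p≡m*g (ℕ.*-zeroʳ m)) λ ()
  ...   | suc g′ | p∣g = contradiction (∣⇒≤ p∣g) (ℕ.<⇒≱ (ℕ.≤-<-trans (∣⇒≤ g∣k) k<p))
  power-coprime (suc k) _ k<p {g} (g∣k , divides m p≡m*g) | inj₁ m∈𝔪 with m | 𝔪⇒p∣ m m∈𝔪
  ...   | suc m′ | p∣m = ℕ.*-cancelˡ-≡ g 1 (suc m′) (≡.trans (≡.sym p≡m*g) (≡.trans p≡m (≡.sym (ℕ.*-identityʳ (suc m′)))))
    where
    0<g : ∀ g → p ≡ suc m′ ℕ.* g → 1 ℕ.≤ g
    0<g zero    e = contradiction (≡.trans e (ℕ.*-zeroʳ (suc m′))) λ ()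
    0<g (suc g) e = s≤s z≤n
    p≡m : p ≡ suc m′
    p≡m = ℕ.≤-antisym (∣⇒≤ p∣m)
      (≡.subst₂ ℕ._≤_ (ℕ.*-identityʳ (suc m′)) (≡.sym p≡m*g) (ℕ.*-monoʳ-≤ (suc m′) (0<g g p≡m*g)))

  ζ^[np]≈1 : ∀ n → ζ ^ (n ℕ.* p) ≈ 1#
  ζ^[np]≈1 n = begin
    ζ ^ (n ℕ.* p)  ≈⟨ ^-congʳ ζ (ℕ.*-comm n p) ⟩
    ζ ^ (p ℕ.* n)  ≈⟨ ^-assocʳ ζ p n ⟨
    (ζ ^ p) ^ n    ≈⟨ ^-congˡ n ζ^p≈1 ⟩
    1# ^ n         ≈⟨ 1^n≈1 n ⟩
    1#             ∎

  ζ≡1-aux : ∀ {k} → ζ ^ k - 1# ∈ 𝔪 → Bézout.Identity 1 k p → ζ - 1# ∈ 𝔪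
  ζ≡1-aux {k} ζ^k≡1 (Bézout.+- a b eq) = 𝔪-resp {(ζ ^ k) ^ a - 1#} (+-congʳ (begin
    (ζ ^ k) ^ a          ≈⟨ ^-assocʳ ζ k a ⟩
    ζ ^ (k ℕ.* a)        ≈⟨ ^-congʳ ζ (ℕ.*-comm k a) ⟩
    ζ ^ (a ℕ.* k)        ≈⟨ ^-congʳ ζ eq ⟨
    ζ * ζ ^ (b ℕ.* p)    ≈⟨ *-congˡ (ζ^[np]≈1 b) ⟩
    ζ * 1#               ≈⟨ *-identityʳ ζ ⟩
    ζ                    ∎)) (power≡1 a ζ^k≡1 (power∈ k (proj₂ ζ∈R)))
  -- Here 1 + a k = b p, so (ζᵏ)ᵃ is the inverse of ζ; this is the origin of the factor `- ζ`.
  ζ≡1-aux {k} ζ^k≡1 (Bézout.-+ a b eq) = 𝔪-resp {(- ζ) * ((ζ ^ k) ^ a - 1#)} (begin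
    - ζ * ((ζ ^ k) ^ a - 1#)     ≈⟨ solve 2 (λ z y → :- z :* (y :- con (+ 1)) := z :- z :* y) refl ζ _ ⟩
    ζ - ζ * (ζ ^ k) ^ a          ≈⟨ +-congˡ (-‿cong (*-congˡ (^-assocʳ ζ k a))) ⟩
    ζ - ζ * ζ ^ (k ℕ.* a)        ≈⟨ +-congˡ (-‿cong (*-congˡ (^-congʳ ζ (ℕ.*-comm k a)))) ⟩
    ζ - ζ * ζ ^ (a ℕ.* k)        ≈⟨ +-congˡ (-‿cong (trans (^-congʳ ζ eq) (ζ^[np]≈1 b))) ⟩
    ζ - 1#                       ∎)
    (𝔪-* (-∈ (proj₂ ζ∈R)) (power≡1 a ζ^k≡1 (power∈ k (proj₂ ζ∈R))))

  -- Some factor 1 - ζᵏ of p = ∏ (1 - ζᵏ) lies in 𝔪, and ζ is a power of ζᵏ.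
  ζ≡1 : ζ - 1# ∈ 𝔪
  ζ≡1 =
    let (i , i<q , e) = 𝔪-prime-prod q {λ i → 1# - ζ ^ suc i}
          (λ i → +∈ 1∈ (-∈ (power∈ (suc i) (proj₂ ζ∈R))))
          (𝔪-resp (trans (sym (geometric-1 q)) (cyclotomic 1#)) p∈𝔪)
    in ζ≡1-aux {suc i} (𝔪-resp (swap- 1# (ζ ^ suc i)) (𝔪-neg e))
         (coprime-Bézout (power-coprime (suc i) (s≤s z≤n) (s≤s i<q)))

  -- This is 1 + ζ + ... + ζⁱ⁻¹ = (ζⁱ - 1) / (ζ - 1). It is congruent to i because ζ ≡ 1, hence a
  -- unit for 0 < i < p. The `γ` of `IsNormalization` is a different element, see `conductor`.
  γ : ℕ → Carrier
  γ zero    = 0#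
  γ (suc i) = 1# + ζ * γ i

  [ζ-1]γ : ∀ i → (ζ - 1#) * γ i ≈ ζ ^ i - 1#
  [ζ-1]γ zero    = trans (zeroʳ _) (sym (-‿inverseʳ 1#))
  [ζ-1]γ (suc i) = begin
    (ζ - 1#) * (1# + ζ * γ i)          ≈⟨ solve 2 (λ z g → (z :- con (+ 1)) :* (con (+ 1) :+ z :* g)
                                            := (z :- con (+ 1)) :+ z :* ((z :- con (+ 1)) :* g)) refl ζ (γ i) ⟩
    (ζ - 1#) + ζ * ((ζ - 1#) * γ i)    ≈⟨ +-congˡ (*-congˡ ([ζ-1]γ i)) ⟩
    (ζ - 1#) + ζ * (ζ ^ i - 1#)        ≈⟨ solve 2 (λ z y → (z :- con (+ 1)) :+ z :* (y :- con (+ 1))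
                                            := z :* y :- con (+ 1)) refl ζ (ζ ^ i) ⟩
    ζ * ζ ^ i - 1#                     ∎

  γ∈R : ∀ i → γ i ∈ R
  γ∈R zero    = R.0∈
  γ∈R (suc i) = R.+∈ R.1∈ (R.*∈ ζ∈R (γ∈R i))

  γ≡ : ∀ i → γ i - i · 1# ∈ 𝔪
  γ≡ zero    = 𝔪-≈ refl
  γ≡ (suc i) = 𝔪-+-cong (𝔪-≈ refl) (𝔪-resp (+-congˡ (-‿cong (*-identityˡ _)))
    (𝔪-*-cong 1∈ (proj₂ (γ∈R i)) ζ≡1 (γ≡ i)))

  γ∈units : ∀ i → i ℕ.< q → γ (suc i) ∈ units
  γ∈units i i<q = ≡𝔪⇒units (·1∈units i (s≤s i<q)) (γ≡ (suc i))

  ζ-1≉0 : ¬ (ζ - 1# ≈ 0#)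
  ζ-1≉0 e = proj₂ ζ-primitive 1 (s≤s z≤n) (s≤s (ℕ.n≢0⇒n>0 q≢0))
    (trans (*-identityʳ ζ) (x-y≈0⇒x≈y e))

  ζ^∈R : ∀ i → ζ ^ i ∈ R
  ζ^∈R zero    = R.1∈
  ζ^∈R (suc i) = R.*∈ ζ∈R (ζ^∈R i)

  ^p≈1 : ∀ {x} → x ^ p ≈ 1# → ∃ λ j → j ℕ.< p × x ≈ ζ ^ j
  ^p≈1 {x} e with em {P = x - 1# ≈ 0#}
  ... | yes x-1≈0 = 0 , s≤s z≤n , x-y≈0⇒x≈y x-1≈0
  ... | no  x-1≉0 =
    let (i , i<q , e′) = zero-prod q (domain (trans (x^p-1 x) (x≈y⇒x-y≈0 e)) x-1≉0)
    in suc i , s≤s i<q , x-y≈0⇒x≈y e′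

  ^p-injective : ∀ {x y} → ¬ (y ≈ 0#) → x ^ p ≈ y ^ p → ∃ λ j → j ℕ.< p × x ≈ ζ ^ j * y
  ^p-injective {x} {y} y≉0 e =
    let (j , j<p , e′) = ^p≈1 {x * y ⁻¹} (begin
          (x * y ⁻¹) ^ p        ≈⟨ ^-distrib-* x (y ⁻¹) p ⟩
          x ^ p * (y ⁻¹) ^ p    ≈⟨ *-congʳ e ⟩
          y ^ p * (y ⁻¹) ^ p    ≈⟨ ^-distrib-* y (y ⁻¹) p ⟨
          (y * y ⁻¹) ^ p        ≈⟨ ^-congˡ p (inverseʳ y≉0) ⟩
          1# ^ p                ≈⟨ 1^n≈1 p ⟩
          1#                    ∎)
    in j , j<p , (begin
      x                 ≈⟨ *-identityʳ x ⟨
      x * 1#            ≈⟨ *-congˡ (inverseʳ y≉0) ⟨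
      x * (y * y ⁻¹)    ≈⟨ solve 3 (λ x y z → x :* (y :* z) := x :* z :* y) refl x y (y ⁻¹) ⟩
      x * y ⁻¹ * y      ≈⟨ *-congʳ e′ ⟩
      ζ ^ j * y         ∎)

-- Generators, their approximations, and integrality of u

module Approximation {ℓ} (setting : Setting ℓ) where
  open Setting setting
  open Field L
  open ValuationRing O
  open RootsOfUnity setting public
  open IntegerSolver commutativeRing
  open Polynomials commutativeRing
  open MonicPolynomials commutativeRing
  open PolynomialFunctions commutativeRing using (functionRing; const-subring; mon⇒evᵐ)
  open ExpProperties commutativeSemiring using (^-congˡ; ^-distrib-*)
  open SetoidReasoning setoid

  -- Membership in 𝒮, phrased inside `L`; the two are matched by `𝒮⇒generator` and `generator⇒𝒮`.
  -- Polynomials in `α` suffice for generation, as `α` is algebraic.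
  record Generator (α : Carrier) : Set ℓ where
    field
      α^p∈𝕂     : α ^ p ∈ 𝕂
      α≡1       : α - 1# ∈ 𝔪
      generates : ∀ y → y ∈ Adj 𝕂 α

    α∉𝕂 : α ∉ 𝕂
    α∉𝕂 α∈ = proj₂ proper (adj-minimal 𝕂-subring 𝕂-subring id α∈ (generates (proj₁ proper)))

    α∈units : α ∈ units
    α∈units = ≡𝔪⇒units 1∈units α≡1

  record Approximant (α c u : Carrier) : Set ℓ where
    field
      generator : Generator α
      c∈𝕂       : c ∈ 𝕂
      c≉0       : ¬ (c ≈ 0#)
      u∈units   : u ∈ units
      α-1≈cu    : α - 1# ≈ c * u
    open Generator generator public

    α≈1+cu : α ≈ 1# + c * u
    α≈1+cu = trans (solve 1 (λ a → a := con (+ 1) :+ (a :- con (+ 1))) refl α) (+-congˡ α-1≈cu)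

    c∈𝔪 : c ∈ 𝔪
    c∈𝔪 = 𝔪-resp (begin
      u ⁻¹ * (α - 1#)    ≈⟨ *-congˡ α-1≈cu ⟩
      u ⁻¹ * (c * u)     ≈⟨ solve 3 (λ v c u → v :* (c :* u) := c :* (u :* v)) refl (u ⁻¹) c u ⟩
      c * (u * u ⁻¹)     ≈⟨ *-congˡ (inverseʳ (units≉0 u∈units)) ⟩
      c * 1#             ≈⟨ *-identityʳ c ⟩
      c                  ∎) (𝔪-* (proj₁ (units⁻¹ u∈units)) α≡1)

    c∈R : c ∈ R
    c∈R = c∈𝕂 , proj₁ c∈𝔪

    u∉𝕂 : u ∉ 𝕂
    u∉𝕂 u∈ = α∉𝕂 (𝕂.resp (sym α≈1+cu) (𝕂.+∈ 𝕂.1∈ (𝕂.*∈ c∈𝕂 u∈)))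

  approximant : ∀ {α} → Generator α → ∃₂ λ c u → Approximant α c u
  approximant {α} generator =
    let (c , u , c∈ , u∈ , e) = sameValues (λ α-1≈0 → α∉𝕂 (𝕂.resp (sym (x-y≈0⇒x≈y α-1≈0)) 𝕂.1∈))
    in c , u , record
      { generator = generator ; c∈𝕂 = c∈ ; u∈units = u∈ ; α-1≈cu = e
      ; c≉0 = λ c≈0 → α∉𝕂 (𝕂.resp (sym (x-y≈0⇒x≈y (trans e (trans (*-congʳ c≈0) (zeroˡ u))))) 𝕂.1∈)
      }
    where open Generator generator

  power∈𝕂 : ∀ {x} n → x ∈ 𝕂 → x ^ n ∈ 𝕂
  power∈𝕂 zero    x∈ = 𝕂.1∈
  power∈𝕂 (suc n) x∈ = 𝕂.*∈ x∈ (power∈𝕂 n x∈)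

  scaled : ∀ {α k} → α ^ p ∈ 𝕂 → (∀ y → y ∈ Adj 𝕂 α) → k ∈ 𝕂 → ¬ (k ≈ 0#) →
           α * k - 1# ∈ 𝔪 → Generator (α * k)
  scaled {α} {k} α^p∈𝕂 generates k∈ k≉0 αk≡1 = record
    { α^p∈𝕂     = 𝕂.resp (sym (^-distrib-* α k p)) (𝕂.*∈ α^p∈𝕂 (power∈𝕂 p k∈))
    ; α≡1       = αk≡1
    ; generates = λ y → adj-minimal 𝕂-subring adj (adj-S 𝕂-subring) α∈ (generates y)
    }
    where
    adj = adj-subring 𝕂-subring {α * k}
    module adj = IsSubring adj
    α∈ : α ∈ Adj 𝕂 (α * k)
    α∈ = adj.resp (begin
      α * k * k ⁻¹    ≈⟨ *-assoc α k (k ⁻¹) ⟩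
      α * (k * k ⁻¹)  ≈⟨ *-congˡ (inverseʳ k≉0) ⟩
      α * 1#          ≈⟨ *-identityʳ α ⟩
      α               ∎)
      (adj.*∈ (adj-gen 𝕂-subring) (adj-S 𝕂-subring (⁻¹∈𝕂 k∈ k≉0)))

  -- Dividing α = 1 + c y by 1 + c a.
  shift-identity : ∀ {α c y e} a → α - 1# ≈ c * y → (1# + c * a) * e ≈ 1# →
                   α * e - 1# ≈ c * (e * (y - a))
  shift-identity {α} {c} {y} {e} a α-1≈cy fe≈1 = begin
    α * e - 1#                          ≈⟨ +-congˡ (-‿cong fe≈1) ⟨
    α * e - (1# + c * a) * e            ≈⟨ solve 4 (λ α e c a → α :* e :- (con (+ 1) :+ c :* a) :* e
                                             := (α :- con (+ 1)) :* e :- c :* a :* e) refl α e c a ⟩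
    (α - 1#) * e - c * a * e            ≈⟨ +-congʳ (*-congʳ α-1≈cy) ⟩
    c * y * e - c * a * e               ≈⟨ solve 4 (λ c y e a → c :* y :* e :- c :* a :* e := c :* (e :* (y :- a)))
                                             refl c y e a ⟩
    c * (e * (y - a))                   ∎

  -- An approximation of `u` by `a` is turned into a change of generator, α / (1 + c a). The new
  -- generator is again ≡ 1, because u - a is integral and `c` is in 𝔪.
  shift : ∀ {α c u a d u′} → Approximant α c u → a ∈ R → u - a ≈ d * u′ →
          d ∈ 𝕂 → ¬ (d ≈ 0#) → u′ ∈ units → ∃₂ λ α′ c′ → Approximant α′ c′ u′
  shift {α} {c} {u} {a} {d} {u′} approx a∈ u-a≈du′ d∈ d≉0 u′∈ = α * e , c * d * e , record
    { generator = scaled α^p∈𝕂 generates e∈𝕂 e≉0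
        (𝔪-resp (trans (solve 4 (λ c d e u → d :* u :* e :* c := c :* d :* e :* u) refl c d e u′) (sym identity))
          (𝔪-* (*∈ (resp u-a≈du′ (+∈ (proj₁ u∈units) (-∈ (proj₂ a∈)))) (proj₁ e∈units)) c∈𝔪))
    ; c∈𝕂       = 𝕂.*∈ (𝕂.*∈ c∈𝕂 d∈) e∈𝕂
    ; c≉0       = ≉0-* (≉0-* c≉0 d≉0) e≉0
    ; u∈units   = u′∈
    ; α-1≈cu    = identity
    }
    where
    open Approximant approx
    f∈𝕂 = 𝕂.+∈ 𝕂.1∈ (𝕂.*∈ c∈𝕂 (proj₁ a∈))
    f∈units : 1# + c * a ∈ units
    f∈units = units-+-𝔪 1∈units (𝔪-resp (*-comm a c) (𝔪-* (proj₂ a∈) c∈𝔪))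
    e = (1# + c * a) ⁻¹
    e∈units = units⁻¹ f∈units
    e∈𝕂 = ⁻¹∈𝕂 f∈𝕂 (units≉0 f∈units)
    e≉0 = units≉0 e∈units
    identity : α * e - 1# ≈ c * d * e * u′
    identity = begin
      α * e - 1#           ≈⟨ shift-identity a α-1≈cu (inverseʳ (units≉0 f∈units)) ⟩
      c * (e * (u - a))    ≈⟨ *-congˡ (*-congˡ u-a≈du′) ⟩
      c * (e * (d * u′))   ≈⟨ solve 4 (λ c d e u → c :* (e :* (d :* u)) := c :* d :* e :* u) refl c d e u′ ⟩
      c * d * e * u′       ∎

  -- The factor 1 + c x - ζⁱ is c (x - g γᵢ), since ζⁱ - 1 = (ζ - 1) γᵢ = g c γᵢ. With c = ζ - 1 and
  -- g = 1 it serves Hensel's lemma; with g = (ζ - 1) / c in 𝔪 it gives the equation of u.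
  [1+cx]^p-1 : ∀ {c g} x → ζ - 1# ≈ g * c →
    (1# + c * x) ^ p - 1# ≈ c ^ p * (x * prod q (λ i → x - g * γ (suc i)))
  [1+cx]^p-1 {c} {g} x 𝔷≈gc = begin
    (1# + c * x) ^ p - 1#
      ≈⟨ x^p-1 (1# + c * x) ⟨
    (1# + c * x - 1#) * prod q (λ i → 1# + c * x - ζ ^ suc i)
      ≈⟨ *-cong (solve 2 (λ c x → con (+ 1) :+ c :* x :- con (+ 1) := c :* x) refl c x)
           (trans (prod-cong q factor) (prod-scale q c (λ i → x - g * γ (suc i)))) ⟩
    c * x * (c ^ q * prod q (λ i → x - g * γ (suc i)))
      ≈⟨ solve 4 (λ c x d y → c :* x :* (d :* y) := c :* d :* (x :* y)) refl c x (c ^ q) _ ⟩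
    c ^ p * (x * prod q (λ i → x - g * γ (suc i))) ∎
    where
    factor : ∀ i → i ℕ.< q → 1# + c * x - ζ ^ suc i ≈ c * (x - g * γ (suc i))
    factor i _ = begin
      1# + c * x - ζ ^ suc i              ≈⟨ solve 3 (λ c x z → con (+ 1) :+ c :* x :- z := c :* x :- (z :- con (+ 1)))
                                               refl c x (ζ ^ suc i) ⟩
      c * x - (ζ ^ suc i - 1#)            ≈⟨ +-congˡ (-‿cong ([ζ-1]γ (suc i))) ⟨
      c * x - (ζ - 1#) * γ (suc i)        ≈⟨ +-congˡ (-‿cong (*-congʳ 𝔷≈gc)) ⟩
      c * x - g * c * γ (suc i)           ≈⟨ solve 4 (λ c x g y → c :* x :- g :* c :* y := c :* (x :- g :* y))
                                               refl c x g (γ (suc i)) ⟩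
      c * (x - g * γ (suc i))             ∎

  private
    module FunctionMonic = MonicPolynomials functionRing

    prod-apply : ∀ n (φ : ℕ → Carrier → Carrier) x → FunctionMonic.prod n φ x ≈ prod n (λ i → φ i x)
    prod-apply zero    φ x = refl
    prod-apply (suc n) φ x = *-congˡ (prod-apply n (φ ∘ suc) x)

  -- Modulo 𝔪 the polynomial is X ∏ (X - ρᵢ), which has 0 as a simple root because the ρᵢ are units.
  hensel-prod : ∀ {c} {ρ : ℕ → Carrier} → c ∈ R → c ∈ 𝔪 → (∀ i → i ℕ.< q → ρ i ∈ R × ρ i ∈ units) →
                ∃ λ b → b ∈ R × c + b * prod q (λ i → b - ρ i) ≈ 0#
  hensel-prod {c} {ρ} c∈ c∈𝔪 ρ∈ =
    let (g , g∈ , e) = mon⇒evᵐ R-subring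
          (FunctionMonic.mon-linear-prod (const-subring R-subring) q {λ i _ → ρ i}
            (λ i i<q → ρ i , proj₁ (ρ∈ i i<q) , λ _ → refl))
        e′ : ∀ x → prod q (λ i → x - ρ i) ≈ evᵐ q g x
        e′ x = trans (sym (prod-apply q (λ i x → x - ρ i) x)) (e x)
        (b , b∈ , _ , root) = hensel q c∈ c∈𝔪 g∈ (units-resp (e′ 0#)
          (units-prod q (λ i i<q → units-resp (sym (+-identityˡ _)) (units-neg (proj₂ (ρ∈ i i<q))))))
    in b , b∈ , trans (+-congˡ (*-congˡ (e′ b))) root

  -- If y = (α - 1) / (ζ - 1) were integral, then Hensel's lemma would give a
  -- p-th root of αᵖ in 𝕂.  As y may be moved by elements of R, it is enough
  -- to consider y ∈ 𝔪, where the root is sought near 0.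
  not-close-𝔪 : ∀ {α y} → Generator α → α - 1# ≈ (ζ - 1#) * y → y ∉ 𝔪
  not-close-𝔪 {α} {y} generator α-1≈𝔷y y∈𝔪 =
    let (b , b∈ , root) = hensel-prod {c = - t} {ρ = λ i → 1# * γ (suc i)} (R.-∈ (t∈𝕂 , proj₁ t∈𝔪)) (𝔪-neg t∈𝔪)
          (λ i i<q → R.*∈ R.1∈ (γ∈R (suc i)) , units-* 1∈units (γ∈units i i<q))
        β = 1# + (ζ - 1#) * b
        β∈units = units-+-𝔪 1∈units (𝔪-resp (*-comm b (ζ - 1#)) (𝔪-* (proj₂ b∈) ζ≡1))
        β^p≈ : α ^ p ≈ β ^ p
        β^p≈ = begin
          α ^ p                                  ≈⟨ solve 1 (λ a → a := (a :- con (+ 1)) :+ con (+ 1)) refl _ ⟩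
          α ^ p - 1# + 1#                        ≈⟨ +-congʳ α^p-1≈ ⟩
          (ζ - 1#) ^ p * t + 1#                  ≈⟨ +-congʳ (*-congˡ (x-y≈0⇒x≈y (trans (+-comm _ _) root))) ⟨
          (ζ - 1#) ^ p * (b * prod q (λ i → b - 1# * γ (suc i))) + 1#
                                                 ≈⟨ +-congʳ ([1+cx]^p-1 b 𝔷≈1𝔷) ⟨
          β ^ p - 1# + 1#                        ≈⟨ solve 1 (λ a → (a :- con (+ 1)) :+ con (+ 1) := a) refl _ ⟩
          β ^ p                                  ∎
        (j , _ , α≈) = ^p-injective (units≉0 β∈units) β^p≈
    in α∉𝕂 (𝕂.resp (sym α≈) (𝕂.*∈ (proj₁ (ζ^∈R j))
         (𝕂.+∈ 𝕂.1∈ (𝕂.*∈ 𝔷∈𝕂 (proj₁ b∈)))))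
    where
    open Generator generator
    𝔷≈1𝔷 = sym (*-identityˡ (ζ - 1#))
    𝔷∈𝕂 = 𝕂.+∈ ζ∈𝕂 (𝕂.-∈ 𝕂.1∈)
    -- t = (αᵖ - 1) / (ζ - 1)ᵖ lies in 𝕂, unlike y, which is a root of X ∏ (X - γᵢ) - t in `L`. The
    -- root b in R yields β = 1 + (ζ - 1) b with βᵖ = αᵖ, so that α is a power of ζ times β.
    t = y * prod q (λ i → y - 1# * γ (suc i))
    α^p-1≈ : α ^ p - 1# ≈ (ζ - 1#) ^ p * t
    α^p-1≈ = trans (+-congʳ (^-congˡ p (trans (solve 1 (λ a → a := con (+ 1) :+ (a :- con (+ 1))) refl α)
      (+-congˡ α-1≈𝔷y)))) ([1+cx]^p-1 y 𝔷≈1𝔷)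
    t∈𝔪 : t ∈ 𝔪
    t∈𝔪 = 𝔪-resp (*-comm _ y) (𝔪-* (prod∈ q (λ i → +∈ (proj₁ y∈𝔪) (-∈ (*∈ 1∈ (proj₂ (γ∈R (suc i))))))) y∈𝔪)
    t∈𝕂 : t ∈ 𝕂
    t∈𝕂 = 𝕂.resp (begin
      ((ζ - 1#) ^ p) ⁻¹ * (α ^ p - 1#)          ≈⟨ *-congˡ α^p-1≈ ⟩
      ((ζ - 1#) ^ p) ⁻¹ * ((ζ - 1#) ^ p * t)    ≈⟨ solve 3 (λ v c u → v :* (c :* u) := c :* v :* u) refl _ _ t ⟩
      (ζ - 1#) ^ p * ((ζ - 1#) ^ p) ⁻¹ * t      ≈⟨ *-congʳ (inverseʳ (power≉0 p ζ-1≉0)) ⟩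
      1# * t                                    ≈⟨ *-identityˡ t ⟩
      t                                         ∎)
      (𝕂.*∈ (⁻¹∈𝕂 (power∈𝕂 p 𝔷∈𝕂) (power≉0 p ζ-1≉0)) (𝕂.+∈ α^p∈𝕂 (𝕂.-∈ 𝕂.1∈)))

  not-close : ∀ {α y} → Generator α → α - 1# ≈ (ζ - 1#) * y → y ∉ 𝒪
  not-close {α} {y} generator α-1≈𝔷y y∈ =
    let (a , a∈ , y≡a) = sameResidues y∈
        f∈units : 1# + (ζ - 1#) * a ∈ units
        f∈units = units-+-𝔪 1∈units (𝔪-resp (*-comm a (ζ - 1#)) (𝔪-* (proj₂ a∈) ζ≡1))
        e = (1# + (ζ - 1#) * a) ⁻¹
        e∈units = units⁻¹ f∈units
        e∈𝕂 = ⁻¹∈𝕂 (𝕂.+∈ 𝕂.1∈ (𝕂.*∈ (𝕂.+∈ ζ∈𝕂 (𝕂.-∈ 𝕂.1∈)) (proj₁ a∈))) (units≉0 f∈units)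
        identity : α * e - 1# ≈ (ζ - 1#) * (e * (y - a))
        identity = shift-identity a α-1≈𝔷y (inverseʳ (units≉0 f∈units))
        y′∈𝔪 = 𝔪-* (proj₁ e∈units) y≡a
    in not-close-𝔪 (scaled (Generator.α^p∈𝕂 generator) (Generator.generates generator) e∈𝕂 (units≉0 e∈units)
         (𝔪-resp (sym identity) (𝔪-* (proj₁ ζ≡1) y′∈𝔪))) identity y′∈𝔪

  module _ {α c u} (approx : Approximant α c u) where
    open Approximant approx

    -- Equality of residue fields gives `a`, then equality of value groups gives `d`. As `u` is not
    -- in 𝕂, the difference u - a is never 0, and a better approximation always exists.
    refine : ∃₂ λ a d → ∃ λ u′ → a ∈ R × a ∈ units × d ∈ R × d ∈ 𝔪 × ¬ (d ≈ 0#) ×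
             u′ ∈ units × u - a ≈ d * u′
    refine =
      let (a , a∈ , u≡a) = sameResidues (proj₁ u∈units)
          (d , u′ , d∈ , u′∈ , e) = sameValues
            {u - a} (λ u-a≈0 → u∉𝕂 (𝕂.resp (sym (x-y≈0⇒x≈y u-a≈0)) (proj₁ a∈)))
          d∈𝔪 : d ∈ 𝔪
          d∈𝔪 = 𝔪-resp (begin
            u′ ⁻¹ * (u - a)     ≈⟨ *-congˡ e ⟩
            u′ ⁻¹ * (d * u′)    ≈⟨ solve 3 (λ v c u → v :* (c :* u) := c :* (u :* v)) refl (u′ ⁻¹) d u′ ⟩
            d * (u′ * u′ ⁻¹)    ≈⟨ *-congˡ (inverseʳ (units≉0 u′∈)) ⟩
            d * 1#              ≈⟨ *-identityʳ d ⟩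
            d                   ∎) (𝔪-* (proj₁ (units⁻¹ u′∈)) u≡a)
      in a , d , u′ , a∈ , ≡𝔪⇒units u∈units (𝔪-resp (swap- u a) (𝔪-neg u≡a)) , (d∈ , proj₁ d∈𝔪) , d∈𝔪 ,
         (λ d≈0 → u∉𝕂 (𝕂.resp (sym (x-y≈0⇒x≈y (trans e (trans (*-congʳ d≈0) (zeroˡ u′))))) (proj₁ a∈))) ,
         u′∈ , e

    -- For α′ = u this is the γ of the theorem. It lies in 𝔪, for otherwise ζ - 1 would divide α -
    -- 1.
    conductor : Carrier
    conductor = (ζ - 1#) * c ⁻¹

    ζ-1≈ : ζ - 1# ≈ conductor * c
    ζ-1≈ = sym (begin
      (ζ - 1#) * c ⁻¹ * c      ≈⟨ solve 3 (λ z v c → z :* v :* c := z :* (c :* v)) refl (ζ - 1#) (c ⁻¹) c ⟩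
      (ζ - 1#) * (c * c ⁻¹)    ≈⟨ *-congˡ (inverseʳ c≉0) ⟩
      (ζ - 1#) * 1#            ≈⟨ *-identityʳ _ ⟩
      ζ - 1#                   ∎)

    conductor∈𝔪 : conductor ∈ 𝔪
    conductor∈𝔪 = ∉𝒪⇒inverse∈𝔪 {c * (ζ - 1#) ⁻¹} (begin
        c * (ζ - 1#) ⁻¹ * conductor                 ≈⟨ solve 3 (λ c v g → c :* v :* g := g :* c :* v) refl c _ conductor ⟩
        conductor * c * (ζ - 1#) ⁻¹                 ≈⟨ *-congʳ ζ-1≈ ⟨
        (ζ - 1#) * (ζ - 1#) ⁻¹                      ≈⟨ inverseʳ ζ-1≉0 ⟩
        1#                                          ∎)
      λ w∈ → not-close generator (begin
        α - 1#                                      ≈⟨ α-1≈cu ⟩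
        c * u                                       ≈⟨ *-identityˡ _ ⟨
        1# * (c * u)                                ≈⟨ *-congʳ (inverseʳ ζ-1≉0) ⟨
        (ζ - 1#) * (ζ - 1#) ⁻¹ * (c * u)            ≈⟨ solve 4 (λ z v c u → z :* v :* (c :* u) := z :* (c :* v :* u))
                                                         refl (ζ - 1#) _ c u ⟩
        (ζ - 1#) * (c * (ζ - 1#) ⁻¹ * u)            ∎) (*∈ w∈ (proj₁ u∈units))

    conductor∈R : conductor ∈ R
    conductor∈R = 𝕂.*∈ (𝕂.+∈ ζ∈𝕂 (𝕂.-∈ 𝕂.1∈)) (⁻¹∈𝕂 c∈𝕂 c≉0) , proj₁ conductor∈𝔪

    private
      ρ : ℕ → Carrier
      ρ i = conductor * γ (suc i)

      ρ∈R : ∀ i → ρ i ∈ R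
      ρ∈R i = R.*∈ conductor∈R (γ∈R (suc i))

      P = prod q (λ i → u - ρ i)

      -- t = (αᵖ - 1) / cᵖ lies in 𝕂, and it is a unit because all `ρ i` lie in 𝔪. So X ∏ (X - ρᵢ) -
      -- t is a monic equation of u with a unit as constant term, and P / t is an inverse of u in
      -- A[u].
      t = u * P

      t∈units : t ∈ units
      t∈units = units-* u∈units (units-prod q (λ i _ → units-+-𝔪 u∈units
        (𝔪-neg (𝔪-resp (*-comm _ _) (𝔪-* (proj₂ (γ∈R (suc i))) conductor∈𝔪)))))

      t∈𝕂 : t ∈ 𝕂
      t∈𝕂 = 𝕂.resp (begin
        (c ^ p) ⁻¹ * (α ^ p - 1#)               ≈⟨ *-congˡ (+-congʳ (^-congˡ p α≈1+cu)) ⟩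
        (c ^ p) ⁻¹ * ((1# + c * u) ^ p - 1#)    ≈⟨ *-congˡ ([1+cx]^p-1 u ζ-1≈) ⟩
        (c ^ p) ⁻¹ * (c ^ p * t)                ≈⟨ solve 3 (λ v c u → v :* (c :* u) := c :* v :* u) refl _ _ t ⟩
        c ^ p * (c ^ p) ⁻¹ * t                  ≈⟨ *-congʳ (inverseʳ (power≉0 p c≉0)) ⟩
        1# * t                                  ≈⟨ *-identityˡ t ⟩
        t                                       ∎)
        (𝕂.*∈ (⁻¹∈𝕂 (power∈𝕂 p c∈𝕂) (power≉0 p c≉0)) (𝕂.+∈ α^p∈𝕂 (𝕂.-∈ 𝕂.1∈)))

      P∈Mon : P ∈ Mon R u q
      P∈Mon = mon-linear-prod R-subring q (λ i _ → ρ∈R i)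

    0∈Mon : 0# ∈ Mon R u p
    0∈Mon = mon-resp (solve 2 (λ u P → (u :- con (+ 0)) :* P :+ :- (u :* P) := con (+ 0)) refl u P)
      (mon-+-pol R-subring (mon-* R-subring (linear R-subring R.0∈) P∈Mon)
        (pol-raise R.0∈ (s≤s z≤n) (proj₂ (adj-S R-subring (R.-∈ (t∈𝕂 , proj₁ t∈units))))))

    inverse∈Adj : ∃ λ v → v ∈ Adj R u × u * v ≈ 1#
    inverse∈Adj = t ⁻¹ * P ,
      IsSubring.*∈ (adj-subring R-subring)
        (adj-S R-subring (⁻¹∈𝕂 t∈𝕂 (units≉0 t∈units) , proj₁ (units⁻¹ t∈units)))
        (suc q , mon⇒pol R.1∈ P∈Mon) ,
      trans (solve 3 (λ u v P → u :* (v :* P) := u :* P :* v) refl u (t ⁻¹) P) (inverseʳ (units≉0 t∈units))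

    adj⊆integral : Adj R u ⊆ Integral R
    adj⊆integral = adj⇒integral R-subring domain 1≉0 (units≉0 u∈units) (p , 0∈Mon)

-- Polynomials dominated by a single coefficient

module Domination {ℓ} (setting : Setting ℓ) where
  open Setting setting
  open Field L
  open ValuationRing O
  open Approximation setting public
  open IntegerSolver commutativeRing
  open Polynomials commutativeRing
  open Coefficients commutativeRing
  open MonicPolynomials commutativeRing
  open PolynomialFunctions commutativeRing
  open SetoidReasoning setoid

  private
    𝔪R : Pred Carrier ℓ
    𝔪R x = x ∈ R × x ∈ 𝔪

    𝔪R-+ : ∀ {x y} → x ∈ 𝔪R → y ∈ 𝔪R → x + y ∈ 𝔪R
    𝔪R-+ (x∈ , x∈𝔪) (y∈ , y∈𝔪) = R.+∈ x∈ y∈ , 𝔪-+ x∈𝔪 y∈𝔪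

    𝔪R-*ˡ : ∀ {x y} → x ∈ 𝔪R → y ∈ R → x * y ∈ 𝔪R
    𝔪R-*ˡ (x∈ , x∈𝔪) y∈ = R.*∈ x∈ y∈ , 𝔪-resp (*-comm _ _) (𝔪-* (proj₂ y∈) x∈𝔪)

    𝔪R-*ʳ : ∀ {x y} → x ∈ R → y ∈ 𝔪R → x * y ∈ 𝔪R
    𝔪R-*ʳ x∈ (y∈ , y∈𝔪) = R.*∈ x∈ y∈ , 𝔪-* (proj₂ x∈) y∈𝔪

    const-+ : ∀ {φ ψ} → φ ∈ Const 𝔪R → ψ ∈ Const 𝔪R → (λ x → φ x + ψ x) ∈ Const 𝔪R
    const-+ (s , s∈ , e) (t , t∈ , f) = s + t , 𝔪R-+ s∈ t∈ , λ x → +-cong (e x) (f x)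

    RF-subring = const-subring R-subring

    minusOne∈ : ∀ k → (λ x → (x - 1#) ^ k) ∈ Fun.Mon (Const R) id k
    minusOne∈ zero    = Fun.nil λ _ → refl
    minusOne∈ (suc k) = Fun.mon-* RF-subring
      (Fun.linear RF-subring {s = λ _ → 1#} (1# , R.1∈ , λ _ → refl)) (minusOne∈ k)

    -- W reversed k μ = c Wᵏ E (c / W) for W = X - 1 and E = ∑ μᵢ Xⁱ.
    reversed : Carrier → ℕ → (ℕ → Carrier) → Carrier → Carrier
    reversed c zero    μ x = 0#
    reversed c (suc k) μ x = c * (μ 0 * (x - 1#) ^ k + reversed c k (μ ∘ suc) x)

    reversed-ev : ∀ c k μ {x y} → (x - 1#) * y ≈ c →
      (x - 1#) * reversed c k μ x ≈ c * ((x - 1#) ^ k * ev k μ y)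
    reversed-ev c zero    μ {x} e =
      solve 2 (λ w c → w :* con (+ 0) := c :* (con (+ 1) :* con (+ 0))) refl (x - 1#) c
    reversed-ev c (suc k) μ {x} {y} e = begin
      w * (c * (μ 0 * w ^ k + ρ))         ≈⟨ solve 5 (λ w c m v r → w :* (c :* (m :* v :+ r))
                                               := c :* (m :* (w :* v) :+ w :* r)) refl w c (μ 0) (w ^ k) ρ ⟩
      c * (μ 0 * (w * w ^ k) + w * ρ)     ≈⟨ *-congˡ (+-congˡ (reversed-ev c k (μ ∘ suc) e)) ⟩
      c * (μ 0 * (w * w ^ k) + c * (w ^ k * E))  ≈⟨ *-congˡ (+-congˡ (*-congʳ e)) ⟨
      c * (μ 0 * (w * w ^ k) + w * y * (w ^ k * E))  ≈⟨ solve 6 (λ w c m v y e →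
                                               c :* (m :* (w :* v) :+ w :* y :* (v :* e))
                                               := c :* (w :* v :* (m :+ y :* e))) refl w c (μ 0) (w ^ k) y E ⟩
      c * (w ^ suc k * (μ 0 + y * E))     ∎
      where
      w = x - 1#
      ρ = reversed c k (μ ∘ suc) x
      E = ev k (μ ∘ suc) y

    reversed∈ : ∀ {c} → c ∈ R → ∀ k μ → (∀ i → i ℕ.< k → μ i ∈ 𝔪R) →
                reversed c k μ ∈ Fun.Pol (Const 𝔪R) id k
    reversed∈ c∈ zero    μ μ∈ = Fun.nil λ _ → refl
    reversed∈ {c} c∈ (suc k) μ μ∈ = Fun.pol-scale {k = λ _ → c} (const* c c∈) (Fun.pol-+ const-+
        (Fun.pol-scale {k = λ _ → μ 0} const*′ (Fun.mon⇒pol (1# , R.1∈ , λ _ → refl) (minusOne∈ k)))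
        (Fun.pol-raise (0# , (R.0∈ , 𝔪-0) , λ _ → refl) (ℕ.n≤1+n k)
          (reversed∈ c∈ k (μ ∘ suc) (λ i i<k → μ∈ (suc i) (s≤s i<k)))))
      where
      const* : ∀ c → c ∈ R → ∀ {φ : Carrier → Carrier} → φ ∈ Const 𝔪R → (λ x → c * φ x) ∈ Const 𝔪R
      const* c c∈ (s , s∈ , e) = c * s , 𝔪R-*ʳ c∈ s∈ , λ x → *-congˡ (e x)
      const*′ : ∀ {φ : Carrier → Carrier} → φ ∈ Const R → (λ x → μ 0 * φ x) ∈ Const 𝔪R
      const*′ (s , s∈ , e) = μ 0 * s , 𝔪R-*ˡ (μ∈ 0 (s≤s z≤n)) s∈ , λ x → *-congˡ (e x)

    value-0 : ∀ {n φ} → φ ∈ Fun.Pol (Const 𝔪R) id n → φ 0# ∈ 𝔪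
    value-0 (Fun.nil e) = 𝔪-resp (sym (e 0#)) 𝔪-0
    value-0 (Fun.cons (s , (_ , s∈) , e) w∈ e′) =
      𝔪-resp (sym (trans (e′ 0#) (trans (+-cong (e 0#) (zeroˡ _)) (+-identityʳ s)))) s∈

    split-constant : ∀ {k φ} → φ ∈ Fun.Pol (Const 𝔪R) id k →
      ∃₂ λ s ψ → s ∈ 𝔪R × ψ ∈ Fun.Pol (Const 𝔪R) id k × ∀ x → φ x ≈ s + x * ψ x
    split-constant (Fun.nil e) = 0# , (λ _ → 0#) , (R.0∈ , 𝔪-0) , Fun.nil (λ _ → refl) ,
      λ x → trans (e x) (solve 1 (λ x → con (+ 0) := con (+ 0) :+ x :* con (+ 0)) refl x)
    split-constant (Fun.cons {w = ψ} (s , s∈ , e) w∈ e′) = s , ψ , s∈ ,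
      Fun.pol-raise (0# , (R.0∈ , 𝔪-0) , λ _ → refl) (ℕ.n≤1+n _) w∈ ,
      λ x → trans (e′ x) (+-congʳ (e x))

  -- A polynomial that is linear modulo 𝔪 has a root.  It is not monic, so
  -- Hensel's lemma is applied to the reversed polynomial in W = c / X, at
  -- its simple root W = -1 modulo 𝔪.
  hensel-linear : ∀ {c} → c ∈ R → ∀ k μ → (∀ i → i ℕ.< k → μ i ∈ R × μ i ∈ 𝔪) →
                  ∃ λ y → y ∈ R × c + y * (1# + y * ev k μ y) ≈ 0#
  hensel-linear {c} c∈ k μ μ∈ =
    -- With w = x - 1 and y = c / w, the polynomial c + y (1 + y E) equals y (x + y E). Times wᵏ,
    -- the second factor is x wᵏ + `reversed c k μ x`: monic in x of degree k + 1 and ≡ x (x - 1)ᵏ,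
    -- so that 0 is a simple root modulo 𝔪.
    let (s , ψ , s∈ , ψ∈ , φ≈) = split-constant (reversed∈ c∈ k μ μ∈)
        (g , g∈ , ψ≈) = mon⇒evᵐ R-subring (Fun.mon-+-pol RF-subring (minusOne∈ k)
          (Fun.pol-map (λ { (s , (s∈ , _) , e) → s , s∈ , e }) ψ∈))
        (x , x∈ , x∈𝔪 , root) = hensel k (proj₁ s∈) (proj₂ s∈) g∈
          (units-resp (ψ≈ 0#) (units-+-𝔪 (units-^ k 0-1∈units) (value-0 ψ∈)))
        w = x - 1#
        w∈units : w ∈ units
        w∈units = units-resp (+-comm _ _) (units-+-𝔪 (units-neg 1∈units) x∈𝔪)
        w≉0 = units≉0 w∈units
        w⁻¹∈R = ⁻¹∈𝕂 (𝕂.+∈ (proj₁ x∈) (𝕂.-∈ 𝕂.1∈)) w≉0 , proj₁ (units⁻¹ w∈units)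
        y = c * w ⁻¹
        wy≈c : w * y ≈ c
        wy≈c = trans (solve 3 (λ w c v → w :* (c :* v) := c :* (w :* v)) refl w c (w ⁻¹))
          (trans (*-congˡ (inverseʳ w≉0)) (*-identityʳ c))
        E = ev k μ y
        vanish : w ^ suc k * (x + y * E) ≈ w ^ suc k * 0#
        vanish = begin
          w ^ suc k * (x + y * E)                    ≈⟨ solve 5 (λ w v x y e → w :* v :* (x :+ y :* e)
                                                          := w :* (v :* x) :+ w :* y :* (v :* e)) refl w (w ^ k) x y E ⟩
          w * (w ^ k * x) + w * y * (w ^ k * E)      ≈⟨ +-congˡ (*-congʳ wy≈c) ⟩
          w * (w ^ k * x) + c * (w ^ k * E)          ≈⟨ +-congˡ (reversed-ev c k μ wy≈c) ⟨
          w * (w ^ k * x) + w * reversed c k μ x     ≈⟨ +-congˡ (*-congˡ (φ≈ x)) ⟩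
          w * (w ^ k * x) + w * (s + x * ψ x)        ≈⟨ solve 5 (λ w v x s z → w :* (v :* x) :+ w :* (s :+ x :* z)
                                                          := w :* (s :+ x :* (v :+ z))) refl w (w ^ k) x s (ψ x) ⟩
          w * (s + x * (w ^ k + ψ x))                ≈⟨ *-congˡ (+-congˡ (*-congˡ (ψ≈ x))) ⟩
          w * (s + x * evᵐ k g x)                    ≈⟨ *-congˡ root ⟩
          w * 0#                                     ≈⟨ solve 2 (λ w v → w :* con (+ 0) := w :* v :* con (+ 0))
                                                          refl w (w ^ k) ⟩
          w ^ suc k * 0#                             ∎
    in y , R.*∈ c∈ w⁻¹∈R , (begin
      c + y * (1# + y * E)             ≈⟨ +-congʳ wy≈c ⟨
      w * y + y * (1# + y * E)         ≈⟨ solve 3 (λ x y e → (x :- con (+ 1)) :* y :+ y :* (con (+ 1) :+ y :* e)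
                                            := y :* (x :+ y :* e)) refl x y E ⟩
      y * (x + y * E)                  ≈⟨ *-congˡ (cancelˡ (power≉0 (suc k) w≉0) vanish) ⟩
      y * 0#                           ≈⟨ zeroʳ y ⟩
      0#                               ∎)
    where
    0-1∈units : 0# - 1# ∈ units
    0-1∈units = units-resp (sym (+-identityˡ _)) (units-neg 1∈units)

  -- An iterated affine substitution turning polynomials in x into
  -- polynomials in u.
  record Substitution (x u : Carrier) : Set ℓ where
    field
      T     : ℕ → (ℕ → Carrier) → ℕ → Carrier
      T∈𝕂   : ∀ n {g} → (∀ i → g i ∈ 𝕂) → ∀ i → T n g i ∈ 𝕂
      ev-T  : ∀ n g → ev n (T n g) u ≈ ev n g x
      T-0   : ∀ n g → (∀ i → i ℕ.< n → g i ≈ 0#) → ∀ i → T n g i ≈ 0#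
      δ     : Carrier
      δ≉0   : ¬ (δ ≈ 0#)
      -- The chain rule for the whole substitution. Through it, domination of the derivative passes
      -- to the nonconstant coefficients of `T (suc n) g`.
      D-T   : ∀ n g i → D (T (suc n) g) i ≈ δ * T n (D g) i

  -- Substituting 0 + 1 X, rather than returning g, cuts g off after n coefficients, as `T-0`
  -- demands.
  identity : ∀ x → Substitution x x
  identity x = record
    { T    = λ n g i → sub 0# 1# n g i
    ; T∈𝕂  = λ n g∈ → sub∈ 𝕂-subring 𝕂.0∈ 𝕂.1∈ n (λ i _ → g∈ i)
    ; ev-T = λ n g → trans (ev-sub 0# 1# n g x) (ev-congʳ n g (trans (+-identityˡ _) (*-identityˡ x)))
    ; T-0  = λ n g g≈0 → sub-0 0# 1# n g≈0
    ; δ    = 1#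
    ; δ≉0  = 1≉0
    ; D-T  = chain-rule 0# 1#
    }

  extend : ∀ {x u a d u′} → Substitution x u → a ∈ 𝕂 → d ∈ 𝕂 → ¬ (d ≈ 0#) → u ≈ a + d * u′ →
           Substitution x u′
  extend {x} {u} {a} {d} {u′} σ a∈ d∈ d≉0 u≈ = record
    { T    = λ n g → sub a d n (T n g)
    ; T∈𝕂  = λ n g∈ → sub∈ 𝕂-subring a∈ d∈ n (λ i _ → T∈𝕂 n g∈ i)
    ; ev-T = λ n g → trans (ev-sub a d n (T n g) u′)
               (trans (ev-congʳ n (T n g) (sym u≈)) (ev-T n g))
    ; T-0  = λ n g g≈0 → sub-0 a d n (λ i _ → T-0 n g g≈0 i)
    ; δ    = d * δ
    ; δ≉0  = ≉0-* d≉0 δ≉0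
    ; D-T  = λ n g i → begin
        D (sub a d (suc n) (T (suc n) g)) i      ≈⟨ chain-rule a d n (T (suc n) g) i ⟩
        d * sub a d n (D (T (suc n) g)) i        ≈⟨ *-congˡ (sub-cong a d n (λ j _ → D-T n g j) i) ⟩
        d * sub a d n (λ j → δ * T n (D g) j) i  ≈⟨ *-congˡ (sub-scale a d n δ (T n (D g)) i) ⟩
        d * (δ * sub a d n (T n (D g)) i)        ≈⟨ *-assoc d δ _ ⟨
        d * δ * sub a d n (T n (D g)) i          ∎
    }
    where open Substitution σ

  -- The polynomial g, of degree < n, is its constant term times 1 modulo 𝔪.
  Dominated : ℕ → (ℕ → Carrier) → Set ℓ
  Dominated n g = ¬ (g 0 ≈ 0#) × (∀ i → suc i ℕ.< n → ∃ λ m → m ∈ 𝔪 × g (suc i) ≈ g 0 * m)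

  dominated-ev : ∀ n g {u} → u ∈ 𝒪 → Dominated (suc n) g →
                 ∃ λ v → v ∈ units × ev (suc n) g u ≈ g 0 * v
  dominated-ev n g {u} u∈ (_ , dominated) =
    let (m , m∈ , e) = ev∈ {I = λ z → ∃ λ m → m ∈ 𝔪 × z ≈ g 0 * m}
          (λ { z≈z′ (m , m∈ , e) → m , m∈ , trans (sym z≈z′) e })
          (0# , 𝔪-0 , sym (zeroʳ (g 0)))
          (λ { (m , m∈ , e) (m′ , m′∈ , e′) → m + m′ , 𝔪-+ m∈ m′∈ ,
               trans (+-cong e e′) (sym (distribˡ (g 0) m m′)) })
          n {x = u}
          (λ { (m , m∈ , e) → u * m , 𝔪-* u∈ m∈ , trans (*-congˡ e)
               (solve 3 (λ u g m → u :* (g :* m) := g :* (u :* m)) refl u (g 0) m) })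
          (λ i i<n → dominated i (s≤s i<n))
    in 1# + u * m , units-+-𝔪 1∈units (𝔪-* u∈ m∈) , trans (+-congˡ (*-congˡ e))
         (solve 3 (λ g u m → g :+ u :* (g :* m) := g :* (con (+ 1) :+ u :* m)) refl (g 0) u m)

  LinearlyDominated : ℕ → (ℕ → Carrier) → Set ℓ
  LinearlyDominated n g =
    ¬ (g 1 ≈ 0#) × (∀ i → suc (suc i) ℕ.< n → ∃ λ m → m ∈ 𝔪 × g (suc (suc i)) ≈ g 1 * m)

  module _ {α c u} (approx : Approximant α c u) (n : ℕ) (g : ℕ → Carrier) (g∈𝕂 : ∀ i → g i ∈ 𝕂)
           (linear : LinearlyDominated (suc (suc n)) g) where
    open Approximant approx

    private
      κ = g 1
      κ≉0 = proj₁ linear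
      κ⁻¹∈𝕂 = ⁻¹∈𝕂 (g∈𝕂 1) κ≉0

      -- Normalised by its linear coefficient, g is ν 0 + X + `ω`, with the coefficients of `ω` in
      -- 𝔪. The two cases below depend on whether `ν 0` is integral.
      ν : ℕ → Carrier
      ν i = κ ⁻¹ * g i

      g≈κν : ∀ i → g i ≈ κ * ν i
      g≈κν i = sym (trans (sym (*-assoc κ (κ ⁻¹) (g i)))
        (trans (*-congʳ (inverseʳ κ≉0)) (*-identityˡ (g i))))

      ν1≈1 : ν 1 ≈ 1#
      ν1≈1 = trans (*-comm _ _) (inverseʳ κ≉0)

      ν∈𝔪R : ∀ i → i ℕ.< n → ν (suc (suc i)) ∈ 𝔪R
      ν∈𝔪R i i<n =
        let (m , m∈ , e) = proj₂ linear i (s≤s (s≤s i<n))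
            ν≈m : m ≈ ν (suc (suc i))
            ν≈m = cancelˡ κ≉0 (trans (sym e) (g≈κν _))
            ν∈𝔪 = 𝔪-resp ν≈m m∈
        in (𝕂.*∈ κ⁻¹∈𝕂 (g∈𝕂 _) , proj₁ ν∈𝔪) , ν∈𝔪

    -- The inverse of `ν 0` lies in 𝔪, so `g 1`, and with it every higher coefficient, is already
    -- small against `g 0`.
    dominated-constant : ν 0 ∉ 𝒪 → Dominated (suc (suc n)) g
    dominated-constant ν0∉ = g0≉0 , λ where
        zero    _               → w , w∈ , g1≈
        (suc i) (s≤s (s≤s i<n)) → w * ν (suc (suc i)) ,
          𝔪-* (proj₁ w∈) (proj₂ (ν∈𝔪R i i<n)) ,
          trans (g≈κν (suc (suc i))) (trans (*-congʳ g1≈) (*-assoc _ _ _))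
      where
      ν0≉0 : ¬ (ν 0 ≈ 0#)
      ν0≉0 e = ν0∉ (resp (sym e) 0∈)
      g0≉0 : ¬ (g 0 ≈ 0#)
      g0≉0 e = ν0≉0 (trans (*-congˡ e) (zeroʳ _))
      w = ν 0 ⁻¹
      w∈ : w ∈ 𝔪
      w∈ = ∉𝒪⇒inverse∈𝔪 (inverseʳ ν0≉0) ν0∉
      g1≈ : g 1 ≈ g 0 * w
      g1≈ = sym (trans (*-congʳ (g≈κν 0)) (trans (*-assoc κ (ν 0) w)
        (trans (*-congˡ (inverseʳ ν0≉0)) (*-identityʳ κ))))

    private
      ω : ℕ → Carrier
      ω zero          = 0#
      ω (suc zero)    = 0#
      ω (suc (suc i)) = ν (suc (suc i))

      ω∈𝔪 : ∀ i → i ℕ.< suc (suc n) → ω i ∈ 𝔪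
      ω∈𝔪 zero          _               = 𝔪-0
      ω∈𝔪 (suc zero)    _               = 𝔪-0
      ω∈𝔪 (suc (suc i)) (s≤s (s≤s i<n)) = proj₂ (ν∈𝔪R i i<n)

      evν : ∀ x → ev (suc (suc n)) ν x ≈ ν 0 + x + ev (suc (suc n)) ω x
      evν x = trans (+-congˡ (*-congˡ (+-congʳ ν1≈1)))
        (solve 3 (λ v x e → v :+ x :* (con (+ 1) :+ x :* e)
           := v :+ x :+ (con (+ 0) :+ x :* (con (+ 0) :+ x :* e))) refl (ν 0) x _)

    private
      module _ (ν0∈R : ν 0 ∈ R) {b d₁ a₂ d₂ : Carrier} (b∈ : b ∈ R) (root : ev (suc (suc n)) ν b ≈ 0#)
               (d₁∈ : d₁ ∈ R) (d₁≉0 : ¬ (d₁ ≈ 0#)) (a₂∈ : a₂ ∈ R) (a₂∈units : a₂ ∈ units)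
               (d₂∈ : d₂ ∈ R) (d₂∈𝔪 : d₂ ∈ 𝔪) where

        -- From u - b = d₁ u₁ and u₁ - a₂ = d₂ u₂ one gets u = a + d u₂: here b is the root of g, d₁
        -- the distance of u from it, and a₂ a unit of R approximating u₁.
        a d : Carrier
        a = b + d₁ * a₂
        d = d₁ * d₂

        a∈R : a ∈ R
        a∈R = R.+∈ b∈ (R.*∈ d₁∈ a₂∈)

        ω-difference : ∃ λ m → m ∈ 𝔪 ×
          ev (suc (suc n)) ω a - ev (suc (suc n)) ω b ≈ (a - b) * m
        ω-difference = ev-difference 𝔪-resp 𝔪-0 𝔪-+ (suc (suc n)) {ω} {a} {b}
          (𝔪-* (proj₂ a∈R)) (𝔪-* (proj₂ b∈)) ω∈𝔪

        m v : Carrier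
        m = proj₁ ω-difference
        v = a₂ * (1# + m)

        v∈units : v ∈ units
        v∈units = units-* a₂∈units (units-+-𝔪 1∈units (proj₁ (proj₂ ω-difference)))

        sub-κ : ∀ i → sub a d (suc (suc n)) g i ≈ κ * sub a d (suc (suc n)) ν i
        sub-κ i = trans (sub-cong a d (suc (suc n)) {g} {λ i → κ * ν i} (λ i _ → g≈κν i) i)
          (sub-scale a d (suc (suc n)) κ ν i)

        -- As b is a root, the new constant term g(a) equals g(a) - g(b), which is κ (a - b) = κ d₁
        -- a₂ up to the factor 1 + m caused by `ω`. So it has the value of κ d₁, whereas all other
        -- coefficients are multiples of κ d₁ d₂.
        constant : sub a d (suc (suc n)) g 0 ≈ κ * (d₁ * v)
        constant = begin
          sub a d (suc (suc n)) g 0                  ≈⟨ sub-κ 0 ⟩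
          κ * sub a d (suc (suc n)) ν 0              ≈⟨ *-congˡ (sub-constant a d (suc (suc n)) ν) ⟩
          κ * ev (suc (suc n)) ν a                   ≈⟨ *-congˡ (solve 1 (λ x → x := x :- con (+ 0)) refl _) ⟩
          κ * (ev (suc (suc n)) ν a - 0#)            ≈⟨ *-congˡ (+-cong (evν a) (-‿cong (trans (sym root) (evν b)))) ⟩
          κ * ((ν 0 + a + ev (suc (suc n)) ω a) - (ν 0 + b + ev (suc (suc n)) ω b))
            ≈⟨ *-congˡ (solve 5 (λ v a b x y → (v :+ a :+ x) :- (v :+ b :+ y) := (a :- b) :+ (x :- y))
                 refl (ν 0) a b _ _) ⟩
          κ * ((a - b) + (ev (suc (suc n)) ω a - ev (suc (suc n)) ω b))
            ≈⟨ *-congˡ (+-congˡ (proj₂ (proj₂ ω-difference))) ⟩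
          κ * ((a - b) + (a - b) * m)
            ≈⟨ *-congˡ (solve 4 (λ b d a m → (b :+ d :* a :- b) :+ (b :+ d :* a :- b) :* m
                 := d :* (a :* (con (+ 1) :+ m))) refl b d₁ a₂ m) ⟩
          κ * (d₁ * v) ∎

        ν∈R : ∀ i → i ℕ.< suc (suc n) → ν i ∈ R
        ν∈R zero          _               = ν0∈R
        ν∈R (suc zero)    _               = R.resp (sym ν1≈1) R.1∈
        ν∈R (suc (suc i)) (s≤s (s≤s i<n)) = proj₁ (ν∈𝔪R i i<n)

        higher : ∀ i {s} → sub a d (suc (suc n)) ν (suc i) ≈ d * s →
                 sub a d (suc (suc n)) g (suc i) ≈ sub a d (suc (suc n)) g 0 * (s * v ⁻¹ * d₂)
        higher i {s} e = begin
          sub a d (suc (suc n)) g (suc i)                ≈⟨ sub-κ (suc i) ⟩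
          κ * sub a d (suc (suc n)) ν (suc i)            ≈⟨ *-congˡ e ⟩
          κ * (d₁ * d₂ * s)                              ≈⟨ *-identityʳ _ ⟨
          κ * (d₁ * d₂ * s) * 1#                         ≈⟨ *-congˡ (inverseʳ (units≉0 v∈units)) ⟨
          κ * (d₁ * d₂ * s) * (v * v ⁻¹)
            ≈⟨ solve 6 (λ κ d₁ d₂ s v w → κ :* (d₁ :* d₂ :* s) :* (v :* w)
                 := κ :* (d₁ :* v) :* (s :* w :* d₂)) refl κ d₁ d₂ s v (v ⁻¹) ⟩
          κ * (d₁ * v) * (s * v ⁻¹ * d₂)                 ≈⟨ *-congʳ constant ⟨
          sub a d (suc (suc n)) g 0 * (s * v ⁻¹ * d₂)    ∎

        shift-dominates : Dominated (suc (suc n)) (sub a d (suc (suc n)) g)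
        shift-dominates =
          (λ e → ≉0-* κ≉0 (≉0-* d₁≉0 (units≉0 v∈units)) (trans (sym constant) e)) ,
          λ i _ → let (s , s∈ , e) = sub-suc∈ R-subring a∈R (R.*∈ d₁∈ d₂∈) (suc (suc n)) {ν} ν∈R i in
            s * v ⁻¹ * d₂ , 𝔪-* (*∈ (proj₂ s∈) (proj₁ (units⁻¹ v∈units))) d₂∈𝔪 , higher i e

    -- A root b of g in R is used to move closer to α.
    dominated-shift : ν 0 ∈ 𝒪 → ∃₂ λ a d → ∃₂ λ α′ c′ → ∃ λ u′ → a ∈ 𝕂 × d ∈ 𝕂 × ¬ (d ≈ 0#) ×
      u ≈ a + d * u′ × Approximant α′ c′ u′ × Dominated (suc (suc n)) (sub a d (suc (suc n)) g)
    dominated-shift ν0∈𝒪 =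
      let (b , b∈ , root) = hensel-linear ν0∈R n (λ i → ν (suc (suc i))) ν∈𝔪R
          (d₁ , u₁ , d₁∈ , d₁≉0 , u₁∈ , e₁) = distance b∈
          (_ , _ , approx₁) = shift approx b∈ e₁ (proj₁ d₁∈) d₁≉0 u₁∈
          -- The distance d₁ may be a unit. One further refinement supplies the factor d₂ in 𝔪 that
          -- separates the constant term from the others.
          (a₂ , d₂ , u₂ , a₂∈ , a₂∈units , d₂∈ , d₂∈𝔪 , d₂≉0 , u₂∈ , e₂) = refine approx₁
          (α₂ , c₂ , approx₂) = shift approx₁ a₂∈ e₂ (proj₁ d₂∈) d₂≉0 u₂∈
      in b + d₁ * a₂ , d₁ * d₂ , α₂ , c₂ , u₂ ,
         𝕂.+∈ (proj₁ b∈) (𝕂.*∈ (proj₁ d₁∈) (proj₁ a₂∈)) , 𝕂.*∈ (proj₁ d₁∈) (proj₁ d₂∈) ,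
         ≉0-* d₁≉0 d₂≉0 , combine e₁ e₂ , approx₂ ,
         shift-dominates ν0∈R b∈ (trans (+-congˡ (*-congˡ (+-congʳ ν1≈1))) root)
           d₁∈ d₁≉0 a₂∈ a₂∈units d₂∈ d₂∈𝔪
      where
      ν0∈R : ν 0 ∈ R
      ν0∈R = 𝕂.*∈ κ⁻¹∈𝕂 (g∈𝕂 0) , ν0∈𝒪
      distance : ∀ {b} → b ∈ R → ∃₂ λ d u₁ → d ∈ R × ¬ (d ≈ 0#) × u₁ ∈ units × u - b ≈ d * u₁
      distance {b} b∈ =
        let (d , u₁ , d∈𝕂 , u₁∈ , e) = sameValues {u - b}
              (λ u-b≈0 → u∉𝕂 (𝕂.resp (sym (x-y≈0⇒x≈y u-b≈0)) (proj₁ b∈)))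
        in d , u₁ ,
           (d∈𝕂 , units-cancelˡ u₁∈ (resp (trans e (*-comm d u₁)) (+∈ (proj₁ u∈units) (-∈ (proj₂ b∈))))) ,
           (λ d≈0 → u∉𝕂 (𝕂.resp (sym (x-y≈0⇒x≈y (trans e (trans (*-congʳ d≈0) (zeroˡ u₁))))) (proj₁ b∈))) ,
           u₁∈ , e
      combine : ∀ {b d₁ u₁ a₂ d₂ u₂} → u - b ≈ d₁ * u₁ → u₁ - a₂ ≈ d₂ * u₂ →
                u ≈ (b + d₁ * a₂) + d₁ * d₂ * u₂
      combine {b} {d₁} {u₁} {a₂} {d₂} {u₂} e₁ e₂ = begin
        u                                  ≈⟨ solve 2 (λ u b → u := b :+ (u :- b)) refl u b ⟩
        b + (u - b)                        ≈⟨ +-congˡ e₁ ⟩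
        b + d₁ * u₁                        ≈⟨ +-congˡ (*-congˡ (solve 2 (λ u a → u := a :+ (u :- a)) refl u₁ a₂)) ⟩
        b + d₁ * (a₂ + (u₁ - a₂))          ≈⟨ +-congˡ (*-congˡ (+-congˡ e₂)) ⟩
        b + d₁ * (a₂ + d₂ * u₂)            ≈⟨ solve 5 (λ b d₁ a₂ d₂ u → b :+ d₁ :* (a₂ :+ d₂ :* u)
                                                := (b :+ d₁ :* a₂) :+ d₁ :* d₂ :* u) refl b d₁ a₂ d₂ u₂ ⟩
        (b + d₁ * a₂) + d₁ * d₂ * u₂       ∎

-- Stages of approximation and exhaustion of the valuation ring

module Generators {ℓ} (setting : Setting ℓ) where
  open Setting setting
  open Field L
  open ValuationRing O
  open Domination setting public
  open IntegerSolver commutativeRing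
  open Polynomials commutativeRing
  open Coefficients commutativeRing
  open MonicPolynomials commutativeRing using (x-y≈0⇒x≈y; x≈y⇒x-y≈0)
  open ExpProperties commutativeSemiring using (^-congˡ; ^-distrib-*)
  open SetoidReasoning setoid

  -- `x` is the fixed generator in which polynomials are given, while `α`, `c` and `u` change from
  -- stage to stage.
  record Stage (x : Carrier) : Set ℓ where
    field
      {α c u}      : Carrier
      stageApprox  : Approximant α c u
      substitution : Substitution x u
    open Approximant stageApprox public
    open Substitution substitution public

  initial : ∀ {α} → Generator α → Stage α
  initial {α} generator = let (c , u , approx) = approximant generator in record
    { stageApprox  = approx
    ; substitution = extend (identity α) 𝕂.1∈ (Approximant.c∈𝕂 approx) (Approximant.c≉0 approx)
                       (Approximant.α≈1+cu approx)
    }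

  Dominates : ∀ {x} → ℕ → (ℕ → Carrier) → Stage x → Set ℓ
  Dominates n g stage = Dominated n (Stage.T stage n g)

  -- A polynomial constant in `x` stays constant in `u`: by the chain rule the rewritten polynomial
  -- has derivative 0, and the positive integers below p are units.
  constant-dominates : ∀ {x} m g (stage : Stage x) → suc m ℕ.≤ p → (∃ λ i → i ℕ.< suc m × ¬ (g i ≈ 0#)) →
    (∀ i → i ℕ.< m → g (suc i) ≈ 0#) → Dominates (suc m) g stage
  constant-dominates {x} m g stage m<p nonzero g≈0 =
    (λ ĝ0≈0 → g0≉0 (begin
      g 0                              ≈⟨ solve 2 (λ g x → g := g :+ x :* con (+ 0)) refl (g 0) x ⟩
      g 0 + x * 0#                     ≈⟨ +-congˡ (*-congˡ (trans (ev-cong m x g≈0) (ev-0 m x))) ⟨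
      ev (suc m) g x                   ≈⟨ ev-T (suc m) g ⟨
      ĝ 0 + u * ev m (ĝ ∘ suc) u       ≈⟨ +-cong ĝ0≈0 (*-congˡ (trans (ev-cong m u ĝ≈0) (ev-0 m u))) ⟩
      0# + u * 0#                      ≈⟨ solve 1 (λ u → con (+ 0) :+ u :* con (+ 0) := con (+ 0)) refl u ⟩
      0#                               ∎)) ,
    λ { i (s≤s i<m) → 0# , 𝔪-0 , trans (ĝ≈0 i i<m) (sym (zeroʳ _)) }
    where
    open Stage stage
    ĝ = T (suc m) g
    g0≉0 : ¬ (g 0 ≈ 0#)
    g0≉0 = case nonzero of λ where
      (zero  , _       , g0≉0)  → g0≉0
      (suc j , s≤s j<m , gsj≉0) → contradiction (g≈0 j j<m) gsj≉0
    ĝ≈0 : ∀ i → i ℕ.< m → ĝ (suc i) ≈ 0#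
    ĝ≈0 i i<m = domain (begin
      (suc i · 1#) * ĝ (suc i)    ≈⟨ D-T m g i ⟩
      δ * T m (D g) i             ≈⟨ *-congˡ (T-0 m (D g) (λ j j<m → trans (*-congˡ (g≈0 j j<m)) (zeroʳ _)) i) ⟩
      δ * 0#                      ≈⟨ zeroʳ δ ⟩
      0#                          ∎)
      (units≉0 (·1∈units i (ℕ.≤-trans (s≤s i<m) m<p)))

  -- The derivative multiplies the coefficients by units, since the degree is
  -- less than p.
  linearlyDominated : ∀ {x} m g (stage : Stage x) → suc m ℕ.≤ p → Dominates m (D g) stage →
    LinearlyDominated (suc m) (Stage.T stage (suc m) g)
  linearlyDominated {x} m g stage m<p (D0≉0 , dominated) =
    (λ ĝ1≈0 → ≉0-* δ≉0 D0≉0 (trans (sym δD0≈ĝ1) ĝ1≈0)) ,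
    λ { i (s≤s i<m) → higher i i<m (dominated i i<m) }
    where
    open Stage stage
    ĝ = T (suc m) g
    δD0≈ĝ1 : ĝ 1 ≈ δ * T m (D g) 0
    δD0≈ĝ1 = trans (solve 1 (λ x → x := (con (+ 1) :+ con (+ 0)) :* x) refl (ĝ 1)) (D-T m g 0)
    higher : ∀ i → suc i ℕ.< m → (∃ λ m′ → m′ ∈ 𝔪 × T m (D g) (suc i) ≈ T m (D g) 0 * m′) →
             ∃ λ m′ → m′ ∈ 𝔪 × ĝ (suc (suc i)) ≈ ĝ 1 * m′
    higher i i<m (m′ , m′∈ , e) = k ⁻¹ * m′ , 𝔪-* (proj₁ (units⁻¹ k∈units)) m′∈ ,
      cancelˡ (units≉0 k∈units) (begin
        k * ĝ (suc (suc i))               ≈⟨ D-T m g (suc i) ⟩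
        δ * T m (D g) (suc i)             ≈⟨ *-congˡ e ⟩
        δ * (T m (D g) 0 * m′)            ≈⟨ *-assoc δ _ m′ ⟨
        δ * T m (D g) 0 * m′              ≈⟨ *-congʳ δD0≈ĝ1 ⟨
        ĝ 1 * m′                          ≈⟨ *-identityˡ _ ⟨
        1# * (ĝ 1 * m′)                   ≈⟨ *-congʳ (inverseʳ (units≉0 k∈units)) ⟨
        k * k ⁻¹ * (ĝ 1 * m′)             ≈⟨ solve 4 (λ k v g m → k :* v :* (g :* m) := k :* (g :* (v :* m)))
                                               refl k (k ⁻¹) (ĝ 1) m′ ⟩
        k * (ĝ 1 * (k ⁻¹ * m′))           ∎)
      where
      k = suc (suc i) · 1#
      k∈units : k ∈ units
      k∈units = ·1∈units (suc i) (ℕ.≤-trans (s≤s i<m) m<p)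

  dominate-linear : ∀ {x} m g (stage : Stage x) → (∀ i → g i ∈ 𝕂) →
    LinearlyDominated (suc (suc m)) (Stage.T stage (suc (suc m)) g) → ∃ (Dominates {x} (suc (suc m)) g)
  dominate-linear m g stage g∈ linear with em {P = Stage.T stage (suc (suc m)) g 1 ⁻¹ * Stage.T stage (suc (suc m)) g 0 ∈ 𝒪}
  ... | no  ∉𝒪 = stage , dominated-constant (Stage.stageApprox stage) m _ (Stage.T∈𝕂 stage (suc (suc m)) g∈) linear ∉𝒪
  ... | yes ∈𝒪 =
    let (_ , _ , _ , _ , _ , a∈ , d∈ , d≉0 , u≈ , approx , dominated) =
          dominated-shift (Stage.stageApprox stage) m _ (Stage.T∈𝕂 stage (suc (suc m)) g∈) linear ∈𝒪
    in record { stageApprox = approx ; substitution = extend (Stage.substitution stage) a∈ d∈ d≉0 u≈ } , dominated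

  dominate : ∀ {α} → Generator α → ∀ n g → n ℕ.≤ p → (∀ i → g i ∈ 𝕂) →
             (∃ λ i → i ℕ.< n × ¬ (g i ≈ 0#)) → ∃ (Dominates {α} n g)
  dominate generator zero    g _   g∈ (_ , () , _)
  dominate generator (suc m) g m<p g∈ nonzero with em {P = ∃ λ i → i ℕ.< m × ¬ (D g i ≈ 0#)}
  -- The derivative is 0, hence so are all coefficients of g except the constant one.
  ... | no none = initial generator , constant-dominates m g (initial generator) m<p nonzero λ i i<m →
        domain (decidable-stable em (λ Dgi≉0 → none (i , i<m , Dgi≉0)))
          (units≉0 (·1∈units i (ℕ.≤-trans (s≤s i<m) m<p)))
  ... | yes some = step m m<p some
    where
    step : ∀ m → suc m ℕ.≤ p → (∃ λ i → i ℕ.< m × ¬ (D g i ≈ 0#)) → ∃ (Dominates (suc m) g)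
    step zero    _   (_ , () , _)
    step (suc m) m<p some =
      let (stage , dominated) = dominate generator (suc m) (D g) (ℕ.<⇒≤ m<p)
                                  (λ i → 𝕂.*∈ (·1∈𝕂 (suc i)) (g∈ (suc i))) some
      in dominate-linear m g stage g∈ (linearlyDominated (suc m) g stage m<p dominated)

  -- A dominated polynomial has as its value a nonzero constant term times a unit, so a polynomial
  -- of degree below p with a nonzero coefficient cannot vanish at α.
  independent : ∀ {α} → Generator α → ∀ {g} → (∀ i → g i ∈ 𝕂) → ev p g α ≈ 0# → ∀ i → i ℕ.< p → g i ≈ 0#
  independent {α} generator {g} g∈ evg≈0 i i<p = decidable-stable em λ gi≉0 →
    absurd (dominate generator p g ℕ.≤-refl g∈ (i , i<p , gi≉0))
    where
    absurd : ¬ ∃ (Dominates {α} p g)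
    absurd (stage , dominated) =
      let (v , v∈ , e) = dominated-ev q (Stage.T stage p g) (proj₁ (Stage.u∈units stage)) dominated
      in ≉0-* (proj₁ dominated) (units≉0 v∈) (trans (sym e) (trans (Stage.ev-T stage p g) evg≈0))

  root∈Mon : ∀ {α} → α ^ p ∈ 𝕂 → 0# ∈ Mon 𝕂 α p
  root∈Mon {α} α^p∈𝕂 = mon-resp (-‿inverseʳ _) (mon-+-pol 𝕂-subring (power∈Mon p)
    (pol-raise 𝕂.0∈ (s≤s z≤n) (proj₂ (adj-S 𝕂-subring (𝕂.-∈ α^p∈𝕂)))))
    where
    power∈Mon : ∀ n → α ^ n ∈ Mon 𝕂 α n
    power∈Mon zero    = nil refl
    power∈Mon (suc n) = cons 𝕂.0∈ (power∈Mon n) (sym (+-identityˡ _))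

  generator-basis : ∀ {α} → Generator α → ∀ y → ∃ λ g → (∀ i → g i ∈ 𝕂) × y ≈ ev p g α
  generator-basis {α} generator y =
    pol⇒stream 𝕂-subring (pol-reduce 𝕂-subring (root∈Mon (Generator.α^p∈𝕂 generator)) (proj₂ (Generator.generates generator y)))

  dominated⇒adj : ∀ n g {u} → u ∈ units → (∀ i → g i ∈ 𝕂) → Dominated (suc n) g →
                  ev (suc n) g u ∈ 𝒪 → ev (suc n) g u ∈ Adj R u
  dominated⇒adj n g {u} u∈ g∈ dominated ev∈𝒪 =
    let (v , v∈ , e) = dominated-ev n g (proj₁ u∈) dominated
        g0∈𝒪 = units-cancelˡ v∈ (resp (trans e (*-comm (g 0) v)) ev∈𝒪)
    in suc n , stream⇒pol R-subring (suc n) u (coefficient∈R g0∈𝒪)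
    where
    coefficient∈R : g 0 ∈ 𝒪 → ∀ i → i ℕ.< suc n → g i ∈ R
    coefficient∈R g0∈𝒪 zero    _   = g∈ 0 , g0∈𝒪
    coefficient∈R g0∈𝒪 (suc i) i<n = let (m , m∈ , e) = proj₂ dominated i i<n in
      g∈ (suc i) , resp (sym e) (*∈ g0∈𝒪 (proj₁ m∈))

  exhausts : ∀ {α₀} → Generator α₀ → ∀ {β} → β ∈ 𝒪 →
             ∃₂ λ α c → ∃ λ u → Approximant α c u × β ∈ Adj R u
  exhausts {α₀} generator {β} β∈ =
    let (g , g∈ , β≈) = generator-basis generator β in expand g g∈ β≈
    where
    expand : ∀ g → (∀ i → g i ∈ 𝕂) → β ≈ ev p g α₀ → ∃₂ λ α c → ∃ λ u → Approximant α c u × β ∈ Adj R u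
    expand g g∈ β≈ with em {P = ∃ λ i → i ℕ.< p × ¬ (g i ≈ 0#)}
    ... | yes nonzero =
          let (stage , dominated) = dominate generator p g ℕ.≤-refl g∈ nonzero
              β≈′ = trans β≈ (sym (Stage.ev-T stage p g))
          in _ , _ , _ , Stage.stageApprox stage , IsSubring.resp (adj-subring R-subring) (sym β≈′)
               (dominated⇒adj q (Stage.T stage p g) (Stage.u∈units stage) (Stage.T∈𝕂 stage p g∈) dominated
                 (resp β≈′ β∈))
    ... | no none =
          let (c , u , approx) = approximant generator
          in α₀ , c , u , approx , IsSubring.resp (adj-subring R-subring)
               (sym (trans β≈ (trans (ev-cong p α₀ (λ i i<p →
                 decidable-stable em (λ gi≉0 → none (i , i<p , gi≉0)))) (ev-0 p α₀))))
               (IsSubring.0∈ (adj-subring R-subring))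

  -- Kummer theory and comparison of the rings A[u]

  -- The same coefficients serve for every root of Xᵖ = h. An identity known at α₂ can thus be
  -- carried over to the conjugate ζ α₂, in place of applying an automorphism of `L`.
  Reducible : Carrier → (Carrier → Carrier) → Set ℓ
  Reducible h φ = ∃ λ g → (∀ i → g i ∈ 𝕂) × ∀ x → x ^ p ≈ h → φ x ≈ ev p g x

  module _ {h} (h∈ : h ∈ 𝕂) where

    reducible-+ : ∀ {φ ψ} → Reducible h φ → Reducible h ψ → Reducible h (λ x → φ x + ψ x)
    reducible-+ (f , f∈ , e) (g , g∈ , e′) = (λ i → f i + g i) , (λ i → 𝕂.+∈ (f∈ i) (g∈ i)) ,
      λ x x^p≈h → trans (+-cong (e x x^p≈h) (e′ x x^p≈h)) (sym (ev-+ p f g x))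

    reducible-scale : ∀ {k φ} → k ∈ 𝕂 → Reducible h φ → Reducible h (λ x → k * φ x)
    reducible-scale {k} k∈ (g , g∈ , e) = (λ i → k * g i) , (λ i → 𝕂.*∈ k∈ (g∈ i)) ,
      λ x x^p≈h → trans (*-congˡ (e x x^p≈h)) (sym (ev-scale p k g x))

    reducible-const : ∀ {k} → k ∈ 𝕂 → Reducible h (λ _ → k)
    reducible-const {k} k∈ = (λ { zero → k ; (suc _) → 0# }) , (λ { zero → k∈ ; (suc _) → 𝕂.0∈ }) ,
      λ x _ → sym (trans (+-congˡ (trans (*-congˡ (ev-0 q x)) (zeroʳ x))) (+-identityʳ k))

    reducible-shift : ∀ {φ} → Reducible h φ → Reducible h (λ x → x * φ x)
    reducible-shift (g , g∈ , e) = g′ , (λ { zero → 𝕂.*∈ h∈ (g∈ q) ; (suc i) → g∈ i }) , λ x x^p≈h → begin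
        x * _                            ≈⟨ *-congˡ (e x x^p≈h) ⟩
        x * ev p g x                     ≈⟨ *-congˡ (ev-snoc q g x) ⟩
        x * (ev q g x + x ^ q * g q)     ≈⟨ solve 4 (λ x e y g → x :* (e :+ y :* g) := x :* y :* g :+ x :* e)
                                              refl x _ (x ^ q) (g q) ⟩
        x ^ p * g q + x * ev q g x       ≈⟨ +-congʳ (*-congʳ x^p≈h) ⟩
        h * g q + x * ev q g x           ∎
      where
      g′ : ℕ → Carrier
      g′ zero    = h * g q
      g′ (suc i) = g i

    reducible-ev-* : ∀ n {f φ} → (∀ i → f i ∈ 𝕂) → Reducible h φ → Reducible h (λ x → ev n f x * φ x)
    reducible-ev-* zero    f∈ φ-red = (λ _ → 0#) , (λ _ → 𝕂.0∈) ,
      λ x _ → trans (zeroˡ _) (sym (ev-0 p x))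
    reducible-ev-* (suc n) {f} {φ} f∈ φ-red =
      let (g , g∈ , e) = reducible-+ (reducible-scale (f∈ 0) φ-red)
                           (reducible-shift (reducible-ev-* n (f∈ ∘ suc) φ-red))
      in g , g∈ , λ x x^p≈h → trans
           (solve 4 (λ f x e y → (f :+ x :* e) :* y := f :* y :+ x :* (e :* y)) refl (f 0) x _ (φ x))
           (e x x^p≈h)

    reducible-ev-^ : ∀ k {f} → (∀ i → f i ∈ 𝕂) → Reducible h (λ x → ev p f x ^ k)
    reducible-ev-^ zero    f∈ = reducible-const 𝕂.1∈
    reducible-ev-^ (suc k) f∈ = reducible-ev-* p f∈ (reducible-ev-^ k f∈)

  ev-monomial : ∀ n g x j → j ℕ.< n → (∀ i → i ℕ.< n → ¬ (i ≡ j) → g i ≈ 0#) → ev n g x ≈ g j * x ^ j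
  ev-monomial (suc n) g x zero j<n g≈0 = trans
    (+-congˡ (*-congˡ (trans (ev-cong n x (λ i i<n → g≈0 (suc i) (s≤s i<n) λ ())) (ev-0 n x))))
    (solve 2 (λ g x → g :+ x :* con (+ 0) := g :* con (+ 1)) refl (g 0) x)
  ev-monomial (suc n) g x (suc j) (s≤s j<n) g≈0 = trans
    (+-cong (g≈0 0 (s≤s z≤n) λ ()) (*-congˡ (ev-monomial n (g ∘ suc) x j j<n
      (λ i i<n i≢j → g≈0 (suc i) (s≤s i<n) (i≢j ∘ ℕ.suc-injective)))))
    (solve 3 (λ g x y → con (+ 0) :+ x :* (g :* y) := g :* (x :* y)) refl (g (suc j)) x (x ^ j))

  ev-twist : ∀ n g z x → ev n g (z * x) ≈ ev n (λ i → z ^ i * g i) x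
  ev-twist zero    g z x = refl
  ev-twist (suc n) g z x = +-cong (sym (*-identityˡ (g 0))) (begin
    z * x * ev n (g ∘ suc) (z * x)               ≈⟨ *-congˡ (ev-twist n (g ∘ suc) z x) ⟩
    z * x * ev n (λ i → z ^ i * g (suc i)) x     ≈⟨ solve 3 (λ z x e → z :* x :* e := x :* (z :* e)) refl z x _ ⟩
    x * (z * ev n (λ i → z ^ i * g (suc i)) x)   ≈⟨ *-congˡ (ev-scale n z (λ i → z ^ i * g (suc i)) x) ⟨
    x * ev n (λ i → z * (z ^ i * g (suc i))) x   ≈⟨ *-congˡ (ev-cong n x (λ i _ → sym (*-assoc z (z ^ i) _))) ⟩
    x * ev n (λ i → z ^ suc i * g (suc i)) x     ∎)

  -- With α₁ = g(α₂), the conjugate g(ζ α₂) is again a p-th root of α₁ᵖ, hence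
  -- equal to ζʲ α₁; comparing coefficients leaves only the j-th term of g.
  kummer : ∀ {α₁ α₂} → Generator α₁ → Generator α₂ → ∃₂ λ k j → k ∈ 𝕂 × α₁ ≈ k * α₂ ^ j
  kummer {α₁} {α₂} gen₁ gen₂ =
    let (g , g∈ , α₁≈) = generator-basis gen₂ α₁
        (j , j<p , e) = ^p-injective (units≉0 (Generator.α∈units gen₁)) (conjugate g∈ α₁≈)
    in g j , j , g∈ j , trans α₁≈ (ev-monomial p g α₂ j j<p (λ i i<p i≢j → other g∈ α₁≈ j<p e i<p i≢j))
    where
    h∈ = Generator.α^p∈𝕂 gen₂
    conjugate : ∀ {g} → (∀ i → g i ∈ 𝕂) → α₁ ≈ ev p g α₂ → ev p g (ζ * α₂) ^ p ≈ α₁ ^ p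
    conjugate {g} g∈ α₁≈ =
      -- The difference of g(x)ᵖ and α₁ᵖ reduces to a polynomial of degree below p that vanishes at
      -- α₂. By independence it is 0, so it vanishes at ζ α₂ as well.
      let (r , r∈ , e) = reducible-+ h∈ (reducible-ev-^ h∈ p g∈)
                           (reducible-const h∈ (𝕂.-∈ (Generator.α^p∈𝕂 gen₁)))
          r≈0 = independent gen₂ r∈ (trans (sym (e α₂ refl))
                  (x≈y⇒x-y≈0 (^-congˡ p (sym α₁≈))))
          [ζα]^p≈h = trans (^-distrib-* ζ α₂ p) (trans (*-congʳ ζ^p≈1) (*-identityˡ _))
      in x-y≈0⇒x≈y (trans (e (ζ * α₂) [ζα]^p≈h) (trans (ev-cong p (ζ * α₂) r≈0) (ev-0 p (ζ * α₂))))
    other : ∀ {g j i} → (∀ i → g i ∈ 𝕂) → α₁ ≈ ev p g α₂ → j ℕ.< p → ev p g (ζ * α₂) ≈ ζ ^ j * α₁ →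
            i ℕ.< p → ¬ (i ≡ j) → g i ≈ 0#
    other {g} {j} {i} g∈ α₁≈ j<p e i<p i≢j = domain
      (trans (solve 3 (λ a b g → (a :- b) :* g := a :* g :+ :- b :* g) refl (ζ ^ i) (ζ ^ j) (g i))
        (independent gen₂ {λ i → ζ ^ i * g i + - ζ ^ j * g i}
          (λ i → 𝕂.+∈ (𝕂.*∈ (proj₁ (ζ^∈R i)) (g∈ i)) (𝕂.*∈ (𝕂.-∈ (proj₁ (ζ^∈R j))) (g∈ i)))
          (begin
            ev p (λ i → ζ ^ i * g i + - ζ ^ j * g i) α₂
              ≈⟨ ev-+ p (λ i → ζ ^ i * g i) (λ i → - ζ ^ j * g i) α₂ ⟩
            ev p (λ i → ζ ^ i * g i) α₂ + ev p (λ i → - ζ ^ j * g i) α₂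
              ≈⟨ +-cong (trans (sym (ev-twist p g ζ α₂)) e)
                        (trans (ev-scale p (- ζ ^ j) g α₂) (*-congˡ (sym α₁≈))) ⟩
            ζ ^ j * α₁ + - ζ ^ j * α₁
              ≈⟨ solve 2 (λ z a → z :* a :+ :- z :* a := con (+ 0)) refl (ζ ^ j) α₁ ⟩
            0# ∎) i i<p))
      λ ζ^i-ζ^j≈0 → distinct i≢j (x-y≈0⇒x≈y ζ^i-ζ^j≈0)
      where
      distinct : ¬ (i ≡ j) → ¬ (ζ ^ i ≈ ζ ^ j)
      distinct i≢j e with ℕ.<-cmp i j
      ... | tri< i<j _ _ = ζ-injective i j i<j (ℕ.≤-trans j<p (ℕ.m≤m+n p i)) e
      ... | tri≈ _ i≡j _ = i≢j i≡j
      ... | tri> _ _ j<i = ζ-injective j i j<i (ℕ.≤-trans i<p (ℕ.m≤m+n p j)) (sym e)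

  power-expansion : ∀ {α c u} → Approximant α c u → ∀ n → ∃ λ g → g ∈ Adj R u × α ^ n ≈ 1# + c * g
  power-expansion {α} {c} {u} approx zero =
    0# , IsSubring.0∈ (adj-subring R-subring) , solve 1 (λ c → con (+ 1) := con (+ 1) :+ c :* con (+ 0)) refl c
  power-expansion {α} {c} {u} approx (suc n) =
    let (g , g∈ , e) = power-expansion approx n
        module Adj = IsSubring (adj-subring R-subring {u})
    in u + (1# + c * u) * g ,
       Adj.+∈ (adj-gen R-subring) (Adj.*∈ (Adj.+∈ Adj.1∈ (Adj.*∈ (adj-S R-subring c∈R) (adj-gen R-subring))) g∈) ,
       trans (*-cong α≈1+cu e) (solve 3 (λ c u g → (con (+ 1) :+ c :* u) :* (con (+ 1) :+ c :* g)
         := con (+ 1) :+ c :* (u :+ (con (+ 1) :+ c :* u) :* g)) refl c u g)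
    where open Approximant approx

  -- From α₁ = k α₂ʲ = k (1 + c₂ g) follows u₁ = (k - 1) / c₁ + k (c₂ / c₁) g. The second summand is
  -- in A[u₂], as c₂ / c₁ is integral. The first is then a difference of integral elements and lies
  -- in 𝕂, hence in R.
  nested : ∀ {α₁ c₁ u₁ α₂ c₂ u₂} → Approximant α₁ c₁ u₁ → Approximant α₂ c₂ u₂ →
           c₂ * c₁ ⁻¹ ∈ 𝒪 → u₁ ∈ Adj R u₂
  nested {α₁} {c₁} {u₁} {α₂} {c₂} {u₂} approx₁ approx₂ c₂/c₁∈𝒪 =
    let (k , j , k∈𝕂 , α₁≈) = kummer A₁.generator A₂.generator
        (g , g∈ , e) = power-expansion approx₂ j
    in main {j = j} k∈𝕂 α₁≈ g∈ e
    where
    module A₁ = Approximant approx₁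
    module A₂ = Approximant approx₂
    adj = adj-subring R-subring {u₂}
    module Adj = IsSubring adj
    c₁⁻¹∈𝕂 = ⁻¹∈𝕂 A₁.c∈𝕂 A₁.c≉0
    s∈R : c₂ * c₁ ⁻¹ ∈ R
    s∈R = 𝕂.*∈ A₂.c∈𝕂 c₁⁻¹∈𝕂 , c₂/c₁∈𝒪
    adj⊆𝒪 : Adj R u₂ ⊆ 𝒪
    adj⊆𝒪 = adj-minimal R-subring isSubring proj₂ (proj₁ A₂.u∈units)
    main : ∀ {k j g} → k ∈ 𝕂 → α₁ ≈ k * α₂ ^ j → g ∈ Adj R u₂ → α₂ ^ j ≈ 1# + c₂ * g → u₁ ∈ Adj R u₂
    main {k} {j} {g} k∈𝕂 α₁≈ g∈ α₂^j≈ = Adj.resp (sym u₁≈)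
      (Adj.+∈ (adj-S R-subring r∈R) sg∈)
      where
      k∈𝒪 : k ∈ 𝒪
      k∈𝒪 = units-cancelˡ (units-^ j A₂.α∈units) (resp (trans α₁≈ (*-comm k _)) (proj₁ A₁.α∈units))
      sg = k * (c₂ * c₁ ⁻¹) * g
      sg∈ : sg ∈ Adj R u₂
      sg∈ = Adj.*∈ (adj-S R-subring (R.*∈ (k∈𝕂 , k∈𝒪) s∈R)) g∈
      r = (k - 1#) * c₁ ⁻¹
      u₁≈ : u₁ ≈ r + sg
      u₁≈ = begin
        u₁                                  ≈⟨ *-identityʳ u₁ ⟨
        u₁ * 1#                             ≈⟨ *-congˡ (inverseʳ A₁.c≉0) ⟨
        u₁ * (c₁ * c₁ ⁻¹)                   ≈⟨ solve 3 (λ u c v → u :* (c :* v) := c :* u :* v) refl u₁ c₁ (c₁ ⁻¹) ⟩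
        c₁ * u₁ * c₁ ⁻¹                     ≈⟨ *-congʳ A₁.α-1≈cu ⟨
        (α₁ - 1#) * c₁ ⁻¹                   ≈⟨ *-congʳ (+-congʳ (trans α₁≈ (*-congˡ α₂^j≈))) ⟩
        (k * (1# + c₂ * g) - 1#) * c₁ ⁻¹    ≈⟨ solve 4 (λ k c g v → (k :* (con (+ 1) :+ c :* g) :- con (+ 1)) :* v
                                                 := (k :- con (+ 1)) :* v :+ k :* (c :* v) :* g) refl k c₂ g (c₁ ⁻¹) ⟩
        r + sg                              ∎
      r∈R : r ∈ R
      r∈R = 𝕂.*∈ (𝕂.+∈ k∈𝕂 (𝕂.-∈ 𝕂.1∈)) c₁⁻¹∈𝕂 ,
        resp (trans (+-congʳ u₁≈) (solve 2 (λ r s → (r :+ s) :- s := r) refl r sg))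
          (+∈ (proj₁ A₁.u∈units) (-∈ (adj⊆𝒪 sg∈)))

  comparable : ∀ {α₁ c₁ u₁ α₂ c₂ u₂} → Approximant α₁ c₁ u₁ → Approximant α₂ c₂ u₂ →
               Adj R u₁ ⊆ Adj R u₂ ⊎ Adj R u₂ ⊆ Adj R u₁
  comparable {α₁} {c₁} {u₁} {α₂} {c₂} {u₂} approx₁ approx₂ with total {c₂ * c₁ ⁻¹} {c₁ * c₂ ⁻¹} (begin
      c₂ * c₁ ⁻¹ * (c₁ * c₂ ⁻¹)        ≈⟨ solve 4 (λ c d v w → c :* v :* (d :* w) := (d :* v) :* (c :* w))
                                            refl c₂ c₁ (c₁ ⁻¹) (c₂ ⁻¹) ⟩
      (c₁ * c₁ ⁻¹) * (c₂ * c₂ ⁻¹)      ≈⟨ *-cong (inverseʳ (Approximant.c≉0 approx₁)) (inverseʳ (Approximant.c≉0 approx₂)) ⟩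
      1# * 1#                          ≈⟨ *-identityˡ 1# ⟩
      1#                               ∎)
  ... | inj₁ ∈𝒪 = inj₁ (adj-minimal R-subring (adj-subring R-subring) (adj-S R-subring) (nested approx₁ approx₂ ∈𝒪))
  ... | inj₂ ∈𝒪 = inj₂ (adj-minimal R-subring (adj-subring R-subring) (adj-S R-subring) (nested approx₂ approx₁ ∈𝒪))

  -- u is determined by α up to a unit of R.
  approximant-unique : ∀ {α c u c′ u′} → Approximant α c u → Approximant α c′ u′ → Adj R u ⊆ Adj R u′
  approximant-unique {α} {c} {u} {c′} {u′} approx approx′ =
    adj-minimal R-subring (adj-subring R-subring) (adj-S R-subring)
      (IsSubring.resp (adj-subring R-subring) (sym u≈ku′)
        (IsSubring.*∈ (adj-subring R-subring) (adj-S R-subring (k∈𝕂 , k∈𝒪)) (adj-gen R-subring)))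
    where
    module A  = Approximant approx
    module A′ = Approximant approx′
    k = c′ * c ⁻¹
    k∈𝕂 = 𝕂.*∈ A′.c∈𝕂 (⁻¹∈𝕂 A.c∈𝕂 A.c≉0)
    u≈ku′ : u ≈ k * u′
    u≈ku′ = cancelˡ A.c≉0 (begin
      c * u                     ≈⟨ A.α-1≈cu ⟨
      α - 1#                    ≈⟨ A′.α-1≈cu ⟩
      c′ * u′                   ≈⟨ *-identityˡ _ ⟨
      1# * (c′ * u′)            ≈⟨ *-congʳ (inverseʳ A.c≉0) ⟨
      c * c ⁻¹ * (c′ * u′)      ≈⟨ solve 4 (λ c v d u → c :* v :* (d :* u) := c :* (d :* v :* u)) refl c (c ⁻¹) c′ u′ ⟩
      c * (c′ * c ⁻¹ * u′)      ∎)
    k∈𝒪 : k ∈ 𝒪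
    k∈𝒪 = units-cancelˡ A′.u∈units (resp (trans u≈ku′ (*-comm k u′)) (proj₁ A.u∈units))

  -- A zero constant term in the monic equation of `x` is removed by cancelling `x`; once s + x w =
  -- 0 with s nonzero, the inverse of `x` is (- w) / s.
  adj-inverse : ∀ {α} → α ^ p ∈ 𝕂 → ¬ (α ≈ 0#) → ∀ {x y} → x ∈ Adj 𝕂 α → x * y ≈ 1# → y ∈ Adj 𝕂 α
  adj-inverse {α} α^p∈𝕂 α≉0 {x} {y} x∈ xy≈1 =
    let (n , vanishing) = adj⇒integral 𝕂-subring domain 1≉0 α≉0 (p , root∈Mon α^p∈𝕂) x∈
    in adj-minimal 𝕂-subring (adj-subring 𝕂-subring) (adj-S 𝕂-subring) x∈ (go vanishing)
    where
    module Adj = IsSubring (adj-subring 𝕂-subring {x})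
    go : ∀ {n} → 0# ∈ Mon 𝕂 x n → y ∈ Adj 𝕂 x
    go (nil 0≈1) = contradiction (sym 0≈1) 1≉0
    go (cons {n} {s} {w} s∈ w∈ e) with em {P = s ≈ 0#}
    ... | yes s≈0 = go (mon-resp (domain (trans (sym (+-identityˡ _)) (trans (+-congʳ (sym s≈0)) (sym e)))
                      (factor≉0ˡ xy≈1)) w∈)
    ... | no  s≉0 = Adj.resp y≈ (Adj.*∈ (adj-S 𝕂-subring (𝕂.-∈ (⁻¹∈𝕂 s∈ s≉0))) (suc n , mon⇒pol 𝕂.1∈ w∈))
      where
      y≈ : - (s ⁻¹) * w ≈ y
      y≈ = cancelˡ s≉0 (begin
        s * (- (s ⁻¹) * w)             ≈⟨ solve 3 (λ s v w → s :* (:- v :* w) := :- (s :* v) :* w) refl s (s ⁻¹) w ⟩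
        - (s * s ⁻¹) * w             ≈⟨ *-congʳ (-‿cong (inverseʳ s≉0)) ⟩
        - 1# * w                     ≈⟨ *-congʳ (-‿cong xy≈1) ⟨
        - (x * y) * w                ≈⟨ solve 4 (λ s x y w → :- (x :* y) :* w := s :* y :- (s :+ x :* w) :* y) refl s x y w ⟩
        s * y - (s + x * w) * y      ≈⟨ +-congˡ (-‿cong (*-congʳ e)) ⟨
        s * y - 0# * y               ≈⟨ solve 2 (λ s y → s :* y :- con (+ 0) :* y := s :* y) refl s y ⟩
        s * y                        ∎)

  -- One of the factors α - ζⁱ of αᵖ - 1 lies in 𝔪, and every power of ζ is ≡ 1.
  ^p≡1⇒≡1 : ∀ {α} → α ^ p - 1# ∈ 𝔪 → α - 1# ∈ 𝔪
  ^p≡1⇒≡1 {α} α^p≡1 = case 𝔪-prime (+∈ α∈ (-∈ 1∈)) (prod∈ q factor∈) (𝔪-resp (sym (x^p-1 α)) α^p≡1) of λ where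
      (inj₁ α≡1) → α≡1
      (inj₂ e)   → let (i , _ , α≡ζ^i) = 𝔪-prime-prod q factor∈ e in
        𝔪-resp (telescope α (ζ ^ suc i) 1#) (𝔪-+ α≡ζ^i (power≡1 (suc i) ζ≡1 (proj₂ ζ∈R)))
    where
    α∈ : α ∈ 𝒪
    α∈ = proj₁ (root∈units q (≡𝔪⇒units 1∈units α^p≡1))
    factor∈ : ∀ i → α - ζ ^ suc i ∈ 𝒪
    factor∈ i = +∈ α∈ (-∈ (proj₂ (ζ^∈R (suc i))))

  -- A Kummer generator times a suitable element of 𝕂 is ≡ 1 modulo 𝔪, since
  -- L and 𝕂 have the same values and residues.
  normalize : ∀ {x} → x ^ p ∈ 𝕂 → (∀ y → y ∈ Adj 𝕂 x) → ∃ Generator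
  normalize {x} x^p∈𝕂 generates =
    let (k , u , k∈ , u∈ , x≈ku) = sameValues x≉0
        (a , a∈ , u≡a)           = sameResidues (proj₁ u∈)
        a∈units                  = ≡𝔪⇒units u∈ (𝔪-resp (swap- u a) (𝔪-neg u≡a))
    in scale k∈ u∈ x≈ku a∈ a∈units u≡a
    where
    x∉𝕂 : x ∉ 𝕂
    x∉𝕂 x∈ = proj₂ proper (adj-minimal 𝕂-subring 𝕂-subring id x∈ (generates (proj₁ proper)))
    x≉0 : ¬ (x ≈ 0#)
    x≉0 x≈0 = x∉𝕂 (𝕂.resp (sym x≈0) 𝕂.0∈)
    scale : ∀ {k u a} → k ∈ 𝕂 → u ∈ units → x ≈ k * u → a ∈ R → a ∈ units → u - a ∈ 𝔪 → ∃ Generator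
    scale {k} {u} {a} k∈ u∈ x≈ku a∈ a∈units u≡a = x * e ,
      scaled x^p∈𝕂 generates (⁻¹∈𝕂 (𝕂.*∈ k∈ (proj₁ a∈)) ka≉0) e≉0
        (𝔪-resp identity′ (𝔪-* (proj₁ (units⁻¹ a∈units)) u≡a))
      where
      k≉0 : ¬ (k ≈ 0#)
      k≉0 k≈0 = x≉0 (trans x≈ku (trans (*-congʳ k≈0) (zeroˡ u)))
      ka≉0 = ≉0-* k≉0 (units≉0 a∈units)
      e = (k * a) ⁻¹
      e≉0 : ¬ (e ≈ 0#)
      e≉0 = factor≉0ˡ (trans (*-comm e (k * a)) (inverseʳ ka≉0))
      identity′ : a ⁻¹ * (u - a) ≈ x * e - 1#
      identity′ = begin
        a ⁻¹ * (u - a)                              ≈⟨ *-identityʳ _ ⟨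
        a ⁻¹ * (u - a) * 1#                         ≈⟨ *-congˡ (inverseʳ ka≉0) ⟨
        a ⁻¹ * (u - a) * (k * a * e)                ≈⟨ solve 5 (λ v u a k e → v :* (u :- a) :* (k :* a :* e)
                                                         := (a :* v) :* (k :* u :* e :- k :* a :* e)) refl (a ⁻¹) u a k e ⟩
        (a * a ⁻¹) * (k * u * e - k * a * e)        ≈⟨ *-cong (inverseʳ (units≉0 a∈units))
                                                         (+-cong (*-congʳ (sym x≈ku)) (-‿cong (inverseʳ ka≉0))) ⟩
        1# * (x * e - 1#)                           ≈⟨ *-identityˡ _ ⟩
        x * e - 1#                                  ∎

-- Passage between K and its image in L

module Embedding {ℓ} (em : ExcludedMiddle ℓ) {K L : Field ℓ} (E : Extension K L)
  {A : ValuationRing K} {O : ValuationRing L} (O/A : ExtensionDefs._LiesOver_ E O A) where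
  module K = Field K
  module A = ValuationRing A
  open Field L
  open ValuationRing O
  open Extension E
  open ExtensionDefs E renaming (resp to K⟨⟩-resp; inv to K⟨⟩-inv)
  open OverValuationRing A
  open RingMorphisms.IsRingHomomorphism isRingHomomorphism public
    using (⟦⟧-cong; +-homo; *-homo; -‿homo; 0#-homo; 1#-homo)
  open Valuations em L O using (1∈units; units-resp)
  open IntegerSolver commutativeRing
  open Polynomials commutativeRing
  open MonicPolynomials commutativeRing using (evᵐ)
  open SetoidReasoning setoid

  ι≉0 : ∀ {x} → ¬ (x K.≈ K.0#) → ¬ (ι x ≈ 0#)
  ι≉0 {x} x≉0 ιx≈0 = let (y , xy≈1) = K.inverse x≉0 in 1≉0 (begin
    1#          ≈⟨ 1#-homo ⟨
    ι K.1#      ≈⟨ ⟦⟧-cong xy≈1 ⟨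
    ι (x K.* y) ≈⟨ *-homo x y ⟩
    ι x * ι y   ≈⟨ *-congʳ ιx≈0 ⟩
    0# * ι y    ≈⟨ zeroˡ _ ⟩
    0#          ∎)

  ι-reflects-0 : ∀ {x} → ι x ≈ 0# → x K.≈ K.0#
  ι-reflects-0 ιx≈0 = decidable-stable em (λ x≉0 → ι≉0 x≉0 ιx≈0)

  minus-homo : ∀ x y → ι (x K.- y) ≈ ι x - ι y
  minus-homo x y = trans (+-homo x (K.- y)) (+-congˡ (-‿homo y))

  ι-reflects : ∀ {x y} → ι x ≈ ι y → x K.≈ y
  ι-reflects {x} {y} e =
    K.trans (K.sym (K.+-identityʳ x)) (K.trans (K.+-congˡ (K.sym (K.-‿inverseˡ y)))
      (K.trans (K.sym (K.+-assoc x _ y)) (K.trans (K.+-congʳ (ι-reflects-0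
        (trans (minus-homo x y) (trans (+-congʳ e) (-‿inverseʳ _))))) (K.+-identityˡ y))))

  ^-homo : ∀ x n → ι (x K.^ n) ≈ ι x ^ n
  ^-homo x zero    = 1#-homo
  ^-homo x (suc n) = trans (*-homo x _) (*-congˡ (^-homo x n))

  ·1-homo : ∀ n → ι (n K.· K.1#) ≈ n · 1#
  ·1-homo zero    = 0#-homo
  ·1-homo (suc n) = trans (+-homo _ _) (+-cong 1#-homo (·1-homo n))

  𝕂 : Pred Carrier ℓ
  𝕂 y = ∃ λ x → y ≈ ι x

  𝕂-subring : IsSubring 𝕂
  𝕂-subring = record
    { resp = λ { y≈z (x , e) → x , trans (sym y≈z) e }
    ; 0∈   = K.0# , sym 0#-homo
    ; 1∈   = K.1# , sym 1#-homo
    ; +∈   = λ { (x , e) (y , f) → x K.+ y , trans (+-cong e f) (sym (+-homo x y)) }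
    ; *∈   = λ { (x , e) (y , f) → x K.* y , trans (*-cong e f) (sym (*-homo x y)) }
    ; -∈   = λ { (x , e) → K.- x , trans (-‿cong e) (sym (-‿homo x)) }
    }

  inverse-unique : ∀ {x y z} → x * y ≈ 1# → x * z ≈ 1# → y ≈ z
  inverse-unique {x} {y} {z} xy≈1 xz≈1 = begin
    y             ≈⟨ *-identityˡ y ⟨
    1# * y        ≈⟨ *-congʳ xz≈1 ⟨
    x * z * y     ≈⟨ solve 3 (λ x z y → x :* z :* y := x :* y :* z) refl x z y ⟩
    x * y * z     ≈⟨ *-congʳ xy≈1 ⟩
    1# * z        ≈⟨ *-identityˡ z ⟩
    z             ∎

  ι-inverse : ∀ {x} → ¬ (x K.≈ K.0#) → ∃ λ y → x K.* y K.≈ K.1# × ι x * ι y ≈ 1#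
  ι-inverse {x} x≉0 = let (y , e) = K.inverse x≉0 in
    y , e , trans (sym (*-homo x y)) (trans (⟦⟧-cong e) 1#-homo)

  𝕂-inverse : ∀ {x y} → x ∈ 𝕂 → x * y ≈ 1# → y ∈ 𝕂
  𝕂-inverse {x} {y} (x′ , x≈) xy≈1 =
    let (y′ , _ , e) = ι-inverse {x′} λ x′≈0 → 1≉0 (begin
          1#         ≈⟨ xy≈1 ⟨
          x * y      ≈⟨ *-congʳ (trans x≈ (trans (⟦⟧-cong x′≈0) 0#-homo)) ⟩
          0# * y     ≈⟨ zeroˡ y ⟩
          0#         ∎)
    in y′ , inverse-unique xy≈1 (trans (*-congʳ x≈) e)

  𝒪⇒ : ∀ {x} → x ∈ A.𝒪 → ι x ∈ 𝒪
  𝒪⇒ = Equivalence.to (O/A _)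

  𝒪⇐ : ∀ {x} → ι x ∈ 𝒪 → x ∈ A.𝒪
  𝒪⇐ = Equivalence.from (O/A _)

  units⇒ : ∀ {x} → x ∈ A.units → ι x ∈ units
  units⇒ (x∈ , w , w∈ , xw≈1) = 𝒪⇒ x∈ , ι w , 𝒪⇒ w∈ ,
    trans (sym (*-homo _ w)) (trans (⟦⟧-cong xw≈1) 1#-homo)

  units⇐ : ∀ {x} → ι x ∈ units → x ∈ A.units
  units⇐ {x} (ιx∈ , w , w∈ , ιxw≈1) =
    let (y , xy≈1 , e) = ι-inverse {x} (λ x≈0 → 1≉0 (trans (sym ιxw≈1)
          (trans (*-congʳ (trans (⟦⟧-cong x≈0) 0#-homo)) (zeroˡ w))))
    in 𝒪⇐ ιx∈ , y , 𝒪⇐ (resp (inverse-unique ιxw≈1 e) w∈) , xy≈1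

  𝔪⇒ : ∀ {x} → x ∈ A.𝔪 → ι x ∈ 𝔪
  𝔪⇒ (x∈ , x∉) = 𝒪⇒ x∈ , x∉ ∘ units⇐

  𝔪⇐ : ∀ {x} → ι x ∈ 𝔪 → x ∈ A.𝔪
  𝔪⇐ (ιx∈ , ιx∉) = 𝒪⇐ ιx∈ , ιx∉ ∘ units⇒

  private
    R : Pred Carrier ℓ
    R x = x ∈ 𝕂 × x ∈ 𝒪

  R⇒ : ∀ {y} → y ∈ R → ∃ λ x → x ∈ A.𝒪 × y ≈ ι x
  R⇒ ((x , y≈ιx) , y∈) = x , 𝒪⇐ (resp y≈ιx y∈) , y≈ιx

  R⇐ : ∀ {x} → x ∈ A.𝒪 → ι x ∈ R
  R⇐ {x} x∈ = (x , refl) , 𝒪⇒ x∈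

  Adj⇒A[] : ∀ {x} → Adj R x ⊆ A[ x ]
  Adj⇒A[] {x} (_ , y∈) = go y∈
    where
    go : ∀ {n} → Pol R x n ⊆ A[ x ]
    go (nil e)         = [] , [] , e
    go (cons s∈ w∈ e) = let (f , f∈ , w≈) = go w∈ ; (a , a∈ , s≈) = R⇒ s∈ in
      a ∷ f , a∈ ∷ f∈ , trans e (+-cong s≈ (*-congˡ w≈))

  A[]⇒Adj : ∀ {x} → A[ x ] ⊆ Adj R x
  A[]⇒Adj {x} (f , f∈ , y≈) = length f , pol-resp (sym y≈) (go f f∈)
    where
    go : ∀ f → All A.𝒪 f → eval (map ι f) x ∈ Pol R x (length f)
    go []      []        = nil refl
    go (a ∷ f) (a∈ ∷ f∈) = cons (R⇐ a∈) (go f f∈) refl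

  Integral⇒B : Integral R ⊆ B
  Integral⇒B {x} (_ , 0∈) = let (f , f∈ , e) = go 0∈ in f , f∈ , sym e
    where
    go : ∀ {n z} → z ∈ Mon R x n → ∃ λ f → All A.𝒪 f × z ≈ eval (monic (map ι f)) x
    go (nil z≈1)       = [] , [] , trans z≈1 (solve 1 (λ x → con (+ 1) := con (+ 1) :+ x :* con (+ 0)) refl x)
    go (cons s∈ w∈ e) = let (f , f∈ , w≈) = go w∈ ; (a , a∈ , s≈) = R⇒ s∈ in
      a ∷ f , a∈ ∷ f∈ , trans e (+-cong s≈ (*-congˡ w≈))

  B⇒Integral : B ⊆ Integral R
  B⇒Integral {x} (f , f∈ , e) = length f , mon-resp e (go f f∈)
    where
    go : ∀ f → All A.𝒪 f → eval (monic (map ι f)) x ∈ Mon R x (length f)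
    go []      []        = nil (solve 1 (λ x → con (+ 1) :+ x :* con (+ 0) := con (+ 1)) refl x)
    go (a ∷ f) (a∈ ∷ f∈) = cons (R⇐ a∈) (go f f∈) refl

  list-evᵐ : ∀ n {g} → (∀ i → g i ∈ R) →
             ∃ λ f → All A.𝒪 f × ∀ x → evᵐ n g (ι x) ≈ ι (K.eval (K.monic f) x)
  list-evᵐ zero    g∈ = [] , [] , λ x → begin
    1#                             ≈⟨ solve 1 (λ x → con (+ 1) := con (+ 1) :+ x :* con (+ 0)) refl (ι x) ⟩
    1# + ι x * 0#                  ≈⟨ +-cong 1#-homo (trans (*-homo x K.0#) (*-congˡ 0#-homo)) ⟨
    ι K.1# + ι (x K.* K.0#)        ≈⟨ +-homo _ _ ⟨
    ι (K.1# K.+ x K.* K.0#)        ∎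
  list-evᵐ (suc n) g∈ =
    let (f , f∈ , e) = list-evᵐ n (g∈ ∘ suc) ; (a , a∈ , g0≈) = R⇒ (g∈ 0) in
    a ∷ f , a∈ ∷ f∈ , λ x → trans (+-cong g0≈ (trans (*-congˡ (e x)) (sym (*-homo x _)))) (sym (+-homo a _))

  derivative-at-0 : ∀ c f → K.eval (K.derivative (c ∷ K.monic f)) K.0# K.≈ K.eval (K.monic f) K.0#
  derivative-at-0 c []      = K.+-cong (K.+-identityʳ _) K.refl
  derivative-at-0 c (b ∷ f) = K.+-cong (K.+-identityʳ b) (K.trans (K.zeroˡ _) (K.sym (K.zeroˡ _)))

  -- The derivative of c + X g at 0 is g(0), so simplicity of the root 0 becomes a unit condition on
  -- g.
  hensel-at-0 : A.IsHenselian → ∀ n {c g} → c ∈ R → c ∈ 𝔪 → (∀ i → g i ∈ R) → evᵐ n g 0# ∈ units →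
                ∃ λ b → b ∈ R × b ∈ 𝔪 × c + b * evᵐ n g b ≈ 0#
  hensel-at-0 henselian n {c} {g} c∈ c∈𝔪 g∈ unit =
    let (c′ , c′∈ , c≈)  = R⇒ c∈
        (f , f∈ , e)     = list-evᵐ n g∈
        (b , b∈ , root , b-0∈) = henselian (c′ ∷ f) (c′∈ ∷ f∈) K.0# A.0∈
          (A.𝔪-resp (K.sym (K.trans (K.+-congˡ (K.zeroˡ _)) (K.+-identityʳ c′))) (𝔪⇐ (𝔪-resp c≈ c∈𝔪)))
          (λ ∈𝔪 → proj₂ ∈𝔪 (units⇐ (units-resp (trans (evᵐ-0 n g) (trans (e K.0#)
                     (⟦⟧-cong (K.sym (derivative-at-0 c′ f))))) unit)))
    in ι b , R⇐ b∈ ,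
       𝔪⇒ (A.𝔪-resp (K.trans (K.+-congˡ (K.trans (K.sym (K.+-identityˡ _)) (K.-‿inverseʳ K.0#))) (K.+-identityʳ b)) b-0∈) ,
       (begin
         c + ι b * evᵐ n g (ι b)                          ≈⟨ +-cong c≈ (*-congˡ (e b)) ⟩
         ι c′ + ι b * ι (K.eval (K.monic f) b)            ≈⟨ trans (+-homo _ _) (+-congˡ (*-homo _ _)) ⟨
         ι (c′ K.+ b K.* K.eval (K.monic f) b)            ≈⟨ ⟦⟧-cong root ⟩
         ι K.0#                                           ≈⟨ 0#-homo ⟩
         0#                                               ∎)
    where
    evᵐ-0 : ∀ n g → evᵐ n g 0# ≈ evᵐ n g (ι K.0#)
    evᵐ-0 n g = MonicPolynomials.evᵐ-congʳ commutativeRing n g (sym 0#-homo)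

  residue-·1 : ∀ m → proj₁ (RingDefs._·_ A.residueField m (CommutativeRing.1# A.residueField)) ≡ m K.· K.1#
  residue-·1 zero    = ≡.refl
  residue-·1 (suc m) = ≡.cong (K.1# K.+_) (residue-·1 m)

  residue-≈0 : ∀ m → (let module k = CommutativeRing A.residueField in
                      RingDefs._·_ A.residueField m k.1# k.≈ k.0#) ⇔ (m · 1# ∈ 𝔪)
  residue-≈0 m = record
    { to   = λ e → 𝔪-resp (trans (⟦⟧-cong x-0≈) (·1-homo m)) (𝔪⇒ e)
    ; from = λ m∈ → 𝔪⇐ (𝔪-resp (sym (trans (⟦⟧-cong x-0≈) (·1-homo m))) m∈)
    ; to-cong   = λ { ≡.refl → ≡.refl }
    ; from-cong = λ { ≡.refl → ≡.refl }
    }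
    where
    x-0≈ : proj₁ (RingDefs._·_ A.residueField m (CommutativeRing.1# A.residueField)) K.- K.0# K.≈ m K.· K.1#
    x-0≈ = K.trans (K.+-cong (K.reflexive (residue-·1 m)) (K.trans (K.sym (K.+-identityˡ _)) (K.-‿inverseʳ K.0#)))
             (K.+-identityʳ _)

  -- The representative of the only coset need not be 1; expressing 1 by the same representative
  -- eliminates it.
  index1⇒sameValues : HasIndex A.valueGroup (ValuationRing.valueGroup O) (valueMap {O} {A} O/A) 1 →
    ∀ {x} → ¬ (x ≈ 0#) → ∃₂ λ k u → k ∈ 𝕂 × u ∈ units × x ≈ k * u
  index1⇒sameValues (r , coset) {x} x≉0
    with coset (x , x≉0) | coset (1# , 1≉0)
  ... | Fin.zero , ((g , _) , u , u∈ , x≈) , _ | Fin.zero , ((g₁ , g₁≉0) , u₁ , (u₁∈ , w₁ , w₁∈ , u₁w₁≈1) , 1≈) , _ =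
    let (h , _ , g₁h≈1) = ι-inverse g₁≉0
        ρ = proj₁ (r Fin.zero)
    in ι g * ι h , u * w₁ , (g K.* h , sym (*-homo g h)) ,
       units-* u∈ (w₁∈ , u₁ , u₁∈ , trans (*-comm w₁ u₁) u₁w₁≈1) , (begin
         x                                             ≈⟨ x≈ ⟩
         u * (ι g * ρ)                                 ≈⟨ solve 1 (λ x → x := con (+ 1) :* con (+ 1) :* x) refl _ ⟩
         1# * 1# * (u * (ι g * ρ))                     ≈⟨ *-congʳ (*-cong u₁w₁≈1 g₁h≈1) ⟨
         u₁ * w₁ * (ι g₁ * ι h) * (u * (ι g * ρ))
           ≈⟨ solve 7 (λ u₁ w₁ g₁ h u g ρ → u₁ :* w₁ :* (g₁ :* h) :* (u :* (g :* ρ))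
                := g :* h :* (u :* w₁) :* (u₁ :* (g₁ :* ρ))) refl u₁ w₁ (ι g₁) (ι h) u (ι g) ρ ⟩
         ι g * ι h * (u * w₁) * (u₁ * (ι g₁ * ρ))      ≈⟨ *-congˡ 1≈ ⟨
         ι g * ι h * (u * w₁) * 1#                     ≈⟨ *-identityʳ _ ⟩
         ι g * ι h * (u * w₁)                          ∎)

  -- The basis vector β need not be 1. Expanding 1 as c₁ β modulo 𝔪 shows that c₁ is a unit, whence
  -- x ≡ c β ≡ c / c₁.
  degree1⇒sameResidues : HasDegree A.residueField residueField (residueMap {O} {A} O/A) 1 →
    ∀ {x} → x ∈ 𝒪 → ∃ λ a → a ∈ R × x - a ∈ 𝔪
  degree1⇒sameResidues (b , coordinates) {x} x∈ =
    let (c  , x≡ , _) = coordinates (x , x∈)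
        (c₁ , 1≡ , _) = coordinates (1# , 1∈)
        β = proj₁ (b Fin.zero)
        β∈ = proj₂ (b Fin.zero)
    in main (proj₂ (c Fin.zero)) (proj₂ (c₁ Fin.zero)) β∈ x≡ 1≡
    where
    main : ∀ {c c₁ β} → c ∈ A.𝒪 → c₁ ∈ A.𝒪 → β ∈ 𝒪 →
           x - (ι c * β + 0#) ∈ 𝔪 → 1# - (ι c₁ * β + 0#) ∈ 𝔪 → ∃ λ a → a ∈ R × x - a ∈ 𝔪
    main {c} {c₁} {β} c∈ c₁∈ β∈ x≡ 1≡ = ι c * ι d , cd∈R , 𝔪-resp (begin
        (x - (ι c * β + 0#)) + ι c * (- ι d * (1# - (ι c₁ * β + 0#)) + 0#)
          ≈⟨ solve 5 (λ x c b d e → (x :- (c :* b :+ con (+ 0))) :+ c :* (:- d :* (con (+ 1) :- (e :* b :+ con (+ 0))) :+ con (+ 0))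
               := x :- c :* b :- c :* d :+ c :* (e :* d) :* b) refl x (ι c) β (ι d) (ι c₁) ⟩
        x - ι c * β - ι c * ι d + ι c * (ι c₁ * ι d) * β
          ≈⟨ +-congˡ (*-congʳ (*-congˡ c₁d≈1)) ⟩
        x - ι c * β - ι c * ι d + ι c * 1# * β
          ≈⟨ solve 4 (λ x c b d → x :- c :* b :- c :* d :+ c :* con (+ 1) :* b := x :- c :* d) refl x (ι c) β (ι d) ⟩
        x - ι c * ι d ∎)
      (𝔪-+ x≡ (𝔪-* (𝒪⇒ c∈) (𝔪-resp (sym (+-identityʳ _)) (𝔪-* (-∈ (𝒪⇒ d∈)) 1≡))))
      where
      c₁∈units : c₁ ∈ A.units
      c₁∈units = decidable-stable em λ c₁∉ → proj₂ (𝔪-resp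
        (solve 2 (λ c b → (con (+ 1) :- (c :* b :+ con (+ 0))) :+ b :* c := con (+ 1)) refl (ι c₁) β)
        (𝔪-+ 1≡ (𝔪-* β∈ (𝔪⇒ (c₁∈ , c₁∉))))) 1∈units
      d = proj₁ (proj₂ c₁∈units)
      d∈ = proj₁ (proj₂ (proj₂ c₁∈units))
      c₁d≈1 : ι c₁ * ι d ≈ 1#
      c₁d≈1 = trans (sym (*-homo c₁ d)) (trans (⟦⟧-cong (proj₂ (proj₂ (proj₂ c₁∈units)))) 1#-homo)
      cd∈R : ι c * ι d ∈ R
      cd∈R = (c K.* d , sym (*-homo c d)) , *∈ (𝒪⇒ c∈) (𝒪⇒ d∈)

  -- If `L` were 𝕂, two basis vectors r and s would satisfy s r = r s. Uniqueness of coordinates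
  -- forces s = 0, and a zero basis vector contradicts uniqueness again.
  degree≥2⇒proper : ∀ q → HasDegree K.commutativeRing commutativeRing ι (suc (suc q)) → ∃ λ x → x ∉ 𝕂
  degree≥2⇒proper q (b , coordinates) = decidable-stable em λ none →
    let all∈ : ∀ x → x ∈ 𝕂
        all∈ x = decidable-stable em (λ x∉ → none (x , x∉))
    in absurd (proj₂ (all∈ (b Fin.zero))) (proj₂ (all∈ (b (Fin.suc Fin.zero))))
    where
    pair : K.Carrier → K.Carrier → Fin (suc (suc q)) → K.Carrier
    pair x y Fin.zero                = x
    pair x y (Fin.suc Fin.zero)      = y
    pair x y (Fin.suc (Fin.suc i))   = K.0#
    b₀ = b Fin.zero
    b₁ = b (Fin.suc Fin.zero)
    unique : ∀ {x y x′ y′} → ι x * b₀ + ι y * b₁ ≈ ι x′ * b₀ + ι y′ * b₁ →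
             (x K.≈ x′) × (y K.≈ y′)
    unique {x} {y} {x′} {y′} e =
      let (c , _ , u) = coordinates (combination (pair x y))
          u₁ = u (pair x y) refl
          u₂ = u (pair x′ y′) (trans (sym (+-assoc _ _ _)) (trans (+-congʳ e) (+-assoc _ _ _)))
      in K.trans (K.sym (u₁ Fin.zero)) (u₂ Fin.zero) ,
         K.trans (K.sym (u₁ (Fin.suc Fin.zero))) (u₂ (Fin.suc Fin.zero))
      where
      combination : (Fin (suc (suc q)) → K.Carrier) → Carrier
      combination c = sum (λ i → ι (c i) * b i)
    absurd : ∀ {r s} → b₀ ≈ ι r → ¬ (b₁ ≈ ι s)
    absurd {r} {s} b₀≈ b₁≈ = K.1≉0 (proj₂ (unique {K.0#} {K.1#} {K.0#} {K.0#} (+-congˡ (begin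
        ι K.1# * b₁     ≈⟨ *-congˡ b₁≈0 ⟩
        ι K.1# * 0#     ≈⟨ zeroʳ _ ⟩
        0#              ≈⟨ zeroʳ _ ⟨
        ι K.0# * 0#     ≈⟨ *-congˡ b₁≈0 ⟨
        ι K.0# * b₁     ∎))))
      where
      s≈0 : s K.≈ K.0#
      s≈0 = proj₁ (unique {s} {K.0#} {K.0#} {r} (begin
        ι s * b₀ + ι K.0# * b₁       ≈⟨ +-cong (*-congˡ b₀≈) (*-congʳ 0#-homo) ⟩
        ι s * ι r + 0# * b₁          ≈⟨ solve 3 (λ s r b → s :* r :+ con (+ 0) :* b := con (+ 0) :* s :+ r :* s) refl (ι s) (ι r) b₁ ⟩
        0# * ι s + ι r * ι s         ≈⟨ +-cong (trans (zeroˡ _) (sym (zeroˡ _))) (*-congˡ (sym b₁≈)) ⟩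
        0# * b₀ + ι r * b₁           ≈⟨ +-congʳ (*-congʳ 0#-homo) ⟨
        ι K.0# * b₀ + ι r * b₁       ∎))
      b₁≈0 : b₁ ≈ 0#
      b₁≈0 = trans b₁≈ (trans (⟦⟧-cong s≈0) 0#-homo)

-- The Kummer extension and its normalizations

module KummerExtension {ℓ} (em : ExcludedMiddle ℓ) {K L : Field ℓ} (E : Extension K L)
  {A : ValuationRing K} {O : ValuationRing L} (O/A : ExtensionDefs._LiesOver_ E O A)
  (q : ℕ) (ζ : Field.Carrier K)
  (henselian : ValuationRing.IsHenselian A)
  (residue-char : RingDefs.HasCharacteristic (ValuationRing.residueField A) (suc (suc q)))
  (ζ-primitive : Field.IsPrimitiveRootOfUnity K (suc (suc q)) ζ)
  (degree : HasDegree (Field.commutativeRing K) (Field.commutativeRing L) (Extension.ι E) (suc (suc q)))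
  (index : HasIndex (ValuationRing.valueGroup A) (ValuationRing.valueGroup O)
             (ExtensionDefs.valueMap E {O} {A} O/A) 1)
  (residueDegree : HasDegree (ValuationRing.residueField A) (ValuationRing.residueField O)
             (ExtensionDefs.residueMap E {O} {A} O/A) 1)
  where

  open Embedding em E {A} {O} O/A

  setting : Setting ℓ
  setting = record
    { em = em ; L = L ; O = O ; 𝕂 = 𝕂 ; 𝕂-subring = 𝕂-subring ; 𝕂-inverse = 𝕂-inverse ; q = suc q
    ; p∈𝔪          = Equivalence.to (residue-≈0 (suc (suc q))) (Equivalence.from (residue-char _) ∣-refl)
    ; 𝔪⇒p∣         = λ m m∈ → Equivalence.to (residue-char m) (Equivalence.from (residue-≈0 m) m∈)
    ; ζ            = Extension.ι E ζ
    ; ζ∈𝕂          = ζ , Field.refl L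
    ; ζ-primitive  =
        Field.trans L (Field.sym L (^-homo ζ (suc (suc q)))) (Field.trans L (⟦⟧-cong (proj₁ ζ-primitive)) 1#-homo) ,
        λ m 0<m m<p e → proj₂ ζ-primitive m 0<m m<p
          (ι-reflects (Field.trans L (^-homo ζ m) (Field.trans L e (Field.sym L 1#-homo))))
    ; sameValues   = index1⇒sameValues index
    ; sameResidues = degree1⇒sameResidues residueDegree
    ; proper       = degree≥2⇒proper q degree
    ; hensel       = hensel-at-0 henselian
    }

  open Setting setting using (R-subring; p; proper; module 𝕂)
  open Field L
  open ValuationRing O
  open Extension E
  open ExtensionDefs E renaming (resp to K⟨⟩-resp; inv to K⟨⟩-inv)
  open OverValuationRing A
  open Generators setting
  open IntegerSolver commutativeRing
  open Polynomials commutativeRing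
  open SetoidReasoning setoid

  private
    𝔷 = ι ζ - 1#

    𝔷≈ : ι (ζ K.- K.1#) ≈ 𝔷
    𝔷≈ = trans (minus-homo ζ K.1#) (+-congˡ (-‿cong 1#-homo))

  K⟨⟩-minimal : ∀ {S T : Pred Carrier ℓ} → IsSubring T → 𝕂 ⊆ T →
    (∀ {x y} → x ∈ T → x * y ≈ 1# → y ∈ T) → S ⊆ T → K⟨ S ⟩ ⊆ T
  K⟨⟩-minimal {S} {T} T-subring 𝕂⊆T inverse∈ S⊆T = go
    where
    module T = IsSubring T-subring
    go : K⟨ S ⟩ ⊆ T
    go (base x)           = 𝕂⊆T (x , refl)
    go (gen x∈)           = S⊆T x∈
    go (add x∈ y∈)        = T.+∈ (go x∈) (go y∈)
    go (mul x∈ y∈)        = T.*∈ (go x∈) (go y∈)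
    go (K⟨⟩-inv x∈ xy≈1)  = inverse∈ (go x∈) xy≈1
    go (K⟨⟩-resp x≈y x∈)  = T.resp x≈y (go x∈)

  Adj⊆K⟨⟩ : ∀ {S x} → x ∈ S → Adj 𝕂 x ⊆ K⟨ S ⟩
  Adj⊆K⟨⟩ {S} {x} x∈ (_ , y∈) = go y∈
    where
    go : ∀ {n} → Pol 𝕂 x n ⊆ K⟨ S ⟩
    go (nil e)                 = K⟨⟩-resp (trans 0#-homo (sym e)) (base K.0#)
    go (cons (s , s≈) w∈ e) =
      K⟨⟩-resp (sym (trans e (+-congʳ s≈))) (add (base s) (mul (gen x∈) (go w∈)))

  -- All roots of Xᵖ = h are of the form ζʲ x, and K[x] is closed under inverses, so it contains the
  -- field that the roots generate. If x were 0, every root would be 0 and `L` would equal 𝕂.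
  𝔄⇒generates : ∀ {h x} → h ∈ 𝔄 p → x ^ p ≈ ι h → ∀ y → y ∈ Adj 𝕂 x
  𝔄⇒generates {h} {x} (_ , generated) x^p≈h y = K⟨⟩-minimal (adj-subring 𝕂-subring) (adj-S 𝕂-subring)
    (adj-inverse (h , x^p≈h) x≉0) solution∈ (generated y)
    where
    x≉0 : ¬ (x ≈ 0#)
    x≉0 x≈0 = proj₂ proper (K⟨⟩-minimal 𝕂-subring id 𝕂-inverse solution∈𝕂 (generated (proj₁ proper)))
      where
      solution∈𝕂 : ∀ {z} → z ^ p ≈ ι h → z ∈ 𝕂
      solution∈𝕂 {z} z^p≈h = K.0# , decidable-stable em λ z≉0 →
        power≉0 {z} p (λ z≈0 → z≉0 (trans z≈0 (sym 0#-homo)))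
          (trans z^p≈h (trans (sym x^p≈h) (trans (*-congʳ x≈0) (zeroˡ _))))
    solution∈ : ∀ {z} → z ^ p ≈ ι h → z ∈ Adj 𝕂 x
    solution∈ z^p≈h = let (j , _ , z≈) = ^p-injective x≉0 (trans z^p≈h (sym x^p≈h))
                          module Adj = IsSubring (adj-subring 𝕂-subring {x})
      in Adj.resp (sym z≈) (Adj.*∈ (adj-S 𝕂-subring (proj₁ (ζ^∈R j))) (adj-gen 𝕂-subring))

  𝒮⇒generator : ∀ {α} → α ∈ 𝒮 p → Generator α
  𝒮⇒generator (h , (h∈𝔄 , h∈units , h-1∈𝔪) , α^p≈h) = record
    { α^p∈𝕂     = h , α^p≈h
    ; α≡1       = ^p≡1⇒≡1 (𝔪-resp (trans (minus-homo h K.1#) (+-cong (sym α^p≈h) (-‿cong 1#-homo))) (𝔪⇒ h-1∈𝔪))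
    ; generates = 𝔄⇒generates h∈𝔄 α^p≈h
    }

  generator⇒𝒮 : ∀ {α} → Generator α → α ∈ 𝒮 p
  generator⇒𝒮 {α} generator =
    let (h , α^p≈h) = α^p∈𝕂 in
    h , (((α , α^p≈h) , λ y → Adj⊆K⟨⟩ α^p≈h (generates y)) ,
         units⇐ (units-resp α^p≈h (units-^ p α∈units)) ,
         𝔪⇐ (𝔪-resp (trans (+-cong α^p≈h (-‿cong (sym 1#-homo))) (sym (minus-homo h K.1#)))
              (power≡1 p α≡1 (proj₁ α∈units)))) ,
    α^p≈h
    where open Generator generator

  B⊆𝒪 : B ⊆ 𝒪
  B⊆𝒪 x∈ = integrallyClosed proj₂ (proj₂ (B⇒Integral x∈))

  approximant⇒normalization : ∀ {α c u} → Approximant α c u → IsNormalization ζ α u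
  approximant⇒normalization {α} {c} {u} approx =
    let (γ , γ∈ , conductor≈γ) = R⇒ (conductor∈R approx)
        (v , v∈ , uv≈1)        = inverse∈Adj approx
    in (γ , γ∈ , (begin
          u * ι (ζ K.- K.1#)            ≈⟨ *-congˡ (trans 𝔷≈ (ζ-1≈ approx)) ⟩
          u * (conductor approx * c)    ≈⟨ solve 3 (λ u g c → u :* (g :* c) := g :* (c :* u)) refl u _ c ⟩
          conductor approx * (c * u)    ≈⟨ *-cong (sym conductor≈γ) α-1≈cu ⟨
          ι γ * (α - 1#)                ∎)) ,
       Integral⇒B (adj⊆integral approx (adj-gen R-subring)) , v ,
       Integral⇒B (adj⊆integral approx v∈) , uv≈1
    where open Approximant approx

  -- Here c = (ζ - 1) / γ, with γ nonzero since α′ and ζ - 1 are. What holds for approximants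
  -- therefore holds for every admissible choice of γ.
  normalization⇒approximant : ∀ {α α′} → Generator α → IsNormalization ζ α α′ →
                              ∃ λ c → Approximant α c α′
  normalization⇒approximant {α} {α′} generator ((γ , γ∈ , e) , α′∈B , w , w∈B , α′w≈1) =
    𝔷 * ι γ ⁻¹ , record
      { generator = generator
      ; c∈𝕂       = 𝕂.*∈ 𝔷∈𝕂 (⁻¹∈𝕂 (γ , refl) γ≉0)
      ; c≉0       = ≉0-* ζ-1≉0 (factor≉0ˡ (trans (*-comm _ _) (inverseʳ γ≉0)))
      ; u∈units   = B⊆𝒪 α′∈B , w , B⊆𝒪 w∈B , α′w≈1
      ; α-1≈cu    = cancelˡ γ≉0 (begin
          ι γ * (α - 1#)             ≈⟨ e ⟨
          α′ * ι (ζ K.- K.1#)        ≈⟨ *-congˡ 𝔷≈ ⟩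
          α′ * 𝔷                     ≈⟨ *-identityˡ _ ⟨
          1# * (α′ * 𝔷)              ≈⟨ *-congʳ (inverseʳ γ≉0) ⟨
          ι γ * ι γ ⁻¹ * (α′ * 𝔷)    ≈⟨ solve 4 (λ g v a z → g :* v :* (a :* z) := g :* (z :* v :* a))
                                          refl (ι γ) (ι γ ⁻¹) α′ 𝔷 ⟩
          ι γ * (𝔷 * ι γ ⁻¹ * α′)    ∎)
      }
    where
    𝔷∈𝕂 : 𝔷 ∈ 𝕂
    𝔷∈𝕂 = ζ K.- K.1# , sym 𝔷≈
    γ≉0 : ¬ (ι γ ≈ 0#)
    γ≉0 γ≈0 = ≉0-* (factor≉0ˡ α′w≈1) ζ-1≉0
      (trans (*-congˡ (sym 𝔷≈)) (trans e (trans (*-congʳ γ≈0) (zeroˡ _))))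

  normalization-scalar : ∀ {α c u} → Approximant α c u →
    ∃ λ k → ¬ (k K.≈ K.0#) × u ≈ (α - 1#) * ι k
  normalization-scalar {α} {c} {u} approx =
    let (k , c⁻¹≈) = ⁻¹∈𝕂 c∈𝕂 c≉0 in
    k ,
    (λ k≈0 → factor≉0ˡ (trans (*-comm _ _) (inverseʳ c≉0)) (trans c⁻¹≈ (trans (⟦⟧-cong k≈0) 0#-homo))) ,
    (begin
      u                    ≈⟨ *-identityˡ u ⟨
      1# * u               ≈⟨ *-congʳ (inverseʳ c≉0) ⟨
      c * c ⁻¹ * u         ≈⟨ solve 3 (λ c v u → c :* v :* u := c :* u :* v) refl c (c ⁻¹) u ⟩
      c * u * c ⁻¹         ≈⟨ *-cong (sym α-1≈cu) c⁻¹≈ ⟩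
      (α - 1#) * ι k       ∎)
    where open Approximant approx

  normalizations : ∀ α → α ∈ 𝒮 p → (∃ λ α′ → IsNormalization ζ α α′) ×
    (∀ α′ → IsNormalization ζ α α′ →
      (∃ λ c → ¬ (c K.≈ K.0#) × α′ ≈ (α - 1#) * ι c) × A[ α′ ] ⊆ B)
  normalizations α α∈ =
    (let (_ , u , approx) = approximant generator in u , approximant⇒normalization approx) ,
    λ α′ normal → let (_ , approx) = normalization⇒approximant generator normal in
      normalization-scalar approx , λ y∈ → Integral⇒B (adj⊆integral approx (A[]⇒Adj y∈))
    where generator = 𝒮⇒generator α∈

  chain : ∀ α₁ α₂ α₁′ α₂′ → α₁ ∈ 𝒮 p → α₂ ∈ 𝒮 p →
    IsNormalization ζ α₁ α₁′ → IsNormalization ζ α₂ α₂′ →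
    A[ α₁′ ] ⊆ A[ α₂′ ] ⊎ A[ α₂′ ] ⊆ A[ α₁′ ]
  chain α₁ α₂ α₁′ α₂′ α₁∈ α₂∈ normal₁ normal₂ = Sum.map
    (λ ⊆₂ y∈ → Adj⇒A[] (⊆₂ (A[]⇒Adj y∈)))
    (λ ⊆₁ y∈ → Adj⇒A[] (⊆₁ (A[]⇒Adj y∈)))
    (comparable (proj₂ (normalization⇒approximant (𝒮⇒generator α₁∈) normal₁))
                (proj₂ (normalization⇒approximant (𝒮⇒generator α₂∈) normal₂)))

  union : IsKummer p → ∀ β → β ∈ B →
    ∃ λ α → α ∈ 𝒮 p × (∀ α′ → IsNormalization ζ α α′ → β ∈ A[ α′ ])
  union (h , h∈𝔄@((x , x^p≈h) , _)) β β∈ =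
    -- The element of 𝔄 need not be ≡ 1; normalizing its root produces the first element of 𝒮.
    let (_ , generator₀)       = normalize (h , x^p≈h) (𝔄⇒generates h∈𝔄 x^p≈h)
        (α , _ , _ , approx , β∈Adj) = exhausts generator₀ (B⊆𝒪 β∈)
        generator = Approximant.generator approx
    in α , generator⇒𝒮 generator , λ α′ normal →
       Adj⇒A[] (approximant-unique approx (proj₂ (normalization⇒approximant generator normal)) β∈Adj)

theorem5p1 : ∀ {ℓ} → ExcludedMiddle ℓ →
    (K L : Field ℓ) (E : Extension K L) →
    let module K = Field K
        module L = Field L
        open Extension E
        open ExtensionDefs E
    in
    (A : ValuationRing K) (O : ValuationRing L) (O/A : O LiesOver A) →
    let module A = ValuationRing A
        open OverValuationRing A
    in
    (p : ℕ) (ζ : K.Carrier) →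
    K.HasCharacteristic 0 →
    A.IsHenselian →
    0 < p →
    RingDefs.HasCharacteristic A.residueField p →
    K.IsPrimitiveRootOfUnity p ζ →
    HasDegree K.commutativeRing L.commutativeRing ι p →
    IsKummer p →
    HasDefect {O} {A} O/A p p →
    (∀ α → α ∈ 𝒮 p →
      (∃ λ α′ → IsNormalization ζ α α′) ×
      (∀ α′ → IsNormalization ζ α α′ →
        (∃ λ c → ¬ (c K.≈ K.0#) × α′ L.≈ (α L.- L.1#) L.* ι c) ×
        A[ α′ ] ⊆ B)) ×
    (∀ α₁ α₂ α₁′ α₂′ → α₁ ∈ 𝒮 p → α₂ ∈ 𝒮 p →
      IsNormalization ζ α₁ α₁′ → IsNormalization ζ α₂ α₂′ →
      A[ α₁′ ] ⊆ A[ α₂′ ] ⊎ A[ α₂′ ] ⊆ A[ α₁′ ]) ×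
    (∀ β → β ∈ B →
      ∃ λ α → α ∈ 𝒮 p × (∀ α′ → IsNormalization ζ α α′ → β ∈ A[ α′ ]))
-- For p = 1 the residue field would satisfy 1 = 0.
theorem5p1 em K L E A O O/A (suc zero) ζ _ _ _ residue-char _ _ _ _ = contradiction
  (A.𝔪-resp (K.trans (K.+-cong (K.+-identityʳ K.1#) (K.trans (K.sym (K.+-identityˡ _)) (K.-‿inverseʳ K.0#)))
    (K.+-identityʳ K.1#)) (Equivalence.from (residue-char 1) ∣-refl))
  λ { (_ , 1∉) → 1∉ (A.1∈ , K.1# , A.1∈ , K.*-identityˡ K.1#) }
  where
  module K = Field K
  module A = ValuationRing A
theorem5p1 em K L E A O O/A (suc (suc q)) ζ _ henselian _ residue-char ζ-primitive degree kummer
  (e , f , index , residueDegree , p≡pef) = normalizations , chain , union kummer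
  where
  ef≡1 : e ℕ.* f ≡ 1
  ef≡1 = ℕ.*-cancelˡ-≡ (e ℕ.* f) 1 (suc (suc q))
    (≡.trans (≡.sym (ℕ.*-assoc (suc (suc q)) e f)) (≡.trans (≡.sym p≡pef) (≡.sym (ℕ.*-identityʳ (suc (suc q))))))
  open KummerExtension em E {A} {O} O/A q ζ henselian residue-char ζ-primitive degree
    (≡.subst (HasIndex (ValuationRing.valueGroup A) (ValuationRing.valueGroup O)
               (ExtensionDefs.valueMap E {O} {A} O/A)) (ℕ.m*n≡1⇒m≡1 e f ef≡1) index)
    (≡.subst (HasDegree (ValuationRing.residueField A) (ValuationRing.residueField O)
               (ExtensionDefs.residueMap E {O} {A} O/A)) (ℕ.m*n≡1⇒n≡1 e f ef≡1) residueDegree)
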